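{- For all integers $k\ge1$ and $n\ge0$, $$e_4(5^kn+\delta_{5,k})\equiv0\pmod{5^k}.$$
   Context: $q=e^{2\pi i\tau}$, $(q;q)_\infty=\prod_{n\ge1}(1-q^n)$, $E_4(\tau)=1+240\sum_{n\ge1}\sigma_3(n)q^n$ with $\sigma_3(n)=\sum_{d\mid n}d^3$. The numbers $e_4(n)$ are defined by $\sum_{n\ge0}e_4(n)q^n=E_4(\tau)/(q;q)_\infty$. For a prime $\ell\ge5$ and $k\ge1$, $\delta_{\ell,k}$ denotes the integer with $0<\delta_{\ell,k}<\ell^k$ and $24\delta_{\ell,k}\equiv1\pmod{\ell^k}$. -}

module Defs where

open import Data.Nat as ℕ using (ℕ; zero; suc; _∸_; _^_)
open import Data.Nat.Divisibility using (_∣?_)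
open import Data.Integer as ℤ using (ℤ; +_; -_; _+_; _*_)
open import Relation.Nullary.Decidable using (does)
open import Data.Bool using (if_then_else_)

Series : Set
Series = ℕ → ℤ

sumTo : ℕ → (ℕ → ℤ) → ℤ
sumTo zero    f = f 0
sumTo (suc n) f = sumTo n f + f (suc n)

_⊛_ : Series → Series → Series
(f ⊛ g) n = sumTo n (λ i → f i * g (n ∸ i))

one : Series
one zero    = + 1
one (suc _) = + 0

σ₃ : ℕ → ℕ
σ₃ n = go n
  where
  go : ℕ → ℕ
  go zero    = 0
  go (suc d) = go d ℕ.+ (if does (suc d ∣? n) then suc d ^ 3 else 0)

E₄ : Series
E₄ zero    = + 1
E₄ (suc n) = + (240 ℕ.* σ₃ (suc n))

-- 1/(1 - q^m) = Σ_{j≥0} q^{m j}, for m ≥ 1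
geom : ℕ → Series
geom m i = if does (m ∣? i) then + 1 else + 0

invPochTrunc : ℕ → Series
invPochTrunc zero    = one
invPochTrunc (suc N) = invPochTrunc N ⊛ geom (suc N)

-- 1/(q;q)_∞ : the coefficient of qⁿ only involves factors with m ≤ n
invPoch : Series
invPoch n = invPochTrunc n n

e₄ : ℕ → ℤ
e₄ = E₄ ⊛ invPoch

-- Write E = (q;q)∞, V f(q) = f(q⁵), U(∑ aₙ qⁿ) = ∑ a₅ₙ qⁿ and θ = q d/dq.
--
-- Euler's pentagonal series splits by exponents mod 5 as E = A + B - y with y = q E(q²⁵); since Jacobi's series for E³ has
-- no exponent ≡ 2 mod 5, AB = -y².  Comparing logarithmic derivatives of the norm of E with U(∑ σ(n) qⁿ) then gives the
-- modular equation E(q⁵)⁶ = E(q²⁵) (E⁵ + 5 E⁴ y + 15 E³ y² + 25 E² y³ + 25 E y⁴).  With z = y/E and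
-- φ(z) = 1 + 5 z + 15 z² + 25 z³ + 25 z⁴, the hauptmodul t = q E(q⁵)⁶/E⁶ satisfies t = z φ(z) and z⁵ = φ(z) V t.
--
-- The w² coefficient of the triple product in w = z + 1/z - 2 yields Ramanujan's E₄ = E₂² - 12 θ E₂.  Both
-- P = (5 E₂(q⁵) - E₂)/4 and E₄ are identified with eta quotients by one principle: if Δ a = V(Δ) b with a(0) = 1 and
-- Δ(0) = 0 then Δ = 0.  The result is E₄ = E¹⁰/E(q⁵)² (1 + 250 t + 3125 t²).
--
-- Put Θ = 125 t and Z = 5 z.  Then Θ ∈ ℤ[Z], and Z is integral of degree 5 over ℤ[V Θ].  Hence for f = q E⁴ E(q⁵)³ and
-- g = q E³ E(q⁵)⁴ finitely many values of U show U(f ℤ[Θ]) ⊆ 5 g ℤ[Θ] and U(q g ℤ[Θ]) ⊆ 5 f ℤ[Θ], so each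
-- extraction of an arithmetic progression from E₄/E gains a factor 5.
module Submission where

open import Defs

-- No theory of modular forms is available, so identities that would follow from a dimension count
-- come from recursion on coefficients: θ f = a f with a(0) = 0 fixes f up to its constant term, and
-- a dilation equation fixes its solution. Infinite sums and products enter as stable sequences of
-- finite identities, compared modulo q^{N+1} for every N. The constants 250 and 3125 mirror those
-- of E₄(q⁵): replacing t by 1/(125 t) exchanges 1 + 250 t + 3125 t² with a multiple of 1 + 10 t + 5
-- t², and maps 1 + 22 t + 125 t² to a multiple of itself. The scale 125 also makes Θ monic in Z. U
-- is linear over ℤ[V Θ] but not over ℤ[Θ]; hence the detour through powers of Z. Two modules
-- alternate because the powers of 5 are 1 and 5 modulo 24 in turn. The start is exceptional: E₄/E =
-- (g/t)(1 + 250 t + 3125 t²) has a leading term outside g ℤ[Θ], so the first extraction needs the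
-- separate value U(q E⁹).

-- Triangular and pentagonal exponents, and the weights of the theta series.

module TriangularNumbers where
  open import Data.Nat using (ℕ; zero; suc; z≤n; _+_; _*_; _≤_)
  open import Data.Nat.Properties using (m≤n+m; *-cancelˡ-≡; *-assoc; +-cancelʳ-≡)
  open import Data.Nat.Tactic.RingSolver using (solve-∀)
  open import Relation.Binary.PropositionalEquality using (_≡_; refl; sym; trans; cong; cong₂)

  triangle : ℕ → ℕ
  triangle zero    = 0
  triangle (suc n) = triangle n + suc n

  n≤triangle : ∀ n → n ≤ triangle n
  n≤triangle zero    = z≤n
  n≤triangle (suc n) = m≤n+m (suc n) (triangle n)

  -- This is m (5 m + 1) / 2, the fifth part of `triangle (m * 5)`; the recursion by differences
  -- avoids division.
  fifthTriangle : ℕ → ℕ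
  fifthTriangle zero    = 0
  fifthTriangle (suc m) = fifthTriangle m + 5 * m + 3

  triangle-*5 : ∀ m → triangle (m * 5) ≡ fifthTriangle m * 5
  triangle-*5 zero    = refl
  triangle-*5 (suc m) = trans (step (triangle (m * 5)) m)
    (trans (cong (λ t → t + 25 * m + 15) (triangle-*5 m)) (collect (fifthTriangle m) m))
    where
    step : ∀ t m → t + suc (m * 5) + suc (suc (m * 5)) + suc (suc (suc (m * 5)))
           + suc (suc (suc (suc (m * 5)))) + suc (suc (suc (suc (suc (m * 5))))) ≡ t + 25 * m + 15
    step = solve-∀
    collect : ∀ v m → v * 5 + 25 * m + 15 ≡ (v + 5 * m + 3) * 5
    collect = solve-∀

  fifthTriangle-triangle : ∀ m → fifthTriangle m + 2 * m ≡ triangle m * 5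
  fifthTriangle-triangle zero    = refl
  fifthTriangle-triangle (suc m) = trans (split (fifthTriangle m) m)
    (trans (cong (_+ suc m * 5) (fifthTriangle-triangle m)) (collect (triangle m) m))
    where
    split : ∀ v m → v + 5 * m + 3 + 2 * suc m ≡ v + 2 * m + suc m * 5
    split = solve-∀
    collect : ∀ t m → t * 5 + suc m * 5 ≡ (t + suc m) * 5
    collect = solve-∀

  triangle-+ : ∀ i n → triangle (i + n) ≡ triangle i + (i * n + triangle n)
  triangle-+ zero    n = refl
  triangle-+ (suc i) n = trans (cong (_+ suc (i + n)) (triangle-+ i n)) (collect (triangle i) (triangle n) i n)
    where
    collect : ∀ t u i n → t + (i * n + u) + suc (i + n) ≡ t + suc i + (n + i * n + u)
    collect = solve-∀

  triangle-shift : ∀ i m → triangle (i + m * 5) ≡ triangle i + (i * m + fifthTriangle m) * 5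
  triangle-shift i m = trans (triangle-+ i (m * 5))
    (trans (cong (λ t → triangle i + (i * (m * 5) + t)) (triangle-*5 m))
      (collect (triangle i) (fifthTriangle m) i m))
    where
    collect : ∀ t v i m → t + (i * (m * 5) + v * 5) ≡ t + (i * m + v) * 5
    collect = solve-∀

  squareTriangle-shift : ∀ s i m → (s + m * 5) * (s + m * 5) + triangle (i + m * 5) ≡
    s * s + triangle i + (2 * s * m + 5 * m * m + (i * m + fifthTriangle m)) * 5
  squareTriangle-shift s i m = trans (cong ((s + m * 5) * (s + m * 5) +_) (triangle-shift i m))
    (collect s (triangle i) (i * m + fifthTriangle m) m)
    where
    collect : ∀ s t v m → (s + m * 5) * (s + m * 5) + (t + v * 5) ≡
              s * s + t + (2 * s * m + 5 * m * m + v) * 5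
    collect = solve-∀

  -- With k = n + 1 these are k (3 k - 1) / 2 and k (3 k + 1) / 2; the form square plus triangle
  -- lets `squareTriangle-shift` serve both.
  pentagonal⁻ pentagonal⁺ : ℕ → ℕ
  pentagonal⁻ n = suc n * suc n + triangle n
  pentagonal⁺ n = suc n * suc n + triangle (suc n)

  -- For p = k (3 k ± 1) / 2 one has 24 p + 1 = (6 k ± 1)². Here k = 4 + 5 m and 6 k + 1 = 5 (6 (m +
  -- 1) - 1), which exchanges the two signs; below, k = 6 + 5 m and 6 k - 1 = 5 (6 (m + 1) + 1).
  pentagonal⁺-scale : ∀ m → pentagonal⁺ (3 + m * 5) ≡ suc (5 * (5 * pentagonal⁻ m))
  pentagonal⁺-scale m = trans (squareTriangle-shift 4 4 m) (trans (split m (fifthTriangle m))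
    (trans (cong (λ v → suc (25 * (suc m * suc m) + 5 * v)) (fifthTriangle-triangle m))
      (collect m (triangle m))))
    where
    split : ∀ m v → 26 + (8 * m + 5 * m * m + (4 * m + v)) * 5 ≡
            suc (25 * (suc m * suc m) + 5 * (v + 2 * m))
    split = solve-∀
    collect : ∀ m t → suc (25 * (suc m * suc m) + 5 * (t * 5)) ≡
              suc (5 * (5 * (suc m * suc m + t)))
    collect = solve-∀

  pentagonal⁻-scale : ∀ m → pentagonal⁻ (5 + m * 5) ≡ suc (5 * (5 * pentagonal⁺ m))
  pentagonal⁻-scale m = trans (squareTriangle-shift 6 5 m) (trans (split m (fifthTriangle m))
    (trans (cong (λ v → suc (25 * (suc m * suc m) + 25 * suc m + 5 * v)) (fifthTriangle-triangle m))
      (collect m (triangle m))))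
    where
    split : ∀ m v → 51 + (12 * m + 5 * m * m + (5 * m + v)) * 5 ≡
            suc (25 * (suc m * suc m) + 25 * suc m + 5 * (v + 2 * m))
    split = solve-∀
    collect : ∀ m t → suc (25 * (suc m * suc m) + 25 * suc m + 5 * (t * 5)) ≡
              suc (5 * (5 * (suc m * suc m + (t + suc m))))
    collect = solve-∀

  -- With w = z + 1/z - 2, s₀ j + s₁ j w + s₂ j w² + … = (z^{j+1/2} - z^{-j-1/2}) / (z^{1/2} - z^{-1/2}); s₂′ is the first
  -- difference of s₂.
  s₀ s₁ s₂ s₂′ : ℕ → ℕ
  s₀ j = suc (2 * j)
  s₁ zero    = 0
  s₁ (suc j) = s₁ j + suc j * suc j
  s₂′ zero    = 0
  s₂′ (suc j) = s₂′ j + s₁ (suc j)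
  s₂ zero    = 0
  s₂ (suc j) = s₂ j + s₂′ j

  2*triangle : ∀ j → 2 * triangle j ≡ j * suc j
  2*triangle zero    = refl
  2*triangle (suc j) = trans (split (triangle j) j) (trans (cong (_+ 2 * suc j) (2*triangle j)) (collect j))
    where
    split : ∀ t j → 2 * (t + suc j) ≡ 2 * t + 2 * suc j
    split = solve-∀
    collect : ∀ j → j * suc j + 2 * suc j ≡ suc j * suc (suc j)
    collect = solve-∀

  -- θ multiplies q^{triangle j} by `triangle j`, so the theta series weighted by `s₁` becomes a
  -- third of the θ-derivative of the one weighted by `s₀`.
  s₁-closed : ∀ j → 3 * s₁ j ≡ triangle j * s₀ j
  s₁-closed zero    = refl
  s₁-closed (suc j) = *-cancelˡ-≡ _ _ 2 (trans (split (s₁ j) j)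
    (trans (cong (λ a → 2 * a + 6 * (suc j * suc j)) (s₁-closed j)) (trans (regroup (triangle j) j)
    (trans (cong (λ a → a * suc (2 * j) + 6 * (suc j * suc j)) (2*triangle j)) (trans (expand j)
    (trans (cong (λ a → a * s₀ (suc j)) (sym (2*triangle (suc j)))) (*-assoc 2 (triangle (suc j)) (s₀ (suc j)))))))))
    where
    split : ∀ s j → 2 * (3 * (s + suc j * suc j)) ≡ 2 * (3 * s) + 6 * (suc j * suc j)
    split = solve-∀
    regroup : ∀ t j → 2 * (t * suc (2 * j)) + 6 * (suc j * suc j) ≡
              2 * t * suc (2 * j) + 6 * (suc j * suc j)
    regroup = solve-∀
    expand : ∀ j → j * suc j * suc (2 * j) + 6 * (suc j * suc j) ≡
             suc j * suc (suc j) * suc (2 * suc j)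
    expand = solve-∀

  6*s₁ : ∀ j → 6 * s₁ j ≡ j * suc j * s₀ j
  6*s₁ j = trans (*-assoc 2 3 (s₁ j)) (trans (cong (2 *_) (s₁-closed j))
    (trans (sym (*-assoc 2 (triangle j) (s₀ j))) (cong (_* s₀ j) (2*triangle j))))

  12*s₂′ : ∀ j → 12 * s₂′ j ≡ j * (suc j * suc j) * suc (suc j)
  12*s₂′ zero    = refl
  12*s₂′ (suc j) = trans (split (s₂′ j) (s₁ (suc j))) (trans
    (cong₂ (λ a b → a + 2 * b) (12*s₂′ j) (6*s₁ (suc j))) (collect j))
    where
    split : ∀ a b → 12 * (a + b) ≡ 12 * a + 2 * (6 * b)
    split = solve-∀
    collect : ∀ j → j * (suc j * suc j) * suc (suc j) + 2 * (suc j * suc (suc j) * suc (2 * suc j)) ≡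
              suc j * (suc (suc j) * suc (suc j)) * suc (suc (suc j))
    collect = solve-∀

  120*s₂ : ∀ j → 120 * s₂ j + 2 * (s₀ j * (j * suc j)) ≡ s₀ j * (j * suc j) * (j * suc j)
  120*s₂ zero    = refl
  120*s₂ (suc j) = +-cancelʳ-≡ (2 * (suc (2 * j) * (j * suc j))) _ _ (trans (split (s₂ j) (s₂′ j) j)
    (trans (cong₂ (λ a b → a + 10 * b + 2 * (suc (2 * suc j) * (suc j * suc (suc j)))) (120*s₂ j) (12*s₂′ j)) (collect j)))
    where
    split : ∀ a b j → 120 * (a + b) + 2 * (suc (2 * suc j) * (suc j * suc (suc j))) + 2 * (suc (2 * j) * (j * suc j)) ≡
      120 * a + 2 * (suc (2 * j) * (j * suc j)) + 10 * (12 * b) + 2 * (suc (2 * suc j) * (suc j * suc (suc j)))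
    split = solve-∀
    collect : ∀ j → suc (2 * j) * (j * suc j) * (j * suc j) + 10 * (j * (suc j * suc j) * suc (suc j))
      + 2 * (suc (2 * suc j) * (suc j * suc (suc j))) ≡
      suc (2 * suc j) * (suc j * suc (suc j)) * (suc j * suc (suc j)) + 2 * (suc (2 * j) * (j * suc j))
    collect = solve-∀

  -- A second θ-derivative carries the squared weight `triangle j`, which is thereby reduced to `s₂`
  -- and the first derivative. The subtracted term stands on the left because the weights are
  -- natural numbers.
  s₂-closed : ∀ j → 30 * s₂ j + triangle j * s₀ j ≡ triangle j * (triangle j * s₀ j)
  s₂-closed j = *-cancelˡ-≡ _ _ 4 (trans (split (s₂ j) (triangle j) (s₀ j)) (trans
    (cong (λ a → 120 * s₂ j + 2 * (s₀ j * a)) (2*triangle j)) (trans (120*s₂ j) (trans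
    (cong (λ a → s₀ j * a * a) (sym (2*triangle j))) (collect (triangle j) (s₀ j))))))
    where
    split : ∀ a t s → 4 * (30 * a + t * s) ≡ 120 * a + 2 * (s * (2 * t))
    split = solve-∀
    collect : ∀ t s → s * (2 * t) * (2 * t) ≡ 4 * (t * (t * s))
    collect = solve-∀

-- The commutative ring of formal power series over ℤ.

module PowerSeries where

  open import Algebra.Bundles using (CommutativeRing)
  open import Algebra.Structures using (IsCommutativeRing)
  open import Data.Integer using (ℤ; +_; -_; _+_; _*_)
  open import Data.Integer.Properties
  open import Data.Nat as ℕ using (ℕ; zero; suc; _∸_; z≤n)
  import Data.Nat.Properties as ℕₚ
  open import Data.Product using (_,_)
  open import Function using (_∘_)
  open import Level using (0ℓ)
  open import Relation.Binary.PropositionalEquality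

  sumTo-cong : ∀ n {f g : Series} → (∀ i → i ℕ.≤ n → f i ≡ g i) → sumTo n f ≡ sumTo n g
  sumTo-cong zero    f≡g = f≡g 0 z≤n
  sumTo-cong (suc n) f≡g =
    cong₂ _+_ (sumTo-cong n λ i i≤n → f≡g i (ℕₚ.m≤n⇒m≤1+n i≤n)) (f≡g (suc n) ℕₚ.≤-refl)

  sumTo-zero : ∀ n → sumTo n (λ _ → + 0) ≡ + 0
  sumTo-zero zero    = refl
  sumTo-zero (suc n) = trans (+-identityʳ _) (sumTo-zero n)

  +-interchange : ∀ a b c d → (a + b) + (c + d) ≡ (a + c) + (b + d)
  +-interchange a b c d = begin
    (a + b) + (c + d) ≡⟨ +-assoc a b (c + d) ⟩
    a + (b + (c + d)) ≡⟨ cong (_+_ a) (sym (+-assoc b c d)) ⟩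
    a + ((b + c) + d) ≡⟨ cong (λ e → a + (e + d)) (+-comm b c) ⟩
    a + ((c + b) + d) ≡⟨ cong (_+_ a) (+-assoc c b d) ⟩
    a + (c + (b + d)) ≡⟨ sym (+-assoc a c (b + d)) ⟩
    (a + c) + (b + d) ∎
    where open ≡-Reasoning

  sumTo-+ : ∀ n (f g : Series) → sumTo n (λ i → f i + g i) ≡ sumTo n f + sumTo n g
  sumTo-+ zero    f g = refl
  sumTo-+ (suc n) f g = trans (cong (_+ (f (suc n) + g (suc n))) (sumTo-+ n f g))
    (+-interchange (sumTo n f) (sumTo n g) (f (suc n)) (g (suc n)))

  sumTo-*ˡ : ∀ n c (f : Series) → sumTo n (λ i → c * f i) ≡ c * sumTo n f
  sumTo-*ˡ zero    c f = refl
  sumTo-*ˡ (suc n) c f = trans (cong (_+ c * f (suc n)) (sumTo-*ˡ n c f))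
    (sym (*-distribˡ-+ c (sumTo n f) (f (suc n))))

  sumTo-head : ∀ n (f : Series) → sumTo (suc n) f ≡ f 0 + sumTo n (f ∘ suc)
  sumTo-head zero    f = refl
  sumTo-head (suc n) f = trans (cong (_+ f (suc (suc n))) (sumTo-head n f))
    (+-assoc (f 0) (sumTo n (f ∘ suc)) (f (suc (suc n))))

  infix 4 _≈_
  -- A record rather than a bare Π-type, so that unification recovers f and g from a proof.
  record _≈_ (f g : Series) : Set where
    constructor pointwise
    field at : ∀ n → f n ≡ g n
  open _≈_ public

  tail : Series → Series
  tail f n = f (suc n)

  ⊛-suc : ∀ f g n → (f ⊛ g) (suc n) ≡ f 0 * g (suc n) + (tail f ⊛ g) n
  ⊛-suc f g n = sumTo-head n (λ i → f i * g (suc n ∸ i))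

  ⊛-sucʳ : ∀ f g n → (f ⊛ g) (suc n) ≡ (f ⊛ tail g) n + f (suc n) * g 0
  ⊛-sucʳ f g n = cong₂ _+_
    (sumTo-cong n λ i i≤n → cong (λ k → f i * g k) (ℕₚ.+-∸-assoc 1 i≤n))
    (cong (λ k → f (suc n) * g k) (ℕₚ.n∸n≡0 n))

  ⊛-cong : ∀ {f f′ g g′ : Series} n → (∀ i → i ℕ.≤ n → f i ≡ f′ i) → (∀ i → i ℕ.≤ n → g i ≡ g′ i) →
           (f ⊛ g) n ≡ (f′ ⊛ g′) n
  ⊛-cong n f≡f′ g≡g′ = sumTo-cong n λ i i≤n → cong₂ _*_ (f≡f′ i i≤n) (g≡g′ (n ∸ i) (ℕₚ.m∸n≤m n i))

  -- Peeling the first summand of one product matches peeling the last summand of the other; the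
  -- tail falls to the induction hypothesis.
  ⊛-comm : ∀ f g n → (f ⊛ g) n ≡ (g ⊛ f) n
  ⊛-comm f g zero    = *-comm (f 0) (g 0)
  ⊛-comm f g (suc n) = begin
    (f ⊛ g) (suc n)                      ≡⟨ ⊛-suc f g n ⟩
    f 0 * g (suc n) + (tail f ⊛ g) n     ≡⟨ cong₂ _+_ (*-comm (f 0) (g (suc n))) (⊛-comm (tail f) g n) ⟩
    g (suc n) * f 0 + (g ⊛ tail f) n     ≡⟨ +-comm (g (suc n) * f 0) _ ⟩
    (g ⊛ tail f) n + g (suc n) * f 0     ≡⟨ sym (⊛-sucʳ g f n) ⟩
    (g ⊛ f) (suc n)                      ∎
    where open ≡-Reasoning

  ⊛-distribʳ : ∀ f g h n → ((λ i → g i + h i) ⊛ f) n ≡ (g ⊛ f) n + (h ⊛ f) n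
  ⊛-distribʳ f g h n = trans
    (sumTo-cong n λ i _ → *-distribʳ-+ (f (n ∸ i)) (g i) (h i))
    (sumTo-+ n (λ i → g i * f (n ∸ i)) (λ i → h i * f (n ∸ i)))

  ⊛-scaleˡ : ∀ c f g n → ((λ i → c * f i) ⊛ g) n ≡ c * (f ⊛ g) n
  ⊛-scaleˡ c f g n = trans
    (sumTo-cong n λ i _ → *-assoc c (f i) (g (n ∸ i)))
    (sumTo-*ˡ n c (λ i → f i * g (n ∸ i)))

  -- Induction on n for all f at once: f is its constant term plus q times `tail f`; the constant
  -- acts by scaling and the tail falls to the induction hypothesis.
  ⊛-assoc : ∀ f g h n → ((f ⊛ g) ⊛ h) n ≡ (f ⊛ (g ⊛ h)) n
  ⊛-assoc f g h zero    = *-assoc (f 0) (g 0) (h 0)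
  ⊛-assoc f g h (suc n) = begin
    ((f ⊛ g) ⊛ h) (suc n)
      ≡⟨ ⊛-suc (f ⊛ g) h n ⟩
    (f 0 * g 0) * h (suc n) + (tail (f ⊛ g) ⊛ h) n
      ≡⟨ cong₂ _+_ (*-assoc (f 0) (g 0) (h (suc n)))
           (⊛-cong {g = h} n (λ i _ → ⊛-suc f g i) (λ _ _ → refl)) ⟩
    f 0 * (g 0 * h (suc n)) + ((λ i → f 0 * tail g i + (tail f ⊛ g) i) ⊛ h) n
      ≡⟨ cong (_+_ (f 0 * (g 0 * h (suc n)))) (trans
           (⊛-distribʳ h (λ i → f 0 * tail g i) (tail f ⊛ g) n)
           (cong₂ _+_ (⊛-scaleˡ (f 0) (tail g) h n) (⊛-assoc (tail f) g h n))) ⟩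
    f 0 * (g 0 * h (suc n)) + (f 0 * (tail g ⊛ h) n + (tail f ⊛ (g ⊛ h)) n)
      ≡⟨ sym (+-assoc (f 0 * (g 0 * h (suc n))) _ _) ⟩
    (f 0 * (g 0 * h (suc n)) + f 0 * (tail g ⊛ h) n) + (tail f ⊛ (g ⊛ h)) n
      ≡⟨ cong (_+ (tail f ⊛ (g ⊛ h)) n) (sym (*-distribˡ-+ (f 0) (g 0 * h (suc n)) _)) ⟩
    f 0 * (g 0 * h (suc n) + (tail g ⊛ h) n) + (tail f ⊛ (g ⊛ h)) n
      ≡⟨ cong (λ e → f 0 * e + (tail f ⊛ (g ⊛ h)) n) (sym (⊛-suc g h n)) ⟩
    f 0 * (g ⊛ h) (suc n) + (tail f ⊛ (g ⊛ h)) n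
      ≡⟨ sym (⊛-suc f (g ⊛ h) n) ⟩
    (f ⊛ (g ⊛ h)) (suc n) ∎
    where open ≡-Reasoning

  ⊛-zeroˡ : ∀ f n → ((λ _ → + 0) ⊛ f) n ≡ + 0
  ⊛-zeroˡ f n = trans (sumTo-cong n λ i _ → *-zeroˡ (f (n ∸ i))) (sumTo-zero n)

  constant : ℤ → Series
  constant c zero    = c
  constant c (suc _) = + 0

  ⊛-constantˡ : ∀ c f n → (constant c ⊛ f) n ≡ c * f n
  ⊛-constantˡ c f zero    = refl
  ⊛-constantˡ c f (suc n) = trans (⊛-suc (constant c) f n)
    (trans (cong (_+_ (c * f (suc n))) (⊛-zeroˡ f n)) (+-identityʳ _))

  infixl 6 _⊕_
  infixl 7 _⊗_
  opaque
    -- The operations are opaque so that unification and the ring solver meet ring expressions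
    -- instead of unfolded convolutions.
    _⊕_ : Series → Series → Series
    (f ⊕ g) n = f n + g n

    _⊗_ : Series → Series → Series
    f ⊗ g = f ⊛ g

    ⊝_ : Series → Series
    (⊝ f) n = - f n

    ⟨_⟩ : ℤ → Series
    ⟨ c ⟩ = constant c

  opaque
    unfolding _⊕_

    ⊕-at : ∀ f g n → (f ⊕ g) n ≡ f n + g n
    ⊕-at f g n = refl

    ⊗-at : ∀ f g n → (f ⊗ g) n ≡ (f ⊛ g) n
    ⊗-at f g n = refl

    ⊝-at : ∀ f n → (⊝ f) n ≡ - f n
    ⊝-at f n = refl

    ⟨⟩-at : ∀ c n → ⟨ c ⟩ n ≡ constant c n
    ⟨⟩-at c n = refl

    ⟨⟩-+ : ∀ c d → ⟨ c + d ⟩ ≈ ⟨ c ⟩ ⊕ ⟨ d ⟩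
    ⟨⟩-+ c d = pointwise λ { zero → refl ; (suc n) → refl }

    ⟨⟩-neg : ∀ c → ⟨ - c ⟩ ≈ ⊝ ⟨ c ⟩
    ⟨⟩-neg c = pointwise λ { zero → refl ; (suc n) → refl }

    ⟨⟩⊗-at : ∀ c f n → (⟨ c ⟩ ⊗ f) n ≡ c * f n
    ⟨⟩⊗-at = ⊛-constantˡ

    ⟨⟩-* : ∀ c d → ⟨ c * d ⟩ ≈ ⟨ c ⟩ ⊗ ⟨ d ⟩
    ⟨⟩-* c d = pointwise λ where
      zero    → refl
      (suc n) → sym (trans (⊛-constantˡ c (constant d) (suc n)) (*-zeroʳ c))

    series-isCommutativeRing : IsCommutativeRing _≈_ _⊕_ _⊗_ ⊝_ ⟨ + 0 ⟩ ⟨ + 1 ⟩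
    series-isCommutativeRing = record
      { isRing = record
        { +-isAbelianGroup = record
          { isGroup = record
            { isMonoid = record
              { isSemigroup = record
                { isMagma = record
                  { isEquivalence = record
                    { refl  = pointwise λ _ → refl
                    ; sym   = λ p → pointwise λ n → sym (at p n)
                    ; trans = λ p q → pointwise λ n → trans (at p n) (at q n)
                    }
                  ; ∙-cong = λ p q → pointwise λ n → cong₂ _+_ (at p n) (at q n)
                  }
                ; assoc = λ f g h → pointwise λ n → +-assoc (f n) (g n) (h n)
                }
              ; identity = (λ f → pointwise λ { zero → +-identityˡ _ ; (suc n) → +-identityˡ _ })
                         , (λ f → pointwise λ { zero → +-identityʳ _ ; (suc n) → +-identityʳ _ })
              }
            ; inverse = (λ f → pointwise λ { zero → +-inverseˡ (f 0) ; (suc n) → +-inverseˡ (f (suc n)) })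
                      , (λ f → pointwise λ { zero → +-inverseʳ (f 0) ; (suc n) → +-inverseʳ (f (suc n)) })
            ; ⁻¹-cong = λ p → pointwise λ n → cong -_ (at p n)
            }
          ; comm = λ f g → pointwise λ n → +-comm (f n) (g n)
          }
        ; *-cong = λ p q → pointwise λ n → ⊛-cong n (λ i _ → at p i) (λ i _ → at q i)
        ; *-assoc = λ f g h → pointwise (⊛-assoc f g h)
        ; *-identity = (λ f → pointwise λ n → trans (⊛-constantˡ (+ 1) f n) (*-identityˡ (f n)))
                     , (λ f → pointwise λ n → trans (⊛-comm f (constant (+ 1)) n)
                          (trans (⊛-constantˡ (+ 1) f n) (*-identityˡ (f n))))
        ; distrib = (λ f g h → pointwise λ n → trans (⊛-comm f (λ i → g i + h i) n)
                       (trans (⊛-distribʳ f g h n) (cong₂ _+_ (⊛-comm g f n) (⊛-comm h f n))))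
                  , (λ f g h → pointwise (⊛-distribʳ f g h))
        }
      ; *-comm = λ f g → pointwise (⊛-comm f g)
      }

  seriesRing : CommutativeRing 0ℓ 0ℓ
  seriesRing = record { isCommutativeRing = series-isCommutativeRing }

-- A ring solver for series with integer coefficients.

module SeriesAlgebra where
  open PowerSeries
  open import Algebra.Bundles using (CommutativeRing)
  open import Algebra.Solver.Ring.AlmostCommutativeRing
  import Data.Integer.Properties as ℤₚ
  open import Data.Maybe using (Maybe; just; nothing)
  open import Relation.Nullary using (yes; no)
  import Relation.Binary.PropositionalEquality as ≡

  open CommutativeRing seriesRing public hiding (_≈_; zero)
  open import Algebra.Properties.Semiring.Exp semiring public using (_^_; ^-congˡ; ^-homo-*; ^-assocʳ)
  open import Algebra.Properties.CommutativeSemiring.Exp commutativeSemiring public using (^-distrib-*)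

  -- Equality of series is undecidable, so the solver normalises over ℤ, where coefficients compute
  -- and can be compared, and transports along constant series.
  ℤ⟶Series : CommutativeRing.rawRing ℤₚ.+-*-commutativeRing -Raw-AlmostCommutative⟶ fromCommutativeRing seriesRing
  ℤ⟶Series = record
    { ⟦_⟧    = ⟨_⟩
    ; +-homo = ⟨⟩-+
    ; *-homo = ⟨⟩-*
    ; -‿homo = ⟨⟩-neg
    ; 0-homo = refl
    ; 1-homo = refl
    }

  ⟨⟩-≟ : ∀ c d → Maybe (⟨ c ⟩ ≈ ⟨ d ⟩)
  ⟨⟩-≟ c d with c ℤₚ.≟ d
  ... | yes ≡.refl = just refl
  ... | no _       = nothing

  open import Algebra.Solver.Ring _ (fromCommutativeRing seriesRing) ℤ⟶Series ⟨⟩-≟ public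
    using (Polynomial; solve; _:=_; con; _:+_; _:*_; _:-_; :-_; _:^_)

-- The operators q, θ, V and U, truncated equality, and uniqueness principles.

module Operators where
  open PowerSeries
  open SeriesAlgebra using (_^_)
  module S = SeriesAlgebra
  open import Data.Integer using (+_; -_; _+_; _*_)
  open import Data.Integer.Properties
  open import Data.Nat as ℕ using (ℕ; zero; suc; _∸_; z≤n; s≤s; NonZero)
  open import Data.Nat.Divisibility as Div using (_∣_; _∣?_; divides)
  open import Data.Nat.Induction using (<-rec)
  import Data.Nat.Properties as ℕₚ
  open import Data.Empty using (⊥-elim)
  open import Data.Sum using (inj₁; inj₂)
  open import Function using (_∘_)
  open import Relation.Binary.PropositionalEquality
  open import Relation.Nullary using (¬_; yes; no)

  ⊗-zero-at : ∀ f g → (f ⊗ g) 0 ≡ f 0 * g 0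
  ⊗-zero-at f g = ⊗-at f g 0

  ⟨⟩-zero-at : ∀ c → ⟨ c ⟩ 0 ≡ c
  ⟨⟩-zero-at c = ⟨⟩-at c 0

  ⟨⟩-suc-at : ∀ c n → ⟨ c ⟩ (suc n) ≡ + 0
  ⟨⟩-suc-at c n = ⟨⟩-at c (suc n)

  ⟨0⟩-at : ∀ n → ⟨ + 0 ⟩ n ≡ + 0
  ⟨0⟩-at zero    = ⟨⟩-zero-at (+ 0)
  ⟨0⟩-at (suc n) = ⟨⟩-suc-at (+ 0) n

  vanishing : (d : Series) → (∀ n → (∀ i → i ℕ.< n → d i ≡ + 0) → d n ≡ + 0) → ∀ n → d n ≡ + 0
  vanishing d step = <-rec (λ n → d n ≡ + 0) λ n rec → step n (λ i i<n → rec i<n)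

  ⊛-vanishing : ∀ f g n → (∀ i → i ℕ.≤ n → g i ≡ + 0) → (f ⊛ g) n ≡ + 0
  ⊛-vanishing f g n g≡0 = trans
    (sumTo-cong n λ i _ → trans (cong (f i *_) (g≡0 (n ∸ i) (ℕₚ.m∸n≤m n i))) (*-zeroʳ (f i)))
    (sumTo-zero n)

  ⊗-leading : ∀ f g n → (∀ i → i ℕ.< n → g i ≡ + 0) → (f ⊗ g) n ≡ f 0 * g n
  ⊗-leading f g zero    _   = ⊗-zero-at f g
  ⊗-leading f g (suc n) g≡0 = trans (⊗-at f g (suc n)) (trans (⊛-suc f g n)
    (trans (cong (_+_ (f 0 * g (suc n))) (⊛-vanishing (tail f) g n λ i i≤n → g≡0 i (s≤s i≤n)))
           (+-identityʳ _)))

  -- The lowest nonzero coefficient of d would reappear in the product, multiplied by `f 0`.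
  ≈0-cancel : ∀ {f d} → f 0 ≢ + 0 → f ⊗ d ≈ ⟨ + 0 ⟩ → d ≈ ⟨ + 0 ⟩
  ≈0-cancel {f} {d} f0≢0 fd≈0 = pointwise λ n → trans (vanishing d step n) (sym (⟨0⟩-at n))
    where
    step : ∀ n → (∀ i → i ℕ.< n → d i ≡ + 0) → d n ≡ + 0
    step n rec with i*j≡0⇒i≡0∨j≡0 (f 0) (trans (sym (⊗-leading f d n rec)) (trans (at fd≈0 n) (⟨0⟩-at n)))
    ... | inj₁ f0≡0 = ⊥-elim (f0≢0 f0≡0)
    ... | inj₂ dn≡0 = dn≡0

  difference : ∀ {f g} → f S.- g ≈ ⟨ + 0 ⟩ → f ≈ g
  difference {f} {g} f-g≈0 = S.trans
    (S.solve 2 (λ f g → f S.:= (f S.:- g) S.:+ g) S.refl f g)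
    (S.trans (S.+-congʳ f-g≈0) (S.+-identityˡ g))

  cancel : ∀ {a} f g → a 0 ≢ + 0 → a ⊗ f ≈ a ⊗ g → f ≈ g
  cancel {a} f g a0≢0 eq = difference (≈0-cancel a0≢0 (S.trans
    (S.solve 3 (λ a f g → a S.:* (f S.:- g) S.:= a S.:* f S.:- a S.:* g) S.refl a f g)
    (S.trans (S.+-congʳ eq) (S.-‿inverseʳ _))))

  opaque
    X : Series
    X 1 = + 1
    X _ = + 0

  opaque
    unfolding X _⊗_
    X⊗-zero : ∀ f → (X ⊗ f) 0 ≡ + 0
    X⊗-zero f = *-zeroˡ (f 0)

    X⊗-suc : ∀ f n → (X ⊗ f) (suc n) ≡ f n
    X⊗-suc f n = trans (⊛-suc X f n) (trans (cong₂ _+_ (*-zeroˡ (f (suc n))) (tail-X n)) (+-identityˡ (f n)))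
      where
      tail-X : ∀ n → (tail X ⊛ f) n ≡ f n
      tail-X n = trans (⊛-cong {f = tail X} {f′ = constant (+ 1)} {g = f} n (λ { zero _ → refl ; (suc i) _ → refl }) (λ _ _ → refl))
        (trans (⊛-constantˡ (+ 1) f n) (*-identityˡ (f n)))

    X-zero : X 0 ≡ + 0
    X-zero = refl

  X-cancel : ∀ f g → X ⊗ f ≈ X ⊗ g → f ≈ g
  X-cancel f g eq = pointwise λ n → trans (sym (X⊗-suc f n)) (trans (at eq (suc n)) (X⊗-suc g n))

  X^⊗-suc : ∀ k f n → (X ^ suc k ⊗ f) (suc n) ≡ (X ^ k ⊗ f) n
  X^⊗-suc k f n = trans (at (S.*-assoc X (X ^ k) f) (suc n)) (X⊗-suc (X ^ k ⊗ f) n)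

  X^⊗-+ : ∀ k f n → (X ^ k ⊗ f) (k ℕ.+ n) ≡ f n
  X^⊗-+ zero    f n = at (S.*-identityˡ f) n
  X^⊗-+ (suc k) f n = trans (X^⊗-suc k f (k ℕ.+ n)) (X^⊗-+ k f n)

  X^⊗-< : ∀ k f n → n ℕ.< k → (X ^ k ⊗ f) n ≡ + 0
  X^⊗-< (suc k) f zero    _         = trans (at (S.*-assoc X (X ^ k) f) 0) (X⊗-zero (X ^ k ⊗ f))
  X^⊗-< (suc k) f (suc n) (s≤s n<k) = trans (X^⊗-suc k f n) (X^⊗-< k f n n<k)

  X^-self : ∀ k → (X ^ k) k ≡ + 1
  X^-self k = trans (sym (at (S.*-identityʳ (X ^ k)) k))
    (trans (cong (X ^ k ⊗ ⟨ + 1 ⟩) (sym (ℕₚ.+-identityʳ k))) (trans (X^⊗-+ k ⟨ + 1 ⟩ 0) (⟨⟩-zero-at (+ 1))))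

  X^-other : ∀ k n → n ≢ k → (X ^ k) n ≡ + 0
  X^-other zero    zero    n≢k = ⊥-elim (n≢k refl)
  X^-other zero    (suc n) n≢k = ⟨⟩-suc-at (+ 1) n
  X^-other (suc k) zero    n≢k = X⊗-zero (X ^ k)
  X^-other (suc k) (suc n) n≢k = trans (X⊗-suc (X ^ k) n) (X^-other k n (n≢k ∘ cong suc))

  infix 4 _≈[_]_
  -- Congruence modulo q^{N+1}, the substitute for convergence.
  record _≈[_]_ (f : Series) (N : ℕ) (g : Series) : Set where
    constructor agree
    field below : ∀ n → n ℕ.≤ N → f n ≡ g n
  open _≈[_]_ public

  ≈⇒≈[] : ∀ {f g} N → f ≈ g → f ≈[ N ] g
  ≈⇒≈[] N eq = agree λ n _ → at eq n

  ≈[]⇒≈ : ∀ {f g} → (∀ N → f ≈[ N ] g) → f ≈ g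
  ≈[]⇒≈ eq = pointwise λ n → below (eq n) n ℕₚ.≤-refl

  ≈[]-refl : ∀ {f N} → f ≈[ N ] f
  ≈[]-refl = agree λ _ _ → refl

  ≈[]-sym : ∀ {f g N} → f ≈[ N ] g → g ≈[ N ] f
  ≈[]-sym eq = agree λ n n≤N → sym (below eq n n≤N)

  ≈[]-trans : ∀ {f g h N} → f ≈[ N ] g → g ≈[ N ] h → f ≈[ N ] h
  ≈[]-trans eq₁ eq₂ = agree λ n n≤N → trans (below eq₁ n n≤N) (below eq₂ n n≤N)

  ≈[]-weaken : ∀ {f g M N} → M ℕ.≤ N → f ≈[ N ] g → f ≈[ M ] g
  ≈[]-weaken M≤N eq = agree λ n n≤M → below eq n (ℕₚ.≤-trans n≤M M≤N)

  ⊗-cong[] : ∀ {f f′ g g′ N} → f ≈[ N ] f′ → g ≈[ N ] g′ → f ⊗ g ≈[ N ] f′ ⊗ g′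
  ⊗-cong[] {f} {f′} {g} {g′} {N} eq₁ eq₂ = agree λ n n≤N → trans (⊗-at f g n) (trans
    (⊛-cong n (λ i i≤n → below eq₁ i (ℕₚ.≤-trans i≤n n≤N)) (λ i i≤n → below eq₂ i (ℕₚ.≤-trans i≤n n≤N)))
    (sym (⊗-at f′ g′ n)))

  ⊕-cong[] : ∀ {f f′ g g′ N} → f ≈[ N ] f′ → g ≈[ N ] g′ → f ⊕ g ≈[ N ] f′ ⊕ g′
  ⊕-cong[] {f} {f′} {g} {g′} eq₁ eq₂ = agree λ n n≤N → trans (⊕-at f g n)
    (trans (cong₂ _+_ (below eq₁ n n≤N) (below eq₂ n n≤N)) (sym (⊕-at f′ g′ n)))

  X^⊗≈[]0 : ∀ {k N} f → N ℕ.< k → X ^ k ⊗ f ≈[ N ] ⟨ + 0 ⟩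
  X^⊗≈[]0 {k} f N<k = agree λ n n≤N → trans (X^⊗-< k f n (ℕₚ.≤-<-trans n≤N N<k)) (sym (⟨0⟩-at n))

  -- Multiplication by q^k gains k digits of precision; `E-coefficient` depends on this gain.
  X^⊗-cong[] : ∀ k {f g N} → f ≈[ N ] g → X ^ k ⊗ f ≈[ k ℕ.+ N ] X ^ k ⊗ g
  X^⊗-cong[] zero {f} {g} eq = agree λ n n≤N →
    trans (at (S.*-identityˡ f) n) (trans (below eq n n≤N) (sym (at (S.*-identityˡ g) n)))
  X^⊗-cong[] (suc k) {f} {g} {N} eq = agree λ where
    zero    _         → trans (X^⊗-< (suc k) f 0 (s≤s z≤n)) (sym (X^⊗-< (suc k) g 0 (s≤s z≤n)))
    (suc n) (s≤s n≤N) → trans (X^⊗-suc k f n) (trans (below (X^⊗-cong[] k eq) n n≤N) (sym (X^⊗-suc k g n)))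

  opaque
    θ : Series → Series
    θ f n = + n * f n

  opaque
    unfolding θ

    θ-at : ∀ f n → θ f n ≡ + n * f n
    θ-at f n = refl

  θ-cong : ∀ {f g} → f ≈ g → θ f ≈ θ g
  θ-cong {f} {g} eq = pointwise λ n → trans (θ-at f n) (trans (cong (+ n *_) (at eq n)) (sym (θ-at g n)))

  opaque
    unfolding θ _⊕_

    θ-⊕ : ∀ f g → θ (f ⊕ g) ≈ θ f ⊕ θ g
    θ-⊕ f g = pointwise λ n → *-distribˡ-+ (+ n) (f n) (g n)

    θ-⊝ : ∀ f → θ (⊝ f) ≈ ⊝ θ f
    θ-⊝ f = pointwise λ n → sym (neg-distribʳ-* (+ n) (f n))

    θ-⟨⟩ : ∀ c → θ ⟨ c ⟩ ≈ ⟨ + 0 ⟩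
    θ-⟨⟩ c = pointwise λ { zero → refl ; (suc n) → *-zeroʳ (+ suc n) }

    θ-⊗ : ∀ f g → θ (f ⊗ g) ≈ θ f ⊗ g ⊕ f ⊗ θ g
    θ-⊗ f g = pointwise λ n → begin
      + n * sumTo n (λ i → f i * g (n ∸ i))
        ≡⟨ sym (sumTo-*ˡ n (+ n) (λ i → f i * g (n ∸ i))) ⟩
      sumTo n (λ i → + n * (f i * g (n ∸ i)))
        ≡⟨ sumTo-cong n (λ i i≤n → term n i i≤n) ⟩
      sumTo n (λ i → + i * f i * g (n ∸ i) + f i * (+ (n ∸ i) * g (n ∸ i)))
        ≡⟨ sumTo-+ n _ _ ⟩
      (θ f ⊗ g ⊕ f ⊗ θ g) n ∎
      where
      open ≡-Reasoning
      term : ∀ n i → i ℕ.≤ n →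
             + n * (f i * g (n ∸ i)) ≡ + i * f i * g (n ∸ i) + f i * (+ (n ∸ i) * g (n ∸ i))
      term n i i≤n = begin
        + n * (f i * g (n ∸ i))
          ≡⟨ cong (λ k → + k * (f i * g (n ∸ i))) (sym (ℕₚ.m+[n∸m]≡n i≤n)) ⟩
        + (i ℕ.+ (n ∸ i)) * (f i * g (n ∸ i))
          ≡⟨ cong (_* (f i * g (n ∸ i))) (pos-+ i (n ∸ i)) ⟩
        (+ i + + (n ∸ i)) * (f i * g (n ∸ i))
          ≡⟨ *-distribʳ-+ (f i * g (n ∸ i)) (+ i) (+ (n ∸ i)) ⟩
        + i * (f i * g (n ∸ i)) + + (n ∸ i) * (f i * g (n ∸ i))
          ≡⟨ cong₂ _+_ (sym (*-assoc (+ i) (f i) (g (n ∸ i)))) (begin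
               + (n ∸ i) * (f i * g (n ∸ i)) ≡⟨ sym (*-assoc (+ (n ∸ i)) (f i) (g (n ∸ i))) ⟩
               + (n ∸ i) * f i * g (n ∸ i)   ≡⟨ cong (_* g (n ∸ i)) (*-comm (+ (n ∸ i)) (f i)) ⟩
               f i * + (n ∸ i) * g (n ∸ i)   ≡⟨ *-assoc (f i) (+ (n ∸ i)) (g (n ∸ i)) ⟩
               f i * (+ (n ∸ i) * g (n ∸ i)) ∎) ⟩
        + i * f i * g (n ∸ i) + f i * (+ (n ∸ i) * g (n ∸ i)) ∎

    θ-X : θ X ≈ X
    θ-X = pointwise λ { zero → sym X-zero ; (suc n) → go n }
      where
      opaque
        unfolding X
        go : ∀ n → + suc n * X (suc n) ≡ X (suc n)
        go zero    = refl
        go (suc n) = *-zeroʳ (+ suc (suc n))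

  -- At the first index n > 0 where d is nonzero, θ multiplies by n, whereas `c ⊗ d` contributes
  -- only c 0 · d n = 0.
  θ-unique : ∀ {c d} → c 0 ≡ + 0 → d 0 ≡ + 0 → θ d ≈ c ⊗ d → d ≈ ⟨ + 0 ⟩
  θ-unique {c} {d} c0≡0 d0≡0 eq = pointwise λ n → trans (vanishing d step n) (sym (⟨0⟩-at n))
    where
    step : ∀ n → (∀ i → i ℕ.< n → d i ≡ + 0) → d n ≡ + 0
    step zero    _   = d0≡0
    step (suc n) rec with i*j≡0⇒i≡0∨j≡0 (+ suc n) {d (suc n)} (begin
        + suc n * d (suc n) ≡⟨ sym (θ-at d (suc n)) ⟩
        θ d (suc n)         ≡⟨ at eq (suc n) ⟩
        (c ⊗ d) (suc n)     ≡⟨ ⊗-leading c d (suc n) rec ⟩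
        c 0 * d (suc n)     ≡⟨ cong (_* d (suc n)) c0≡0 ⟩
        + 0 * d (suc n)     ≡⟨ *-zeroˡ (d (suc n)) ⟩
        + 0                 ∎)
      where open ≡-Reasoning
    ... | inj₁ ()
    ... | inj₂ dn≡0 = dn≡0

  opaque
    dilate : (m : ℕ) → Series → Series
    dilate m f n with m ∣? n
    ... | yes (divides k _) = f k
    ... | no  _             = + 0

  opaque
    unfolding dilate

    dilate-on : ∀ m .{{_ : NonZero m}} f k → dilate m f (k ℕ.* m) ≡ f k
    dilate-on m f k with m ∣? (k ℕ.* m)
    ... | yes (divides k′ eq) = cong f (sym (ℕₚ.*-cancelʳ-≡ k k′ m eq))
    ... | no  m∤km            = ⊥-elim (m∤km (Div.n∣m*n k))

    dilate-off : ∀ m f n → ¬ m ∣ n → dilate m f n ≡ + 0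
    dilate-off m f n m∤n with m ∣? n
    ... | yes m∣n = ⊥-elim (m∤n m∣n)
    ... | no  _   = refl

  -- The algebraic laws of `dilate` are derived from this characterisation on and off the multiples
  -- of m, without unfolding the divisibility test.
  dilate-unique : ∀ m .{{_ : NonZero m}} f g → (∀ k → g (k ℕ.* m) ≡ f k) → (∀ n → ¬ m ∣ n → g n ≡ + 0) →
                  dilate m f ≈ g
  dilate-unique m f g on off = pointwise eq
    where
    eq : ∀ n → dilate m f n ≡ g n
    eq n with m ∣? n
    ... | yes (divides k refl) = trans (dilate-on m f k) (sym (on k))
    ... | no  m∤n              = trans (dilate-off m f n m∤n) (sym (off n m∤n))

  sumTo-multiples : ∀ m .{{_ : NonZero m}} k (h : Series) → (∀ n → ¬ m ∣ n → h n ≡ + 0) →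
                    sumTo (k ℕ.* m) h ≡ sumTo k (λ i → h (i ℕ.* m))
  sumTo-multiples (suc m) zero    h off = refl
  sumTo-multiples (suc m) (suc k) h off =
    cong (_+ h (suc m ℕ.+ k ℕ.* suc m)) (trans (skip m ℕₚ.≤-refl) (sumTo-multiples (suc m) k h off))
    where
    skip : ∀ j → j ℕ.≤ m → sumTo (j ℕ.+ k ℕ.* suc m) h ≡ sumTo (k ℕ.* suc m) h
    skip zero    _   = refl
    skip (suc j) j<m = trans
      (cong₂ _+_ (skip j (ℕₚ.<⇒≤ j<m)) (off (suc j ℕ.+ k ℕ.* suc m) λ m∣ →
        Div.>⇒∤ (s≤s j<m) (Div.∣m+n∣m⇒∣n (subst (suc m ∣_) (ℕₚ.+-comm (suc j) _) m∣) (Div.n∣m*n k))))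
      (+-identityʳ _)

  module _ (m : ℕ) .{{_ : NonZero m}} where

    dilate-cong : ∀ {f g} → f ≈ g → dilate m f ≈ dilate m g
    dilate-cong {f} {g} eq = dilate-unique m f (dilate m g)
      (λ k → trans (dilate-on m g k) (sym (at eq k))) (dilate-off m g)

    dilate-⊕ : ∀ f g → dilate m (f ⊕ g) ≈ dilate m f ⊕ dilate m g
    dilate-⊕ f g = dilate-unique m _ _
      (λ k → trans (⊕-at _ _ (k ℕ.* m)) (trans (cong₂ _+_ (dilate-on m f k) (dilate-on m g k)) (sym (⊕-at f g k))))
      (λ n m∤n → trans (⊕-at _ _ n) (cong₂ _+_ (dilate-off m f n m∤n) (dilate-off m g n m∤n)))

    dilate-⊝ : ∀ f → dilate m (⊝ f) ≈ ⊝ dilate m f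
    dilate-⊝ f = dilate-unique m _ _
      (λ k → trans (⊝-at _ (k ℕ.* m)) (trans (cong -_ (dilate-on m f k)) (sym (⊝-at f k))))
      (λ n m∤n → trans (⊝-at _ n) (cong -_ (dilate-off m f n m∤n)))

    dilate-⟨⟩ : ∀ c → dilate m ⟨ c ⟩ ≈ ⟨ c ⟩
    dilate-⟨⟩ c = dilate-unique m _ _ on off
      where
      on : ∀ k → ⟨ c ⟩ (k ℕ.* m) ≡ ⟨ c ⟩ k
      on zero    = refl
      on (suc k) with suc k ℕ.* m | ℕₚ.m*n≢0 (suc k) m
      ... | suc j | _ = trans (⟨⟩-suc-at c j) (sym (⟨⟩-suc-at c k))
      off : ∀ n → ¬ m ∣ n → ⟨ c ⟩ n ≡ + 0
      off zero    m∤0 = ⊥-elim (m∤0 (m Div.∣0))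
      off (suc n) _   = ⟨⟩-suc-at c n

    -- Only one factor is a dilation; this generality serves both `dilate-⊗` and the linearity of U
    -- over the image of V.
    dilate-⊗-on : ∀ f g k → (dilate m f ⊗ g) (k ℕ.* m) ≡ sumTo k (λ i → f i * g ((k ∸ i) ℕ.* m))
    dilate-⊗-on f g k = trans (⊗-at (dilate m f) g (k ℕ.* m)) (trans
      (sumTo-multiples m k _ λ n m∤n → trans (cong (_* g (k ℕ.* m ∸ n)) (dilate-off m f n m∤n)) (*-zeroˡ (g (k ℕ.* m ∸ n))))
      (sumTo-cong k λ i _ → cong₂ (λ c j → c * g j) (dilate-on m f i) (sym (ℕₚ.*-distribʳ-∸ m k i))))

    dilate-⊗ : ∀ f g → dilate m (f ⊗ g) ≈ dilate m f ⊗ dilate m g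
    dilate-⊗ f g = dilate-unique m _ _
      (λ k → trans (dilate-⊗-on f (dilate m g) k) (trans
        (sumTo-cong k λ i _ → cong (f i *_) (dilate-on m g (k ∸ i))) (sym (⊗-at f g k))))
      (λ n m∤n → trans (⊗-at _ _ n) (trans (sumTo-cong n (off n m∤n)) (sumTo-zero n)))
      where
      off : ∀ n → ¬ m ∣ n → ∀ i → i ℕ.≤ n → dilate m f i * dilate m g (n ∸ i) ≡ + 0
      off n m∤n i i≤n with m ∣? i
      ... | yes m∣i = trans (cong (dilate m f i *_) (dilate-off m g (n ∸ i) λ m∣n∸i →
              m∤n (subst (m ∣_) (ℕₚ.m+[n∸m]≡n i≤n) (Div.∣m∣n⇒∣m+n m∣i m∣n∸i)))) (*-zeroʳ (dilate m f i))
      ... | no  m∤i = trans (cong (_* dilate m g (n ∸ i)) (dilate-off m f i m∤i)) (*-zeroˡ (dilate m g (n ∸ i)))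

    dilate-^ : ∀ f j → dilate m (f ^ j) ≈ dilate m f ^ j
    dilate-^ f zero    = dilate-⟨⟩ (+ 1)
    dilate-^ f (suc j) = S.trans (dilate-⊗ f (f ^ j)) (S.*-congˡ (dilate-^ f j))

    dilate-X : dilate m X ≈ X ^ m
    dilate-X = dilate-unique m X (X ^ m) on off
      where
      opaque
        unfolding X
        on : ∀ k → (X ^ m) (k ℕ.* m) ≡ X k
        on 0 = X^-other m 0 (ℕₚ.<⇒≢ (ℕ.>-nonZero⁻¹ m))
        on 1 = trans (cong (X ^ m) (ℕₚ.*-identityˡ m)) (X^-self m)
        on (suc (suc k)) = X^-other m _ λ eq →
          ℕₚ.<⇒≢ (ℕₚ.m<m+n m (ℕ.>-nonZero⁻¹ (suc k ℕ.* m) {{ℕₚ.m*n≢0 (suc k) m}})) (sym eq)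
      off : ∀ n → ¬ m ∣ n → (X ^ m) n ≡ + 0
      off n m∤n = X^-other m n λ { refl → m∤n Div.∣-refl }

    θ-dilate : ∀ f → θ (dilate m f) ≈ ⟨ + m ⟩ ⊗ dilate m (θ f)
    θ-dilate f = S.sym (S.trans (S.sym (S.trans (dilate-⊗ ⟨ + m ⟩ (θ f)) (S.*-congʳ (dilate-⟨⟩ (+ m)))))
      (dilate-unique m _ _
        (λ k → begin
          θ (dilate m f) (k ℕ.* m)          ≡⟨ θ-at _ (k ℕ.* m) ⟩
          + (k ℕ.* m) * dilate m f (k ℕ.* m) ≡⟨ cong₂ _*_ (trans (cong +_ (ℕₚ.*-comm k m)) (pos-* m k)) (dilate-on m f k) ⟩
          + m * + k * f k                   ≡⟨ *-assoc (+ m) (+ k) (f k) ⟩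
          + m * (+ k * f k)                 ≡⟨ cong (+ m *_) (sym (θ-at f k)) ⟩
          + m * θ f k                       ≡⟨ sym (⟨⟩⊗-at (+ m) (θ f) k) ⟩
          (⟨ + m ⟩ ⊗ θ f) k                 ∎)
        (λ n m∤n → trans (θ-at _ n) (trans (cong (+ n *_) (dilate-off m f n m∤n)) (*-zeroʳ (+ n))))))
      where open ≡-Reasoning

  V : Series → Series
  V = dilate 5

  opaque
    U : Series → Series
    U f n = f (n ℕ.* 5)

  opaque
    unfolding U

    U-at : ∀ f n → U f n ≡ f (n ℕ.* 5)
    U-at f n = refl

  U-cong : ∀ {f g} → f ≈ g → U f ≈ U g
  U-cong {f} {g} eq = pointwise λ n → trans (U-at f n) (trans (at eq (n ℕ.* 5)) (sym (U-at g n)))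

  U-⊕ : ∀ f g → U (f ⊕ g) ≈ U f ⊕ U g
  U-⊕ f g = pointwise λ n → trans (U-at (f ⊕ g) n) (trans (⊕-at f g (n ℕ.* 5))
    (trans (cong₂ _+_ (sym (U-at f n)) (sym (U-at g n))) (sym (⊕-at (U f) (U g) n))))

  -- Exponents of V f are multiples of 5, so an exponent divisible by 5 in the product needs one in
  -- g. Every evaluation of U below pulls out factors this way.
  U-V⊗ : ∀ f g → U (V f ⊗ g) ≈ f ⊗ U g
  U-V⊗ f g = pointwise λ n → trans (U-at _ n) (trans (dilate-⊗-on 5 f g n)
    (trans (sumTo-cong n λ i _ → cong (f i *_) (sym (U-at g (n ∸ i)))) (sym (⊗-at f (U g) n))))

  U-⟨⟩⊗ : ∀ c g → U (⟨ c ⟩ ⊗ g) ≈ ⟨ c ⟩ ⊗ U g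
  U-⟨⟩⊗ c g = S.trans (U-cong (S.*-congʳ (S.sym (dilate-⟨⟩ 5 c)))) (U-V⊗ ⟨ c ⟩ g)

  U-V : ∀ f → U (V f) ≈ f
  U-V f = pointwise λ n → trans (U-at (V f) n) (dilate-on 5 f n)

  dilate-cong[] : ∀ m .{{_ : NonZero m}} {f g N} → f ≈[ N ] g → dilate m f ≈[ N ] dilate m g
  dilate-cong[] m {f} {g} {N} eq = agree go
    where
    go : ∀ n → n ℕ.≤ N → dilate m f n ≡ dilate m g n
    go n n≤N with m ∣? n
    ... | no  m∤n              = trans (dilate-off m f n m∤n) (sym (dilate-off m g n m∤n))
    ... | yes (divides k refl) = trans (dilate-on m f k)
            (trans (below eq k (ℕₚ.≤-trans (ℕₚ.m≤m*n k m) n≤N)) (sym (dilate-on m g k)))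

  dilate-X^ : ∀ m .{{_ : NonZero m}} e → dilate m (X ^ e) ≈ X ^ (m ℕ.* e)
  dilate-X^ m e = S.trans (dilate-^ m X e) (S.trans (S.^-congˡ e (dilate-X m)) (S.^-assocʳ X m e))

  -‿cong[] : ∀ {f g N} → f ≈[ N ] g → ⊝ f ≈[ N ] ⊝ g
  -‿cong[] {f} {g} eq = agree λ n n≤N → trans (⊝-at f n) (trans (cong -_ (below eq n n≤N)) (sym (⊝-at g n)))

  θ-cong[] : ∀ {f g N} → f ≈[ N ] g → θ f ≈[ N ] θ g
  θ-cong[] {f} {g} eq = agree λ n n≤N → trans (θ-at f n) (trans (cong (+ n *_) (below eq n n≤N)) (sym (θ-at g n)))

  U-cong[] : ∀ {f g N} → f ≈[ N ℕ.* 5 ] g → U f ≈[ N ] U g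
  U-cong[] {f} {g} eq = agree λ n n≤N → trans (U-at f n)
    (trans (below eq (n ℕ.* 5) (ℕₚ.*-monoˡ-≤ 5 n≤N)) (sym (U-at g n)))

  ^-cong[] : ∀ {f g N} k → f ≈[ N ] g → f ^ k ≈[ N ] g ^ k
  ^-cong[] zero    eq = ≈[]-refl
  ^-cong[] (suc k) eq = ⊗-cong[] eq (^-cong[] k eq)

  -- The lowest coefficient of d would reappear in V d at five times its index.
  dilation-unique : ∀ {a b d} → a 0 ≡ + 1 → d 0 ≡ + 0 → a ⊗ d ≈ b ⊗ V d → d ≈ ⟨ + 0 ⟩
  dilation-unique {a} {b} {d} a0≡1 d0≡0 eq = pointwise λ n → trans (vanishing d step n) (sym (⟨0⟩-at n))
    where
    step : ∀ n → (∀ i → i ℕ.< n → d i ≡ + 0) → d n ≡ + 0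
    step zero    _   = d0≡0
    step (suc n) rec = begin
      d (suc n)           ≡⟨ sym (*-identityˡ (d (suc n))) ⟩
      + 1 * d (suc n)     ≡⟨ cong (_* d (suc n)) (sym a0≡1) ⟩
      a 0 * d (suc n)     ≡⟨ sym (⊗-leading a d (suc n) rec) ⟩
      (a ⊗ d) (suc n)     ≡⟨ at eq (suc n) ⟩
      (b ⊗ V d) (suc n)   ≡⟨ ⊗-at b (V d) (suc n) ⟩
      (b ⊛ V d) (suc n)   ≡⟨ ⊛-vanishing b (V d) (suc n) Vd≡0 ⟩
      + 0                 ∎
      where
      open ≡-Reasoning
      Vd≡0 : ∀ i → i ℕ.≤ suc n → V d i ≡ + 0
      Vd≡0 i i≤n with 5 ∣? i
      ... | no 5∤i = dilate-off 5 d i 5∤i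
      ... | yes (divides zero refl)    = trans (dilate-on 5 d 0) d0≡0
      ... | yes (divides (suc k) refl) = trans (dilate-on 5 d (suc k))
              (rec (suc k) (ℕₚ.<-≤-trans (ℕₚ.m<m*n (suc k) 5 (s≤s (s≤s z≤n))) i≤n))

-- Euler's product and its inverse as limits of finite products.

module EulerProduct where
  open PowerSeries
  open SeriesAlgebra
  open TriangularNumbers
  open Operators
  open import Data.Bool using (if_then_else_)
  open import Data.Integer as ℤ using (ℤ; +_)
  open import Data.Nat as ℕ using (ℕ; zero; suc; NonZero)
  open import Data.Nat.Divisibility using (_∣?_; n∣m*n)
  import Data.Nat.Properties as ℕₚ
  open import Relation.Binary.PropositionalEquality as ≡ using (_≡_; cong; cong₂; subst)
  open import Relation.Nullary.Decidable using (dec-true; dec-false)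
  open import Relation.Binary.Reasoning.Setoid setoid

  infix 9 #_
  #_ : ℕ → Series
  # n = ⟨ + n ⟩

  infix 10 κ_
  κ_ : ∀ {n} → ℕ → Polynomial n
  κ n = con (+ n)

  X^-+ : ∀ m n → X ^ (m ℕ.+ n) ≈ X ^ m * X ^ n
  X^-+ = ^-homo-* X

  X^-≡ : ∀ {m n} → m ≡ n → X ^ m ≈ X ^ n
  X^-≡ ≡.refl = refl

  X^-split : ∀ m n {k} → k ≡ m ℕ.+ n → X ^ k ≈ X ^ m * X ^ n
  X^-split m n k≡m+n = trans (X^-≡ k≡m+n) (X^-+ m n)

  factor : ℕ → Series
  factor n = # 1 - X ^ n

  ones : Series
  ones _ = + 1

  ones-expand : ones ≈ # 1 + X * ones
  ones-expand = pointwise λ where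
    zero    → ≡.sym (≡.trans (⊕-at (# 1) (X * ones) 0) (cong₂ ℤ._+_ (⟨⟩-zero-at (+ 1)) (X⊗-zero ones)))
    (suc n) → ≡.sym (≡.trans (⊕-at (# 1) (X * ones) (suc n)) (cong₂ ℤ._+_ (⟨⟩-suc-at (+ 1) n) (X⊗-suc ones n)))

  geom≈dilate : ∀ m .{{_ : NonZero m}} → dilate m ones ≈ geom m
  geom≈dilate m = dilate-unique m ones (geom m)
    (λ k → cong (λ b → if b then + 1 else + 0) (dec-true (m ∣? k ℕ.* m) (n∣m*n k)))
    (λ n m∤n → cong (λ b → if b then + 1 else + 0) (dec-false (m ∣? n) m∤n))

  -- Only m = 1 is computed; the general case is its image under the substitution of q^m for q.
  geom-inverse : ∀ m .{{_ : NonZero m}} → factor m * geom m ≈ # 1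
  geom-inverse m = begin
    factor m * geom m
      ≈⟨ *-cong (+-cong (dilate-⟨⟩ m (+ 1)) (trans (dilate-⊝ m X) (-‿cong (dilate-X m)))) (geom≈dilate m) ⟨
    (dilate m (# 1) + dilate m (- X)) * dilate m ones
      ≈⟨ trans (dilate-⊗ m _ _) (*-congʳ (dilate-⊕ m _ _)) ⟨
    dilate m ((# 1 - X) * ones)
      ≈⟨ dilate-cong m (begin
           (# 1 - X) * ones          ≈⟨ solve 2 (λ x o → (κ 1 :- x) :* o := o :- x :* o) refl X ones ⟩
           ones - X * ones           ≈⟨ +-congʳ ones-expand ⟩
           # 1 + X * ones - X * ones ≈⟨ solve 2 (λ x o → κ 1 :+ x :* o :- x :* o := κ 1) refl X ones ⟩
           # 1                       ∎) ⟩
    dilate m (# 1)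
      ≈⟨ dilate-⟨⟩ m (+ 1) ⟩
    # 1 ∎

  P : ℕ → Series
  P zero    = # 1
  P (suc n) = P n * factor (suc n)

  I : ℕ → Series
  I = invPochTrunc

  I-zero : I 0 ≈ # 1
  I-zero = pointwise λ { zero → ≡.sym (⟨⟩-zero-at (+ 1)) ; (suc n) → ≡.sym (⟨⟩-suc-at (+ 1) n) }

  I-suc : ∀ n → I (suc n) ≈ I n * geom (suc n)
  I-suc n = pointwise λ k → ≡.sym (⊗-at (I n) (geom (suc n)) k)

  factor-I : ∀ n → factor (suc n) * I (suc n) ≈ I n
  factor-I n = begin
    factor (suc n) * I (suc n)              ≈⟨ *-congˡ (I-suc n) ⟩
    factor (suc n) * (I n * geom (suc n))   ≈⟨ solve 3 (λ f i g → f :* (i :* g) := i :* (f :* g)) refl _ _ _ ⟩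
    I n * (factor (suc n) * geom (suc n))   ≈⟨ *-congˡ (geom-inverse (suc n)) ⟩
    I n * # 1                               ≈⟨ *-identityʳ (I n) ⟩
    I n                                     ∎

  P-I : ∀ n → P n * I n ≈ # 1
  P-I zero    = trans (*-identityˡ (I 0)) I-zero
  P-I (suc n) = begin
    P n * factor (suc n) * I (suc n)   ≈⟨ *-assoc _ _ _ ⟩
    P n * (factor (suc n) * I (suc n)) ≈⟨ *-congˡ (factor-I n) ⟩
    P n * I n                          ≈⟨ P-I n ⟩
    # 1                                ∎

  -- The diagonal: coefficient n is final from the n-th approximant on as soon as F is stable.
  -- `invPoch` is defined in this same shape.
  limit : (ℕ → Series) → Series
  limit F n = F n n

  module _ {F : ℕ → Series} (stable : ∀ n → F (suc n) ≈[ n ] F n) where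

    stable-+ : ∀ n k → F (k ℕ.+ n) ≈[ n ] F n
    stable-+ n zero    = ≈[]-refl
    stable-+ n (suc k) = ≈[]-trans (≈[]-weaken (ℕₚ.m≤n+m n k) (stable (k ℕ.+ n))) (stable-+ n k)

    stable-≤ : ∀ {m n} → m ℕ.≤ n → F n ≈[ m ] F m
    stable-≤ {m} {n} m≤n = subst (λ k → F k ≈[ m ] F m) (ℕₚ.m∸n+n≡m m≤n) (stable-+ m (n ℕ.∸ m))

    limit≈ : ∀ N → limit F ≈[ N ] F N
    limit≈ N = agree λ n n≤N → ≡.sym (below (stable-≤ n≤N) n ℕₚ.≤-refl)

  stable-by : ∀ {n f g} h → f ≈ g + X ^ suc n * h → f ≈[ n ] g
  stable-by {n} {f} {g} h eq = ≈[]-trans (≈⇒≈[] n eq) (≈[]-trans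
    (⊕-cong[] ≈[]-refl (X^⊗≈[]0 h (ℕₚ.n<1+n n))) (≈⇒≈[] n (+-identityʳ g)))

  P-stable : ∀ n → P (suc n) ≈[ n ] P n
  P-stable n = stable-by (- P n) (solve 2 (λ p x → p :* (κ 1 :- x) := p :+ x :* (:- p)) refl (P n) (X ^ suc n))

  I-stable : ∀ n → I (suc n) ≈[ n ] I n
  I-stable n = stable-by (I (suc n)) (trans
    (solve 2 (λ i x → i := (κ 1 :- x) :* i :+ x :* i) refl (I (suc n)) (X ^ suc n))
    (+-congʳ (factor-I n)))

  E : Series
  E = limit P

  E≈P : ∀ N → E ≈[ N ] P N
  E≈P = limit≈ P-stable

  invPoch≈I : ∀ N → invPoch ≈[ N ] I N
  invPoch≈I = limit≈ I-stable

  E-invPoch : E * invPoch ≈ # 1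
  E-invPoch = ≈[]⇒≈ λ N → ≈[]-trans (⊗-cong[] (E≈P N) (invPoch≈I N)) (≈⇒≈[] N (P-I N))

  E-zero : E 0 ≡ + 1
  E-zero = ⟨⟩-zero-at (+ 1)

  sgn : ℕ → Series
  sgn n = (- # 1) ^ n

  -- The bound is exclusive, unlike that of `sumTo`.
  ∑ : ℕ → (ℕ → Series) → Series
  ∑ zero    F = # 0
  ∑ (suc n) F = ∑ n F + F n

  ∑-cong[] : ∀ {N F G} n → (∀ i → i ℕ.< n → F i ≈[ N ] G i) → ∑ n F ≈[ N ] ∑ n G
  ∑-cong[] zero    eq = ≈[]-refl
  ∑-cong[] (suc n) eq = ⊕-cong[] (∑-cong[] n λ i i<n → eq i (ℕₚ.m<n⇒m<1+n i<n)) (eq n ℕₚ.≤-refl)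

  ∑-cong : ∀ {F G} n → (∀ i → F i ≈ G i) → ∑ n F ≈ ∑ n G
  ∑-cong zero    eq = refl
  ∑-cong (suc n) eq = +-cong (∑-cong n eq) (eq n)

  ∑-*ˡ : ∀ c F n → ∑ n (λ i → c * F i) ≈ c * ∑ n F
  ∑-*ˡ c F zero    = solve 1 (λ c → κ 0 := c :* κ 0) refl c
  ∑-*ˡ c F (suc n) = trans (+-congʳ (∑-*ˡ c F n)) (sym (distribˡ c (∑ n F) (F n)))

-- Euler's pentagonal number theorem by finite sums.

module PentagonalNumbers where
  open PowerSeries
  open SeriesAlgebra
  open TriangularNumbers
  open Operators
  open EulerProduct
  open import Data.Integer using (+_)
  open import Data.Nat as ℕ using (ℕ; zero; suc; z≤n; s≤s)
  import Data.Nat.Properties as ℕₚ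
  open import Data.Nat.Tactic.RingSolver using (solve-∀)
  open import Relation.Binary.PropositionalEquality using (_≡_)
  open import Relation.Binary.Reasoning.Setoid setoid

  -- Shanks' finite sums: P n · ∑_{s≤n} (-1)^s q^{sn + s(s+1)/2} / P s is a partial sum of the pentagonal series.
  shanksTerm : ℕ → ℕ → Series
  shanksTerm n s = sgn s * I s * X ^ (s ℕ.* n ℕ.+ triangle s)

  shanks : ℕ → Series
  shanks n = P n * ∑ (suc n) (shanksTerm n)

  pentagonalTerm : ℕ → Series
  pentagonalTerm n = sgn (suc n) * (X ^ pentagonal⁻ n + X ^ pentagonal⁺ n)

  pentagonalSum : ℕ → Series
  pentagonalSum n = # 1 + ∑ n pentagonalTerm

  -- Raising n by one multiplies term s by q^s, and 1 - q^s turns 1 / P s into 1 / P (s - 1).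
  -- Consecutive contributions therefore cancel and one boundary term survives.
  shanks-telescope : ∀ n k → factor (suc n) * ∑ (suc k) (shanksTerm (suc n)) ≈
    ∑ (suc k) (shanksTerm n) - sgn k * I k * X ^ (suc k ℕ.* suc n ℕ.+ triangle k)
  shanks-telescope n zero = begin
    factor (suc n) * (# 0 + # 1 * I 0 * # 1)
      ≈⟨ solve 2 (λ x i → (κ 1 :- x) :* (κ 0 :+ κ 1 :* i :* κ 1) := (κ 0 :+ κ 1 :* i :* κ 1) :- κ 1 :* i :* x) refl (X ^ suc n) (I 0) ⟩
    # 0 + # 1 * I 0 * # 1 - # 1 * I 0 * X ^ suc n
      ≈⟨ +-congˡ (-‿cong (*-congˡ (X^-≡ (exponent n)))) ⟩
    # 0 + # 1 * I 0 * # 1 - # 1 * I 0 * X ^ (1 ℕ.* suc n ℕ.+ 0) ∎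
    where
    exponent : ∀ n → suc n ≡ 1 ℕ.* suc n ℕ.+ 0
    exponent = solve-∀
  shanks-telescope n (suc k) = begin
    factor (suc n) * (∑ (suc k) (shanksTerm (suc n)) + shanksTerm (suc n) (suc k))
      ≈⟨ distribˡ _ _ _ ⟩
    factor (suc n) * ∑ (suc k) (shanksTerm (suc n)) + factor (suc n) * shanksTerm (suc n) (suc k)
      ≈⟨ +-cong (shanks-telescope n k) (*-congˡ (*-congˡ (X^-split (suc k ℕ.* n ℕ.+ triangle (suc k)) (suc k) (exponent₁ n k (triangle k))))) ⟩
    S - σ * I k * X ^ (suc k ℕ.* suc n ℕ.+ triangle k) + (# 1 - x) * (- # 1 * σ * i * (w * y))
      ≈⟨ +-congʳ (+-congˡ (-‿cong (*-cong (*-congˡ (sym (factor-I k))) (X^-≡ (exponent₂ n k (triangle k)))))) ⟩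
    S - σ * ((# 1 - y) * i) * w + (# 1 - x) * (- # 1 * σ * i * (w * y))
      ≈⟨ solve 6 (λ S σ i w x y →
           S :- σ :* ((κ 1 :- y) :* i) :* w :+ (κ 1 :- x) :* (:- κ 1 :* σ :* i :* (w :* y)) :=
           S :+ :- κ 1 :* σ :* i :* w :- :- κ 1 :* σ :* i :* (w :* y :* x)) refl S σ i w x y ⟩
    S + - # 1 * σ * i * w - - # 1 * σ * i * (w * y * x)
      ≈⟨ +-congˡ (-‿cong (*-congˡ (sym (trans
           (X^-split (suc k ℕ.* n ℕ.+ triangle (suc k) ℕ.+ suc k) (suc n) (exponent₃ n k (triangle k)))
           (*-congʳ (X^-+ (suc k ℕ.* n ℕ.+ triangle (suc k)) (suc k))))))) ⟩
    S + - # 1 * σ * i * w - - # 1 * σ * i * X ^ (suc (suc k) ℕ.* suc n ℕ.+ triangle (suc k)) ∎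
    where
    S = ∑ (suc k) (shanksTerm n)
    i = I (suc k)
    σ = sgn k
    x = X ^ suc n
    y = X ^ suc k
    w = X ^ (suc k ℕ.* n ℕ.+ triangle (suc k))
    exponent₁ : ∀ n k t → suc k ℕ.* suc n ℕ.+ (t ℕ.+ suc k) ≡ suc k ℕ.* n ℕ.+ (t ℕ.+ suc k) ℕ.+ suc k
    exponent₁ = solve-∀
    exponent₂ : ∀ n k t → suc k ℕ.* suc n ℕ.+ t ≡ suc k ℕ.* n ℕ.+ (t ℕ.+ suc k)
    exponent₂ = solve-∀
    exponent₃ : ∀ n k t → suc (suc k) ℕ.* suc n ℕ.+ (t ℕ.+ suc k) ≡ suc k ℕ.* n ℕ.+ (t ℕ.+ suc k) ℕ.+ suc k ℕ.+ suc n
    exponent₃ = solve-∀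

  -- The new summand s = n + 1 has exponent `pentagonal⁺ n`, the boundary term of the telescope has
  -- exponent `pentagonal⁻ n`, and in both the prefactor cancels the inverse product.
  shanks-suc : ∀ n → shanks (suc n) ≈ shanks n + pentagonalTerm n
  shanks-suc n = begin
    P n * factor (suc n) * (S + sgn (suc n) * I (suc n) * q⁺)
      ≈⟨ solve 6 (λ p f S σ i q → p :* f :* (S :+ σ :* i :* q) := p :* (f :* S) :+ p :* f :* i :* (σ :* q)) refl (P n) (factor (suc n)) S (sgn (suc n)) (I (suc n)) q⁺ ⟩
    P n * (factor (suc n) * S) + P (suc n) * I (suc n) * (sgn (suc n) * q⁺)
      ≈⟨ +-cong (*-congˡ (shanks-telescope n n)) (*-congʳ (P-I (suc n))) ⟩
    P n * (∑ (suc n) (shanksTerm n) - sgn n * I n * q⁻) + # 1 * (sgn (suc n) * q⁺)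
      ≈⟨ solve 6 (λ p S σ i q r → p :* (S :- σ :* i :* q) :+ κ 1 :* (:- κ 1 :* σ :* r) :=
           p :* S :+ (:- κ 1 :* σ :* r :- p :* i :* (σ :* q))) refl (P n) _ (sgn n) (I n) q⁻ q⁺ ⟩
    shanks n + (- # 1 * sgn n * q⁺ - P n * I n * (sgn n * q⁻))
      ≈⟨ +-congˡ (+-congˡ (-‿cong (*-congʳ (P-I n)))) ⟩
    shanks n + (- # 1 * sgn n * q⁺ - # 1 * (sgn n * q⁻))
      ≈⟨ +-congˡ (solve 3 (λ σ q r → :- κ 1 :* σ :* r :- κ 1 :* (σ :* q) := :- κ 1 :* σ :* (q :+ r)) refl (sgn n) q⁻ q⁺) ⟩
    shanks n + pentagonalTerm n ∎
    where
    S = ∑ (suc n) (shanksTerm (suc n))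
    q⁻ = X ^ pentagonal⁻ n
    q⁺ = X ^ pentagonal⁺ n

  shanks≈pentagonalSum : ∀ n → shanks n ≈ pentagonalSum n
  shanks≈pentagonalSum zero = begin
    # 1 * (# 0 + # 1 * I 0 * # 1) ≈⟨ solve 1 (λ i → κ 1 :* (κ 0 :+ κ 1 :* i :* κ 1) := i :+ κ 0) refl (I 0) ⟩
    I 0 + # 0                     ≈⟨ +-congʳ I-zero ⟩
    # 1 + # 0                     ∎
  shanks≈pentagonalSum (suc n) = trans (shanks-suc n)
    (trans (+-congʳ (shanks≈pentagonalSum n)) (+-assoc (# 1) (∑ n pentagonalTerm) (pentagonalTerm n)))

  -- Every term s ≥ 1 of the sum in `shanks N` has exponent s N + triangle s > N, so only `P N` is
  -- visible to this order.
  E≈pentagonalSum : ∀ N → E ≈[ N ] pentagonalSum N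
  E≈pentagonalSum N = ≈[]-trans (E≈P N) (≈[]-trans (≈[]-sym tail-negligible) (≈⇒≈[] N (shanks≈pentagonalSum N)))
    where
    sum≈1 : ∀ k → ∑ (suc k) (shanksTerm N) ≈[ N ] # 1
    sum≈1 zero = ≈⇒≈[] N (trans
      (solve 1 (λ i → κ 0 :+ κ 1 :* i :* κ 1 := i) refl (I 0)) I-zero)
    sum≈1 (suc k) = ≈[]-trans (⊕-cong[] (sum≈1 k) (≈[]-trans (≈⇒≈[] N (*-comm _ _))
      (X^⊗≈[]0 _ (ℕₚ.≤-trans (ℕₚ.≤-reflexive (ℕₚ.+-comm 1 N))
        (ℕₚ.+-mono-≤ (ℕₚ.m≤m+n N (k ℕ.* N)) (ℕₚ.≤-trans (s≤s z≤n) (n≤triangle (suc k))))))))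
      (≈⇒≈[] N (+-identityʳ (# 1)))
    tail-negligible : shanks N ≈[ N ] P N
    tail-negligible = ≈[]-trans (⊗-cong[] (≈[]-refl {P N}) (sum≈1 N)) (≈⇒≈[] N (*-identityʳ (P N)))

-- Exponents modulo 5 and the dissection of E.

module ResidueClasses where
  open PowerSeries
  open SeriesAlgebra
  open TriangularNumbers
  open Operators
  open EulerProduct
  open PentagonalNumbers
  open import Data.Empty using (⊥-elim)
  open import Data.Integer as ℤ using (+_)
  import Data.Integer.Properties as ℤₚ
  open import Data.Nat as ℕ using (ℕ; zero; suc; s≤s)
  open import Data.Nat.Divisibility using (n∣m⇒m%n≡0)
  open import Data.Nat.DivMod using (_%_; %-distribˡ-+; [m+kn]%n≡m%n; m*n%n≡0; m%n<n)
  import Data.Nat.Properties as ℕₚ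
  open import Relation.Binary.PropositionalEquality as ≡ using (_≡_; _≢_; cong; cong₂)
  open import Relation.Binary.Reasoning.Setoid setoid
  open import Relation.Nullary using (Dec; yes; no)

  -- The residue r is left unreduced, so that a product carries the plain sum of residues;
  -- `supported-%` changes the representative.
  record Supported (r : ℕ) (f : Series) : Set where
    constructor supported
    field outside : ∀ n → n % 5 ≢ r % 5 → f n ≡ + 0
  open Supported public

  supported-≈ : ∀ {r f g} → f ≈ g → Supported r f → Supported r g
  supported-≈ eq s = supported λ n n≢r → ≡.trans (≡.sym (at eq n)) (outside s n n≢r)

  supported-% : ∀ {r s f} → r % 5 ≡ s % 5 → Supported r f → Supported s f
  supported-% eq s = supported λ n n≢s → outside s n λ n≡r → n≢s (≡.trans n≡r eq)

  supported-+ : ∀ {r f g} → Supported r f → Supported r g → Supported r (f + g)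
  supported-+ {f = f} {g} s t = supported λ n n≢r →
    ≡.trans (⊕-at f g n) (cong₂ ℤ._+_ (outside s n n≢r) (outside t n n≢r))

  supported-neg : ∀ {r f} → Supported r f → Supported r (- f)
  supported-neg {f = f} s = supported λ n n≢r → ≡.trans (⊝-at f n) (cong ℤ.-_ (outside s n n≢r))

  supported-* : ∀ {r s f g} → Supported r f → Supported s g → Supported (r ℕ.+ s) (f * g)
  supported-* {r} {s} {f} {g} sf sg = supported λ n n≢ → ≡.trans (⊗-at f g n)
    (≡.trans (sumTo-cong n (term n n≢)) (sumTo-zero n))
    where
    term : ∀ n → n % 5 ≢ (r ℕ.+ s) % 5 → ∀ i → i ℕ.≤ n → f i ℤ.* g (n ℕ.∸ i) ≡ + 0
    term n n≢ i i≤n with i % 5 ℕₚ.≟ r % 5 | (n ℕ.∸ i) % 5 ℕₚ.≟ s % 5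
    ... | no i≢r | _ = ≡.trans (cong (ℤ._* g (n ℕ.∸ i)) (outside sf i i≢r)) (ℤₚ.*-zeroˡ (g (n ℕ.∸ i)))
    ... | yes _ | no n-i≢s = ≡.trans (cong (f i ℤ.*_) (outside sg (n ℕ.∸ i) n-i≢s)) (ℤₚ.*-zeroʳ (f i))
    ... | yes i≡r | yes n-i≡s = ⊥-elim (n≢ (≡.trans (cong (_% 5) (≡.sym (ℕₚ.m+[n∸m]≡n i≤n)))
            (≡.trans (%-distribˡ-+ i (n ℕ.∸ i) 5) (≡.trans (cong₂ (λ a b → (a ℕ.+ b) % 5) i≡r n-i≡s)
              (≡.sym (%-distribˡ-+ r s 5))))))

  supported-⟨⟩ : ∀ c → Supported 0 ⟨ c ⟩
  supported-⟨⟩ c = supported λ where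
    zero    0≢0 → ⊥-elim (0≢0 ≡.refl)
    (suc n) _   → ⟨⟩-suc-at c n

  supported-^ : ∀ {r f} → Supported r f → ∀ k → Supported (k ℕ.* r) (f ^ k)
  supported-^ s zero    = supported-⟨⟩ (+ 1)
  supported-^ s (suc k) = supported-* s (supported-^ s k)

  infixl 7 _·_
  _·_ : ∀ {r s f g} → Supported r f → Supported s g → Supported (r ℕ.+ s) (f * g)
  _·_ = supported-*

  infixr 8 _↑_
  _↑_ : ∀ {r f} → Supported r f → ∀ k → Supported (k ℕ.* r) (f ^ k)
  _↑_ = supported-^

  supported-#* : ∀ n {r f} → Supported r f → Supported r (# n * f)
  supported-#* n s = supported-⟨⟩ (+ n) · s

  supported-V : ∀ f → Supported 0 (V f)
  supported-V f = supported λ n n≢0 → dilate-off 5 f n λ 5∣n → n≢0 (n∣m⇒m%n≡0 n 5 5∣n)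

  supported-X^ : ∀ r k {e} → e ≡ r ℕ.+ k ℕ.* 5 → Supported r (X ^ e)
  supported-X^ r k {e} ≡.refl = supported λ n n≢r → X^-other e n λ { ≡.refl → n≢r ([m+kn]%n≡m%n r k 5) }

  supported-θ : ∀ {r f} → Supported r f → Supported r (θ f)
  supported-θ {f = f} s = supported λ n n≢r →
    ≡.trans (θ-at f n) (≡.trans (cong (+ n ℤ.*_) (outside s n n≢r)) (ℤₚ.*-zeroʳ (+ n)))

  U-supported : ∀ {r f} → r % 5 ≢ 0 → Supported r f → U f ≈ # 0
  U-supported {r} {f} r≢0 s = pointwise λ n → ≡.trans (U-at f n)
    (≡.trans (outside s (n ℕ.* 5) λ eq → r≢0 (≡.trans (≡.sym eq) (m*n%n≡0 n 5))) (≡.sym (⟨0⟩-at n)))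

  select : ∀ {A : Set} → Dec A → ℤ.ℤ → ℤ.ℤ
  select (yes _) a = a
  select (no  _) _ = + 0

  opaque
    part : ℕ → Series → Series
    part r f n = select (n % 5 ℕₚ.≟ r) (f n)

  opaque
    unfolding part _⊕_

    part-supported : ∀ r f → r % 5 ≡ r → Supported r (part r f)
    part-supported r f r<5 = supported go
      where
      go : ∀ n → n % 5 ≢ r % 5 → part r f n ≡ + 0
      go n n≢r with n % 5 ℕₚ.≟ r
      ... | yes n≡r = ⊥-elim (n≢r (≡.trans n≡r (≡.sym r<5)))
      ... | no  _   = ≡.refl

    part-cong[] : ∀ r {f g N} → f ≈[ N ] g → part r f ≈[ N ] part r g
    part-cong[] r {f} {g} {N} eq = agree go
      where
      go : ∀ n → n ℕ.≤ N → part r f n ≡ part r g n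
      go n n≤N with n % 5 ℕₚ.≟ r
      ... | yes _ = below eq n n≤N
      ... | no  _ = ≡.refl

    part-+ : ∀ r f g → part r (f + g) ≈ part r f + part r g
    part-+ r f g = pointwise go
      where
      go : ∀ n → part r (f + g) n ≡ (part r f + part r g) n
      go n with n % 5 ℕₚ.≟ r
      ... | yes _ = ≡.refl
      ... | no  _ = ≡.refl

    part-same : ∀ r {f} → r % 5 ≡ r → Supported r f → part r f ≈ f
    part-same r {f} r<5 s = pointwise go
      where
      go : ∀ n → part r f n ≡ f n
      go n with n % 5 ℕₚ.≟ r
      ... | yes _   = ≡.refl
      ... | no  n≢r = ≡.sym (outside s n λ n≡r → n≢r (≡.trans n≡r r<5))

    part-other : ∀ r {s f} → s % 5 ≢ r → Supported s f → part r f ≈ # 0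
    part-other r {s} {f} s≢r sf = pointwise λ n → ≡.trans (go n) (≡.sym (⟨0⟩-at n))
      where
      go : ∀ n → part r f n ≡ + 0
      go n with n % 5 ℕₚ.≟ r
      ... | yes n≡r = outside sf n λ n≡s → s≢r (≡.trans (≡.sym n≡s) n≡r)
      ... | no  _   = ≡.refl

    part-zero : ∀ f → part 0 f 0 ≡ f 0
    part-zero f = ≡.refl

    parts : ∀ f → f ≈ part 0 f + part 1 f + part 2 f + part 3 f + part 4 f
    parts f = pointwise λ n → decompose (n % 5) (m%n<n n 5) (f n)
      where
      -- With n % 5 replaced by a variable k below 5, the five selections compute in each case.
      decompose : ∀ k → k ℕ.< 5 → ∀ a → a ≡
        select (k ℕₚ.≟ 0) a ℤ.+ select (k ℕₚ.≟ 1) a ℤ.+ select (k ℕₚ.≟ 2) a ℤ.+ select (k ℕₚ.≟ 3) a ℤ.+ select (k ℕₚ.≟ 4) a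
      decompose 0 _ a = ≡.sym (≡.trans (ℤₚ.+-identityʳ _) (≡.trans (ℤₚ.+-identityʳ _) (≡.trans (ℤₚ.+-identityʳ _) (ℤₚ.+-identityʳ a))))
      decompose 1 _ a = ≡.sym (≡.trans (ℤₚ.+-identityʳ _) (≡.trans (ℤₚ.+-identityʳ _) (≡.trans (ℤₚ.+-identityʳ _) (ℤₚ.+-identityˡ a))))
      decompose 2 _ a = ≡.sym (≡.trans (ℤₚ.+-identityʳ _) (≡.trans (ℤₚ.+-identityʳ _) (ℤₚ.+-identityˡ a)))
      decompose 3 _ a = ≡.sym (≡.trans (ℤₚ.+-identityʳ _) (ℤₚ.+-identityˡ a))
      decompose 4 _ a = ≡.sym (ℤₚ.+-identityˡ a)
      decompose (suc (suc (suc (suc (suc _))))) (s≤s (s≤s (s≤s (s≤s (s≤s ()))))) _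

  dilate-sgn : ∀ m .{{_ : ℕ.NonZero m}} n → dilate m (sgn n) ≈ sgn n
  dilate-sgn m n = trans (dilate-^ m (- # 1) n)
    (^-congˡ n (trans (dilate-⊝ m (# 1)) (-‿cong (dilate-⟨⟩ m (+ 1)))))

  supported-sgn : ∀ n → Supported 0 (sgn n)
  supported-sgn zero    = supported-⟨⟩ (+ 1)
  supported-sgn (suc n) = supported-* (supported-neg (supported-⟨⟩ (+ 1))) (supported-sgn n)

  supported-sgn* : ∀ n {r f} → Supported r f → Supported r (sgn n * f)
  supported-sgn* n = supported-* (supported-sgn n)

  mod5-cases : (Q : ℕ → Set) → (∀ m → Q (m ℕ.* 5)) → (∀ m → Q (1 ℕ.+ m ℕ.* 5)) → (∀ m → Q (2 ℕ.+ m ℕ.* 5)) →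
               (∀ m → Q (3 ℕ.+ m ℕ.* 5)) → (∀ m → Q (4 ℕ.+ m ℕ.* 5)) → ∀ n → Q n
  mod5-cases Q q₀ q₁ q₂ q₃ q₄ 0 = q₀ 0
  mod5-cases Q q₀ q₁ q₂ q₃ q₄ 1 = q₁ 0
  mod5-cases Q q₀ q₁ q₂ q₃ q₄ 2 = q₂ 0
  mod5-cases Q q₀ q₁ q₂ q₃ q₄ 3 = q₃ 0
  mod5-cases Q q₀ q₁ q₂ q₃ q₄ 4 = q₄ 0
  mod5-cases Q q₀ q₁ q₂ q₃ q₄ (suc (suc (suc (suc (suc n))))) =
    mod5-cases (λ n → Q (5 ℕ.+ n)) (λ m → q₀ (suc m)) (λ m → q₁ (suc m)) (λ m → q₂ (suc m))
      (λ m → q₃ (suc m)) (λ m → q₄ (suc m)) n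

  supported-pentagonal⁻ : ∀ i m → Supported (pentagonal⁻ i) (X ^ pentagonal⁻ (i ℕ.+ m ℕ.* 5))
  supported-pentagonal⁻ i m = supported-X^ (pentagonal⁻ i) (2 ℕ.* suc i ℕ.* m ℕ.+ 5 ℕ.* m ℕ.* m ℕ.+ (i ℕ.* m ℕ.+ fifthTriangle m)) (squareTriangle-shift (suc i) i m)

  supported-pentagonal⁺ : ∀ i m → Supported (pentagonal⁺ i) (X ^ pentagonal⁺ (i ℕ.+ m ℕ.* 5))
  supported-pentagonal⁺ i m = supported-X^ (pentagonal⁺ i) (2 ℕ.* suc i ℕ.* m ℕ.+ 5 ℕ.* m ℕ.* m ℕ.+ (suc i ℕ.* m ℕ.+ fifthTriangle m)) (squareTriangle-shift (suc i) (suc i) m)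

  part-pentagonalTerm : ∀ r n → part r (pentagonalTerm n) ≈
    part r (sgn (suc n) * X ^ pentagonal⁻ n) + part r (sgn (suc n) * X ^ pentagonal⁺ n)
  part-pentagonalTerm r n = trans (≈[]⇒≈ λ N → part-cong[] r (≈⇒≈[] N (distribˡ (sgn (suc n)) _ _))) (part-+ r _ _)

  part-cong : ∀ r {f g} → f ≈ g → part r f ≈ part r g
  part-cong r eq = ≈[]⇒≈ λ N → part-cong[] r (≈⇒≈[] N eq)

  part-term≈0 : ∀ r i m → pentagonal⁻ i % 5 ≢ r → pentagonal⁺ i % 5 ≢ r → part r (pentagonalTerm (i ℕ.+ m ℕ.* 5)) ≈ # 0
  part-term≈0 r i m ⁻≢r ⁺≢r = trans (part-pentagonalTerm r n) (trans
    (+-cong (part-other r ⁻≢r (supported-sgn* (suc n) (supported-pentagonal⁻ i m)))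
            (part-other r ⁺≢r (supported-sgn* (suc n) (supported-pentagonal⁺ i m))))
    (+-identityʳ (# 0)))
    where n = i ℕ.+ m ℕ.* 5

  part-pentagonalSum≈0 : ∀ r → 0 ≢ r → (∀ n → part r (pentagonalTerm n) ≈ # 0) →
                         ∀ n → part r (pentagonalSum n) ≈ # 0
  part-pentagonalSum≈0 r 0≢r terms n = trans (part-+ r (# 1) (∑ n pentagonalTerm))
    (trans (+-cong (part-other r 0≢r (supported-⟨⟩ (+ 1))) (sum n)) (+-identityʳ (# 0)))
    where
    sum : ∀ n → part r (∑ n pentagonalTerm) ≈ # 0
    sum zero    = part-other r 0≢r (supported-⟨⟩ (+ 0))
    sum (suc n) = trans (part-+ r _ _) (trans (+-cong (sum n) (terms n)) (+-identityʳ (# 0)))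

  part-E≈0 : ∀ r → 0 ≢ r → (∀ n → part r (pentagonalTerm n) ≈ # 0) → part r E ≈ # 0
  part-E≈0 r 0≢r terms = ≈[]⇒≈ λ N → ≈[]-trans (part-cong[] r (E≈pentagonalSum N))
    (≈⇒≈[] N (part-pentagonalSum≈0 r 0≢r terms N))

  -- For a pentagonal number p, 24 p + 1 is a square, so 1 - p is 0, 1 or 4 modulo 5 and p is never
  -- 3 or 4.
  part-3-E : part 3 E ≈ # 0
  part-3-E = part-E≈0 3 (λ ()) (mod5-cases _
    (λ m → part-term≈0 3 0 m (λ ()) (λ ())) (λ m → part-term≈0 3 1 m (λ ()) (λ ()))
    (λ m → part-term≈0 3 2 m (λ ()) (λ ())) (λ m → part-term≈0 3 3 m (λ ()) (λ ()))
    (λ m → part-term≈0 3 4 m (λ ()) (λ ())))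

  part-4-E : part 4 E ≈ # 0
  part-4-E = part-E≈0 4 (λ ()) (mod5-cases _
    (λ m → part-term≈0 4 0 m (λ ()) (λ ())) (λ m → part-term≈0 4 1 m (λ ()) (λ ()))
    (λ m → part-term≈0 4 2 m (λ ()) (λ ())) (λ m → part-term≈0 4 3 m (λ ()) (λ ()))
    (λ m → part-term≈0 4 4 m (λ ()) (λ ())))

  sgn-*5 : ∀ m → sgn (m ℕ.* 5) ≈ sgn m
  sgn-*5 zero    = refl
  sgn-*5 (suc m) = trans
    (solve 1 (λ σ → :- κ 1 :* (:- κ 1 :* (:- κ 1 :* (:- κ 1 :* (:- κ 1 :* σ)))) := :- κ 1 :* σ) refl (sgn (m ℕ.* 5)))
    (*-congˡ (sgn-*5 m))

  V²-X^ : ∀ e → V (V (X ^ e)) ≈ X ^ (5 ℕ.* (5 ℕ.* e))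
  V²-X^ e = trans (dilate-cong 5 (dilate-X^ 5 e)) (dilate-X^ 5 (5 ℕ.* e))

  V²-pentagonalTerm : ∀ m → V (V (pentagonalTerm m)) ≈
    sgn (suc m) * (X ^ (5 ℕ.* (5 ℕ.* pentagonal⁻ m)) + X ^ (5 ℕ.* (5 ℕ.* pentagonal⁺ m)))
  V²-pentagonalTerm m = trans (dilate-cong 5 (dilate-⊗ 5 _ _)) (trans (dilate-⊗ 5 _ _) (*-cong
    (trans (dilate-cong 5 (dilate-sgn 5 (suc m))) (dilate-sgn 5 (suc m)))
    (trans (dilate-cong 5 (dilate-⊕ 5 _ _)) (trans (dilate-⊕ 5 _ _) (+-cong (V²-X^ (pentagonal⁻ m)) (V²-X^ (pentagonal⁺ m)))))))

  part-term⁺ : ∀ m → part 1 (pentagonalTerm (3 ℕ.+ m ℕ.* 5)) ≈ sgn m * (X * X ^ (5 ℕ.* (5 ℕ.* pentagonal⁻ m)))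
  part-term⁺ m = begin
    part 1 (pentagonalTerm n)
      ≈⟨ part-pentagonalTerm 1 n ⟩
    part 1 (sgn (suc n) * X ^ pentagonal⁻ n) + part 1 (sgn (suc n) * X ^ pentagonal⁺ n)
      ≈⟨ +-cong (part-other 1 (λ ()) (supported-sgn* (suc n) (supported-pentagonal⁻ 3 m)))
                (part-same 1 ≡.refl (supported-% ≡.refl (supported-sgn* (suc n) (supported-pentagonal⁺ 3 m)))) ⟩
    # 0 + sgn (suc n) * X ^ pentagonal⁺ n
      ≈⟨ +-congˡ (*-cong (trans
           (solve 1 (λ σ → :- κ 1 :* (:- κ 1 :* (:- κ 1 :* (:- κ 1 :* σ))) := σ) refl (sgn (m ℕ.* 5))) (sgn-*5 m))
           (X^-≡ (pentagonal⁺-scale m))) ⟩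
    # 0 + sgn m * (X * X ^ (5 ℕ.* (5 ℕ.* pentagonal⁻ m)))
      ≈⟨ +-identityˡ _ ⟩
    sgn m * (X * X ^ (5 ℕ.* (5 ℕ.* pentagonal⁻ m))) ∎
    where n = 3 ℕ.+ m ℕ.* 5

  -- The index starts at 5 instead of 0 so that k = 6 + 5 m has the same sign as k = 4 + 5 m of
  -- `part-term⁺`; together they form the dilate of `pentagonalTerm m`.
  part-term⁻ : ∀ m → part 1 (pentagonalTerm (5 ℕ.+ m ℕ.* 5)) ≈ sgn m * (X * X ^ (5 ℕ.* (5 ℕ.* pentagonal⁺ m)))
  part-term⁻ m = begin
    part 1 (pentagonalTerm n)
      ≈⟨ part-pentagonalTerm 1 n ⟩
    part 1 (sgn (suc n) * X ^ pentagonal⁻ n) + part 1 (sgn (suc n) * X ^ pentagonal⁺ n)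
      ≈⟨ +-cong (part-same 1 ≡.refl (supported-% ≡.refl (supported-sgn* (suc n) (supported-pentagonal⁻ 5 m))))
                (part-other 1 (λ ()) (supported-sgn* (suc n) (supported-pentagonal⁺ 5 m))) ⟩
    sgn (suc n) * X ^ pentagonal⁻ n + # 0
      ≈⟨ +-congʳ (*-cong (trans
           (solve 1 (λ σ → :- κ 1 :* (:- κ 1 :* (:- κ 1 :* (:- κ 1 :* (:- κ 1 :* (:- κ 1 :* σ))))) := σ) refl (sgn (m ℕ.* 5))) (sgn-*5 m))
           (X^-≡ (pentagonal⁻-scale m))) ⟩
    sgn m * (X * X ^ (5 ℕ.* (5 ℕ.* pentagonal⁺ m))) + # 0
      ≈⟨ +-identityʳ _ ⟩
    sgn m * (X * X ^ (5 ℕ.* (5 ℕ.* pentagonal⁺ m))) ∎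
    where n = 5 ℕ.+ m ℕ.* 5

  part-pentagonalSum-suc : ∀ r n → part r (pentagonalSum (suc n)) ≈ part r (pentagonalSum n) + part r (pentagonalTerm n)
  part-pentagonalSum-suc r n = trans (part-cong r (sym (+-assoc (# 1) _ _))) (part-+ r _ _)

  -- Term 0 contributes -q, the image of the constant 1; this accounts for the extra index. Each
  -- later block of five terms contains the two that scale to term m of the sum itself.
  part-1-pentagonalSum : ∀ m → part 1 (pentagonalSum (suc (m ℕ.* 5))) ≈ - (X * V (V (pentagonalSum m)))
  part-1-pentagonalSum zero = begin
    part 1 (pentagonalSum 1)
      ≈⟨ trans (part-pentagonalSum-suc 1 0) (+-congˡ (part-pentagonalTerm 1 0)) ⟩
    part 1 (# 1 + # 0) + (part 1 (sgn 1 * X ^ 1) + part 1 (sgn 1 * X ^ 2))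
      ≈⟨ +-cong (part-other 1 (λ ()) (supported-+ (supported-⟨⟩ (+ 1)) (supported-⟨⟩ (+ 0))))
           (+-cong (part-same 1 ≡.refl (supported-sgn* 1 (supported-X^ 1 0 ≡.refl)))
                   (part-other 1 (λ ()) (supported-sgn* 1 (supported-X^ 2 0 ≡.refl)))) ⟩
    # 0 + (sgn 1 * X ^ 1 + # 0)
      ≈⟨ solve 1 (λ x → κ 0 :+ (:- κ 1 :* κ 1 :* (x :* κ 1) :+ κ 0) := :- (x :* (κ 1 :+ κ 0))) refl X ⟩
    - (X * (# 1 + # 0))
      ≈⟨ -‿cong (*-congˡ (trans (+-cong (V²-⟨⟩ (+ 1)) (V²-⟨⟩ (+ 0))) (V²-+ (# 1) (# 0)))) ⟩
    - (X * V (V (# 1 + # 0))) ∎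
    where
    V²-⟨⟩ : ∀ c → ⟨ c ⟩ ≈ V (V ⟨ c ⟩)
    V²-⟨⟩ c = sym (trans (dilate-cong 5 (dilate-⟨⟩ 5 c)) (dilate-⟨⟩ 5 c))
    V²-+ : ∀ f g → V (V f) + V (V g) ≈ V (V (f + g))
    V²-+ f g = sym (trans (dilate-cong 5 (dilate-⊕ 5 f g)) (dilate-⊕ 5 _ _))
  part-1-pentagonalSum (suc m) = begin
    part 1 (pentagonalSum (6 ℕ.+ m ℕ.* 5))
      ≈⟨ trans (part-pentagonalSum-suc 1 (5 ℕ.+ m ℕ.* 5)) (+-congʳ
           (trans (part-pentagonalSum-suc 1 (4 ℕ.+ m ℕ.* 5)) (+-congʳ
           (trans (part-pentagonalSum-suc 1 (3 ℕ.+ m ℕ.* 5)) (+-congʳ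
           (trans (part-pentagonalSum-suc 1 (2 ℕ.+ m ℕ.* 5)) (+-congʳ
           (part-pentagonalSum-suc 1 (1 ℕ.+ m ℕ.* 5))))))))) ⟩
    part 1 (pentagonalSum (suc (m ℕ.* 5))) + part 1 (pentagonalTerm (1 ℕ.+ m ℕ.* 5))
      + part 1 (pentagonalTerm (2 ℕ.+ m ℕ.* 5)) + part 1 (pentagonalTerm (3 ℕ.+ m ℕ.* 5))
      + part 1 (pentagonalTerm (4 ℕ.+ m ℕ.* 5)) + part 1 (pentagonalTerm (5 ℕ.+ m ℕ.* 5))
      ≈⟨ +-cong (+-cong (+-cong (+-cong (+-cong (part-1-pentagonalSum m)
           (part-term≈0 1 1 m (λ ()) (λ ()))) (part-term≈0 1 2 m (λ ()) (λ ()))) (part-term⁺ m))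
           (part-term≈0 1 4 m (λ ()) (λ ()))) (part-term⁻ m) ⟩
    - (X * V (V (pentagonalSum m))) + # 0 + # 0 + sgn m * (X * q⁻) + # 0 + sgn m * (X * q⁺)
      ≈⟨ solve 5 (λ x S σ q r → :- (x :* S) :+ κ 0 :+ κ 0 :+ σ :* (x :* q) :+ κ 0 :+ σ :* (x :* r) :=
           :- (x :* (S :+ :- κ 1 :* σ :* (q :+ r)))) refl X (V (V (pentagonalSum m))) (sgn m) q⁻ q⁺ ⟩
    - (X * (V (V (pentagonalSum m)) + sgn (suc m) * (q⁻ + q⁺)))
      ≈⟨ -‿cong (*-congˡ (+-congˡ (sym (V²-pentagonalTerm m)))) ⟩
    - (X * (V (V (pentagonalSum m)) + V (V (pentagonalTerm m))))
      ≈⟨ -‿cong (*-congˡ (sym (trans (dilate-cong 5 (trans (dilate-cong 5 (sym (+-assoc (# 1) _ _))) (dilate-⊕ 5 _ _))) (dilate-⊕ 5 _ _)))) ⟩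
    - (X * V (V (pentagonalSum (suc m)))) ∎
    where
    q⁻ = X ^ (5 ℕ.* (5 ℕ.* pentagonal⁻ m))
    q⁺ = X ^ (5 ℕ.* (5 ℕ.* pentagonal⁺ m))

  E₅ E₂₅ : Series
  E₅ = V E
  E₂₅ = V E₅

  part-1-E : part 1 E ≈ - (X * E₂₅)
  part-1-E = ≈[]⇒≈ λ N → ≈[]-trans
    (part-cong[] 1 (≈[]-weaken (ℕₚ.≤-trans (ℕₚ.m≤m*n N 5) (ℕₚ.n≤1+n _)) (E≈pentagonalSum (suc (N ℕ.* 5)))))
    (≈[]-trans (≈⇒≈[] N (part-1-pentagonalSum N))
      (-‿cong[] (⊗-cong[] (≈[]-refl {X}) (dilate-cong[] 5 (dilate-cong[] 5 (≈[]-sym (E≈pentagonalSum N)))))))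

  A B y : Series
  A = part 0 E
  B = part 2 E
  y = X * E₂₅

  E-dissection : E ≈ A + B - y
  E-dissection = begin
    E                                                        ≈⟨ parts E ⟩
    A + part 1 E + B + part 3 E + part 4 E                   ≈⟨ +-cong (+-cong (+-congʳ (+-congˡ part-1-E)) part-3-E) part-4-E ⟩
    A + - y + B + # 0 + # 0                                  ≈⟨ solve 3 (λ a b y → a :+ :- y :+ b :+ κ 0 :+ κ 0 := a :+ b :- y) refl A B y ⟩
    A + B - y                                                ∎

  A-supported : Supported 0 A
  A-supported = part-supported 0 E ≡.refl

  B-supported : Supported 2 B
  B-supported = part-supported 2 E ≡.refl

  y-supported : Supported 1 y
  y-supported = supported-* (supported-≈ (*-identityʳ X) (supported-X^ 1 0 ≡.refl)) (supported-V E₅)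

-- A finite form of Jacobi's triple product.

module FiniteJacobi where
  open PowerSeries
  open SeriesAlgebra
  open TriangularNumbers
  open Operators
  open EulerProduct
  open import Data.Integer using (+_)
  open import Data.Nat as ℕ using (ℕ; zero; suc; s≤s)
  import Data.Nat.Properties as ℕₚ
  open import Data.Nat.Tactic.RingSolver using (solve-∀)
  open import Relation.Binary.PropositionalEquality as ≡ using (_≡_; cong)
  open import Relation.Binary.Reasoning.Setoid setoid

  -- coefficient N j = q^{j(j+1)/2} [2N+1 choose N-j]_q, reflected by coefficient N (-1) = coefficient N 0.
  coefficient : ℕ → ℕ → Series
  coefficient zero    zero    = # 1
  coefficient zero    (suc j) = # 0
  coefficient (suc N) zero    = (# 1 + X ^ suc N * X ^ suc N) * coefficient N 0 +
    X ^ suc N * (coefficient N 0 + coefficient N 1)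
  coefficient (suc N) (suc j) = (# 1 + X ^ suc N * X ^ suc N) * coefficient N (suc j) +
    X ^ suc N * (coefficient N j + coefficient N (suc (suc j)))

  zero-combination : ∀ {c d u v w} → u ≈ # 0 → v ≈ # 0 → w ≈ # 0 → c * u + d * (v + w) ≈ # 0
  zero-combination {c} {d} u≈0 v≈0 w≈0 = trans (+-cong (*-congˡ u≈0) (*-congˡ (+-cong v≈0 w≈0)))
    (solve 2 (λ c d → c :* κ 0 :+ d :* (κ 0 :+ κ 0) := κ 0) refl c d)

  coefficient≈0 : ∀ N j → N ℕ.< j → coefficient N j ≈ # 0
  coefficient≈0 zero    (suc j) _         = refl
  coefficient≈0 (suc N) (suc j) (s≤s N<j) = zero-combination (coefficient≈0 N (suc j) (ℕₚ.m<n⇒m<1+n N<j))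
    (coefficient≈0 N j N<j) (coefficient≈0 N (suc (suc j)) (ℕₚ.m<n⇒m<1+n (ℕₚ.m<n⇒m<1+n N<j)))

  P-≡ : ∀ {m n} → m ≡ n → P m ≈ P n
  P-≡ ≡.refl = refl

  -- The q-binomial formula with its denominators cleared; d stands for N - j, passed explicitly to
  -- avoid truncated subtraction.
  ClosedForm : ℕ → ℕ → ℕ → Set
  ClosedForm N j d = coefficient N j * (P d * P (suc (N ℕ.+ j))) ≈ X ^ triangle j * P (suc (N ℕ.+ N))

  module _ (N : ℕ) (closed : ∀ j d → N ≡ j ℕ.+ d → ClosedForm N j d) where

    -- The three neighbours at level N are brought to the denominator P d · P (N + j + 2) of entry j
    -- at level N + 1, where d = N + 1 - j. For d = 0 the entry is beyond its range and the factor 1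
    -- - X^0 vanishes too.
    closed-centre : ∀ j d → suc N ≡ j ℕ.+ d → coefficient N j * (P d * P (suc (suc (N ℕ.+ j)))) ≈
      X ^ triangle j * P (suc (N ℕ.+ N)) * ((# 1 - X ^ d) * (# 1 - X ^ suc (suc (N ℕ.+ j))))
    closed-centre j zero    eq = trans
      (*-congʳ (coefficient≈0 N j (ℕₚ.≤-reflexive (≡.trans eq (ℕₚ.+-identityʳ j)))))
      (solve 4 (λ p t u v → κ 0 :* p := t :* u :* ((κ 1 :- κ 1) :* v)) refl _ _ _ _)
    closed-centre j (suc d) eq = begin
      coefficient N j * (P d * factor (suc d) * (P (suc (N ℕ.+ j)) * factor (suc (suc (N ℕ.+ j)))))
        ≈⟨ solve 5 (λ c p f q g → c :* (p :* f :* (q :* g)) := c :* (p :* q) :* (f :* g)) refl _ _ _ _ _ ⟩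
      coefficient N j * (P d * P (suc (N ℕ.+ j))) * (factor (suc d) * factor (suc (suc (N ℕ.+ j))))
        ≈⟨ *-congʳ (closed j d (ℕₚ.suc-injective (≡.trans eq (ℕₚ.+-suc j d)))) ⟩
      X ^ triangle j * P (suc (N ℕ.+ N)) * (factor (suc d) * factor (suc (suc (N ℕ.+ j)))) ∎

    -- Stated with X · (1 - X^d) (1 - X^{d-1}), since the exponent d - 1 is truncated at d = 0.
    closed-right : ∀ j d → suc N ≡ j ℕ.+ d → X * (coefficient N (suc j) * (P d * P (suc (suc (N ℕ.+ j))))) ≈
      X ^ triangle (suc j) * P (suc (N ℕ.+ N)) * ((# 1 - X ^ d) * (X - X ^ d))
    closed-right j zero    eq = trans
      (*-congˡ (*-congʳ (coefficient≈0 N (suc j) (s≤s (ℕₚ.≤-trans (ℕₚ.n≤1+n N) (ℕₚ.≤-reflexive (≡.trans eq (ℕₚ.+-identityʳ j))))))))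
      (solve 5 (λ x p t u v → x :* (κ 0 :* p) := t :* u :* ((κ 1 :- κ 1) :* v)) refl _ _ _ _ _)
    closed-right j (suc zero) eq = trans
      (*-congˡ (*-congʳ (coefficient≈0 N (suc j) (s≤s (ℕₚ.≤-reflexive
        (ℕₚ.suc-injective (≡.trans eq (ℕₚ.+-comm j 1))))))))
      (solve 4 (λ x p t u → x :* (κ 0 :* p) := t :* u :* ((κ 1 :- x :* κ 1) :* (x :- x :* κ 1))) refl _ _ _ _)
    closed-right j (suc (suc d)) eq = begin
      X * (coefficient N (suc j) * (P d * factor (suc d) * factor (suc (suc d)) * P (suc (suc (N ℕ.+ j)))))
        ≈⟨ solve 6 (λ x c p f g q → x :* (c :* (p :* f :* g :* q)) := c :* (p :* q) :* (g :* (x :* f))) refl _ _ _ _ _ _ ⟩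
      coefficient N (suc j) * (P d * P (suc (suc (N ℕ.+ j)))) * (factor (suc (suc d)) * (X * factor (suc d)))
        ≈⟨ *-congʳ (trans (*-congˡ (*-congˡ (P-≡ (cong suc (≡.sym (ℕₚ.+-suc N j))))))
             (closed (suc j) d (ℕₚ.suc-injective (≡.trans eq (move j d))))) ⟩
      X ^ triangle (suc j) * P (suc (N ℕ.+ N)) * (factor (suc (suc d)) * (X * factor (suc d)))
        ≈⟨ *-congˡ (*-congˡ (solve 2 (λ x z → x :* (κ 1 :- z) := x :- x :* z) refl X (X ^ suc d))) ⟩
      X ^ triangle (suc j) * P (suc (N ℕ.+ N)) * (factor (suc (suc d)) * (X - X ^ suc (suc d))) ∎
      where
      move : ∀ j d → j ℕ.+ suc (suc d) ≡ suc (suc j ℕ.+ d)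
      move = solve-∀

    closed-left : ∀ j d → N ≡ j ℕ.+ d → coefficient N j * (P d * P (suc (suc (suc (N ℕ.+ j))))) ≈
      X ^ triangle j * P (suc (N ℕ.+ N)) * ((# 1 - X ^ suc (suc (N ℕ.+ j))) * (# 1 - X ^ suc (suc (suc (N ℕ.+ j)))))
    closed-left j d eq = trans
      (solve 5 (λ c p q f g → c :* (p :* (q :* f :* g)) := c :* (p :* q) :* (f :* g)) refl _ _ _ _ _)
      (*-congʳ (closed j d eq))

  cancel-X : ∀ {f g} → X * f ≈ X * g → f ≈ g
  cancel-X {f} {g} = X-cancel f g

  -- Over the common denominator the recursion becomes a polynomial identity in q and the powers of
  -- q involved. The extra X, forced by `closed-right`, is cancelled at the end; j = 0 is separate
  -- because its left neighbour is reflected.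
  closedForm : ∀ N j d → N ≡ j ℕ.+ d → ClosedForm N j d
  closedForm zero    zero    zero    _  = *-congˡ (*-identityˡ (P 1))
  closedForm (suc N) zero    d       ≡.refl = cancel-X (begin
    X * (((# 1 + n * n) * coefficient N 0 + n * (coefficient N 0 + coefficient N 1)) * K)
      ≈⟨ solve 5 (λ x n c c′ k → x :* (((κ 1 :+ n :* n) :* c :+ n :* (c :+ c′)) :* k) :=
           (κ 1 :+ n :* n :+ n) :* (x :* (c :* k)) :+ n :* (x :* (c′ :* k))) refl X n (coefficient N 0) (coefficient N 1) K ⟩
    (# 1 + n * n + n) * (X * (coefficient N 0 * K)) + n * (X * (coefficient N 1 * K))
      ≈⟨ +-cong (*-congˡ (*-congˡ (closed-centre N (closedForm N) 0 (suc N) ≡.refl)))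
                (*-congˡ (closed-right N (closedForm N) 0 (suc N) ≡.refl)) ⟩
    (# 1 + n * n + n) * (X * (# 1 * p * ((# 1 - n) * (# 1 - X ^ suc (suc (N ℕ.+ 0))))))
      + n * (X * # 1 * p * ((# 1 - n) * (X - n)))
      ≈⟨ +-congʳ (*-congˡ (*-congˡ (*-congˡ (*-congˡ (+-congˡ (-‿cong (*-congˡ (X^-≡ (cong suc (ℕₚ.+-identityʳ N)))))))))) ⟩
    (# 1 + n * n + n) * (X * (# 1 * p * ((# 1 - n) * (# 1 - X * n)))) + n * (X * # 1 * p * ((# 1 - n) * (X - n)))
      ≈⟨ solve 3 (λ x n p → (κ 1 :+ n :* n :+ n) :* (x :* (κ 1 :* p :* ((κ 1 :- n) :* (κ 1 :- x :* n))))
             :+ n :* (x :* κ 1 :* p :* ((κ 1 :- n) :* (x :- n))) :=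
           x :* (κ 1 :* (p :* (κ 1 :- n :* n) :* (κ 1 :- x :* (n :* n))))) refl X n p ⟩
    X * (# 1 * (p * (# 1 - n * n) * (# 1 - X * (n * n))))
      ≈⟨ *-congˡ (*-congˡ (*-cong (*-cong (sym P₁) (+-congˡ (-‿cong (sym n²)))) (+-congˡ (-‿cong (sym Xn²))))) ⟩
    X * (# 1 * P (suc (suc N ℕ.+ suc N))) ∎)
    where
    n = X ^ suc N
    K = P (suc N) * P (suc (suc (N ℕ.+ 0)))
    p = P (suc (N ℕ.+ N))
    P₁ : P (N ℕ.+ suc N) ≈ p
    P₁ = P-≡ (ℕₚ.+-suc N N)
    n² : X ^ suc (N ℕ.+ suc N) ≈ n * n
    n² = X^-+ (suc N) (suc N)
    Xn² : X ^ suc (suc (N ℕ.+ suc N)) ≈ X * (n * n)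
    Xn² = *-congˡ n²
  closedForm (suc N) (suc j) d eq = cancel-X (begin
    X * (((# 1 + n * n) * c₁ + n * (c₀ + c₂)) * K)
      ≈⟨ solve 6 (λ x n c₀ c₁ c₂ k → x :* (((κ 1 :+ n :* n) :* c₁ :+ n :* (c₀ :+ c₂)) :* k) :=
           (κ 1 :+ n :* n) :* (x :* (c₁ :* k)) :+ n :* (x :* (c₀ :* k) :+ x :* (c₂ :* k))) refl X n c₀ c₁ c₂ K ⟩
    (# 1 + n * n) * (X * (c₁ * K)) + n * (X * (c₀ * K) + X * (c₂ * K))
      ≈⟨ +-cong (*-congˡ (*-congˡ centre)) (*-congˡ (+-cong (*-congˡ left) right)) ⟩
    (# 1 + n * n) * (X * (t * a * p * ((# 1 - b) * (# 1 - X * (n * a)))))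
      + n * (X * (t * p * ((# 1 - n * a) * (# 1 - X * (n * a)))) + t * a * (X * a) * p * ((# 1 - b) * (X - b)))
      ≈⟨ +-cong (*-cong (+-congˡ (*-cong n≈ab n≈ab)) (*-congˡ (*-congˡ (*-congˡ (+-congˡ (-‿cong (*-congˡ (*-congʳ n≈ab))))))))
           (*-cong n≈ab (+-congʳ (*-congˡ (*-congˡ (*-cong (+-congˡ (-‿cong (*-congʳ n≈ab)))
             (+-congˡ (-‿cong (*-congˡ (*-congʳ n≈ab))))))))) ⟩
    (# 1 + a * b * (a * b)) * (X * (t * a * p * ((# 1 - b) * (# 1 - X * (a * b * a)))))
      + a * b * (X * (t * p * ((# 1 - a * b * a) * (# 1 - X * (a * b * a)))) + t * a * (X * a) * p * ((# 1 - b) * (X - b)))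
      ≈⟨ solve 5 (λ x a b t p →
           (κ 1 :+ a :* b :* (a :* b)) :* (x :* (t :* a :* p :* ((κ 1 :- b) :* (κ 1 :- x :* (a :* b :* a)))))
             :+ a :* b :* (x :* (t :* p :* ((κ 1 :- a :* b :* a) :* (κ 1 :- x :* (a :* b :* a))))
                :+ t :* a :* (x :* a) :* p :* ((κ 1 :- b) :* (x :- b))) :=
           x :* (t :* a :* (p :* (κ 1 :- a :* b :* (a :* b)) :* (κ 1 :- x :* (a :* b :* (a :* b)))))) refl X a b t p ⟩
    X * (t * a * (p * (# 1 - a * b * (a * b)) * (# 1 - X * (a * b * (a * b)))))
      ≈⟨ *-congˡ (*-cong (sym T₁) (*-cong (*-cong (sym P₁) (+-congˡ (-‿cong (sym n²)))) (+-congˡ (-‿cong (*-congˡ (sym n²)))))) ⟩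
    X * (X ^ triangle (suc j) * P (suc (suc N ℕ.+ suc N))) ∎)
    where
    n = X ^ suc N
    a = X ^ suc j
    b = X ^ d
    t = X ^ triangle j
    p = P (suc (N ℕ.+ N))
    P₁ : P (N ℕ.+ suc N) ≈ p
    P₁ = P-≡ (ℕₚ.+-suc N N)
    c₀ = coefficient N j
    c₁ = coefficient N (suc j)
    c₂ = coefficient N (suc (suc j))
    K = P d * P (suc (suc (N ℕ.+ suc j)))
    n≈ab : n ≈ a * b
    n≈ab = X^-split (suc j) d eq
    n² : X ^ suc (N ℕ.+ suc N) ≈ a * b * (a * b)
    n² = trans (X^-+ (suc N) (suc N)) (*-cong n≈ab n≈ab)
    T₁ : X ^ triangle (suc j) ≈ t * a
    T₁ = X^-+ (triangle j) (suc j)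
    na : X ^ suc (N ℕ.+ suc j) ≈ n * a
    na = X^-+ (suc N) (suc j)
    centre : c₁ * K ≈ t * a * p * ((# 1 - b) * (# 1 - X * (n * a)))
    centre = trans (closed-centre N (closedForm N) (suc j) d eq)
      (*-cong (*-congʳ T₁) (*-congˡ (+-congˡ (-‿cong (*-congˡ na)))))
    right : X * (c₂ * K) ≈ t * a * (X * a) * p * ((# 1 - b) * (X - b))
    right = trans (closed-right N (closedForm N) (suc j) d eq)
      (*-congʳ (*-congʳ (trans (X^-+ (triangle (suc j)) (suc (suc j))) (*-congʳ T₁))))
    left : c₀ * K ≈ t * p * ((# 1 - n * a) * (# 1 - X * (n * a)))
    left = trans (*-congˡ (*-congˡ (P-≡ (cong (λ k → suc (suc k)) (ℕₚ.+-suc N j)))))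
      (trans (closed-left N (closedForm N) j d (ℕₚ.suc-injective eq))
        (*-congˡ (*-cong (+-congˡ (-‿cong (trans (X^-≡ (cong suc (≡.sym (ℕₚ.+-suc N j)))) na)))
                         (+-congˡ (-‿cong (*-congˡ (trans (X^-≡ (cong suc (≡.sym (ℕₚ.+-suc N j)))) na)))))))

  pairing : ℕ → (ℕ → Series) → ℕ → Series
  pairing N f k = ∑ k (λ j → sgn j * f j * coefficient N j)

  -- g is the second difference of f, with f extended by f (-1) = - f 0.
  record SecondDifference (f g : ℕ → Series) : Set where
    field
      boundary : f 1 ≈ g 0 + # 3 * f 0
      interior : ∀ j → f (suc (suc j)) ≈ g (suc j) + # 2 * f (suc j) - f j

  -- With x = q^{N+1} the recursion for `coefficient` is moved onto f: the alternating signs give (1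
  -- + x²) f j - x (f (j - 1) + f (j + 1)), which is (1 - x)² f j - x g j. The last line is the
  -- boundary term at the cut k.
  summation-by-parts : ∀ N {f g} → SecondDifference f g → ∀ k → pairing (suc N) f (suc k) ≈
    (# 1 - X ^ suc N) ^ 2 * pairing N f (suc k) - X ^ suc N * pairing N g (suc k)
      + X ^ suc N * (sgn k * (f (suc k) * coefficient N k + f k * coefficient N (suc k)))
  summation-by-parts N {f} {g} Δ zero = trans
    (solve 5 (λ n f₀ g₀ c₀ c₁ → κ 0 :+ κ 1 :* f₀ :* ((κ 1 :+ n :* n) :* c₀ :+ n :* (c₀ :+ c₁)) :=
      (κ 1 :- n) :^ 2 :* (κ 0 :+ κ 1 :* f₀ :* c₀) :- n :* (κ 0 :+ κ 1 :* g₀ :* c₀)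
        :+ n :* (κ 1 :* ((g₀ :+ κ 3 :* f₀) :* c₀ :+ f₀ :* c₁))) refl
      (X ^ suc N) (f 0) (g 0) (coefficient N 0) (coefficient N 1))
    (+-congˡ (*-congˡ (*-congˡ (+-congʳ (*-congʳ (sym (SecondDifference.boundary Δ)))))))
  summation-by-parts N {f} {g} Δ (suc k) = begin
    pairing (suc N) f (suc k) + - # 1 * σ * f₁ * ((# 1 + n * n) * c₁ + n * (c₀ + c₂))
      ≈⟨ +-congʳ (summation-by-parts N Δ k) ⟩
    (# 1 - n) ^ 2 * F - n * G + n * (σ * (f₁ * c₀ + f₀ * c₁))
      + - # 1 * σ * f₁ * ((# 1 + n * n) * c₁ + n * (c₀ + c₂))
      ≈⟨ solve 10 (λ n σ F G f₀ f₁ g₁ c₀ c₁ c₂ →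
           (κ 1 :- n) :^ 2 :* F :- n :* G :+ n :* (σ :* (f₁ :* c₀ :+ f₀ :* c₁))
             :+ :- κ 1 :* σ :* f₁ :* ((κ 1 :+ n :* n) :* c₁ :+ n :* (c₀ :+ c₂)) :=
           (κ 1 :- n) :^ 2 :* (F :+ :- κ 1 :* σ :* f₁ :* c₁) :- n :* (G :+ :- κ 1 :* σ :* g₁ :* c₁)
             :+ n :* (:- κ 1 :* σ :* ((g₁ :+ κ 2 :* f₁ :- f₀) :* c₁ :+ f₁ :* c₂))) refl n σ F G f₀ f₁ (g (suc k)) c₀ c₁ c₂ ⟩
    (# 1 - n) ^ 2 * pairing N f (suc (suc k)) - n * pairing N g (suc (suc k))
      + n * (- # 1 * σ * ((g (suc k) + # 2 * f₁ - f₀) * c₁ + f₁ * c₂))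
      ≈⟨ +-congˡ (*-congˡ (*-congˡ (+-congʳ (*-congʳ (sym (SecondDifference.interior Δ k)))))) ⟩
    (# 1 - n) ^ 2 * pairing N f (suc (suc k)) - n * pairing N g (suc (suc k))
      + n * (- # 1 * σ * (f (suc (suc k)) * c₁ + f₁ * c₂)) ∎
    where
    n = X ^ suc N
    σ = sgn k
    F = pairing N f (suc k)
    G = pairing N g (suc k)
    f₀ = f k
    f₁ = f (suc k)
    c₀ = coefficient N k
    c₁ = coefficient N (suc k)
    c₂ = coefficient N (suc (suc k))

  Φ : ℕ → (ℕ → Series) → Series
  Φ N f = pairing N f (suc N)

  -- Coefficients with j > N vanish, so the boundary term and the surplus summands drop out.
  Φ-suc : ∀ N {f g} → SecondDifference f g →
          Φ (suc N) f ≈ (# 1 - X ^ suc N) ^ 2 * Φ N f - X ^ suc N * Φ N g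
  Φ-suc N {f} {g} Δ = trans (summation-by-parts N Δ (suc N)) (trans
    (+-cong (+-cong (*-congˡ (drop f)) (-‿cong (*-congˡ (drop g))))
      (*-congˡ (*-congˡ (+-cong (*-congˡ c₁≈0) (*-congˡ (coefficient≈0 N (suc (suc N)) (ℕₚ.n≤1+n _)))))))
    (solve 6 (λ n F G σ f f′ → (κ 1 :- n) :^ 2 :* F :- n :* G :+ n :* (σ :* (f :* κ 0 :+ f′ :* κ 0)) :=
      (κ 1 :- n) :^ 2 :* F :- n :* G) refl (X ^ suc N) (Φ N f) (Φ N g) (sgn (suc N)) (f (suc (suc N))) (f (suc N))))
    where
    c₁≈0 : coefficient N (suc N) ≈ # 0
    c₁≈0 = coefficient≈0 N (suc N) ℕₚ.≤-refl
    drop : ∀ h → pairing N h (suc (suc N)) ≈ Φ N h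
    drop h = trans (+-congˡ (*-congˡ c₁≈0))
      (solve 2 (λ s h → s :+ h :* κ 0 := s) refl (Φ N h) (sgn (suc N) * h (suc N)))

  coefficient-quotient : ∀ N j d → N ≡ j ℕ.+ d →
    coefficient N j ≈ X ^ triangle j * (P (suc (N ℕ.+ N)) * (I d * I (suc (N ℕ.+ j))))
  coefficient-quotient N j d eq = begin
    c                                              ≈⟨ solve 1 (λ c → c := c :* (κ 1 :* κ 1)) refl c ⟩
    c * (# 1 * # 1)                                ≈⟨ *-congˡ (*-cong (sym (P-I d)) (sym (P-I (suc (N ℕ.+ j))))) ⟩
    c * (P d * I d * (P (suc (N ℕ.+ j)) * I (suc (N ℕ.+ j))))
      ≈⟨ solve 5 (λ c p i q j → c :* (p :* i :* (q :* j)) := c :* (p :* q) :* (i :* j)) refl _ _ _ _ _ ⟩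
    c * (P d * P (suc (N ℕ.+ j))) * (I d * I (suc (N ℕ.+ j)))
      ≈⟨ *-congʳ (closedForm N j d eq) ⟩
    X ^ triangle j * P (suc (N ℕ.+ N)) * (I d * I (suc (N ℕ.+ j)))
      ≈⟨ *-assoc _ _ _ ⟩
    X ^ triangle j * (P (suc (N ℕ.+ N)) * (I d * I (suc (N ℕ.+ j)))) ∎
    where c = coefficient N j

  -- E times the q-binomial is 1 only to order N - j, but the factor q^{triangle j} restores the
  -- missing digits because j ≤ triangle j.
  E-coefficient : ∀ N j → j ℕ.≤ N → E * coefficient N j ≈[ N ] X ^ triangle j
  E-coefficient N j j≤N = ≈[]-trans
    (≈⇒≈[] N (trans (*-congˡ (coefficient-quotient N j d (≡.sym (ℕₚ.m+[n∸m]≡n j≤N))))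
      (solve 5 (λ e x p i i′ → e :* (x :* (p :* (i :* i′))) := x :* (e :* p :* (i :* i′))) refl _ _ _ _ _)))
    (≈[]-trans (≈[]-weaken N≤ (X^⊗-cong[] (triangle j) unit)) (≈⇒≈[] N (*-identityʳ (X ^ triangle j))))
    where
    d = N ℕ.∸ j
    N≤ : N ℕ.≤ triangle j ℕ.+ d
    N≤ = ℕₚ.≤-trans (ℕₚ.≤-reflexive (≡.sym (ℕₚ.m+[n∸m]≡n j≤N))) (ℕₚ.+-monoˡ-≤ d (n≤triangle j))
    d≤N = ℕₚ.m∸n≤m N j
    unit : E * P (suc (N ℕ.+ N)) * (I d * I (suc (N ℕ.+ j))) ≈[ d ] # 1
    unit = ≈[]-trans
      (⊗-cong[] (⊗-cong[] (≈[]-refl {E}) (≈[]-sym (≈[]-weaken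
          (ℕₚ.≤-trans d≤N (ℕₚ.≤-trans (ℕₚ.m≤m+n N N) (ℕₚ.n≤1+n _))) (E≈P (suc (N ℕ.+ N))))))
        (⊗-cong[] (≈[]-sym (invPoch≈I d)) (≈[]-sym (≈[]-weaken
          (ℕₚ.≤-trans d≤N (ℕₚ.≤-trans (ℕₚ.m≤m+n N j) (ℕₚ.n≤1+n _))) (invPoch≈I (suc (N ℕ.+ j)))))))
      (≈⇒≈[] d (trans (solve 2 (λ e i → e :* e :* (i :* i) := e :* i :* (e :* i)) refl E invPoch)
        (trans (*-cong E-invPoch E-invPoch) (*-identityʳ (# 1)))))

  thetaSum : (ℕ → Series) → ℕ → Series
  thetaSum f N = ∑ (suc N) (λ j → sgn j * f j * X ^ triangle j)

  E-Φ : ∀ f N → E * Φ N f ≈[ N ] thetaSum f N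
  E-Φ f N = ≈[]-trans (≈⇒≈[] N (sym (∑-*ˡ E _ (suc N)))) (∑-cong[] (suc N) term)
    where
    term : ∀ j → j ℕ.< suc N → E * (sgn j * f j * coefficient N j) ≈[ N ] sgn j * f j * X ^ triangle j
    term j (s≤s j≤N) = ≈[]-trans
      (≈⇒≈[] N (solve 4 (λ e σ f c → e :* (σ :* f :* c) := σ :* f :* (e :* c)) refl E (sgn j) (f j) (coefficient N j)))
      (⊗-cong[] (≈[]-refl {sgn j * f j}) (E-coefficient N j j≤N))

-- Jacobi's series for E³ and its θ-derivatives.

module CubeOfE where
  open PowerSeries
  open SeriesAlgebra
  open TriangularNumbers
  open Operators
  open EulerProduct
  open FiniteJacobi
  open ResidueClasses
  open import Data.Integer using (+_)
  import Data.Integer.Properties as ℤₚ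
  open import Data.Nat as ℕ using (ℕ; zero; suc)
  open import Data.Nat.DivMod using (_%_)
  open import Data.Nat.Tactic.RingSolver using (solve-∀)
  open import Relation.Binary.PropositionalEquality as ≡ using (_≡_; _≢_; cong)
  open import Relation.Binary.Reasoning.Setoid setoid

  #-+ : ∀ m n → # (m ℕ.+ n) ≈ # m + # n
  #-+ m n = ⟨⟩-+ (+ m) (+ n)

  #-* : ∀ m n → # (m ℕ.* n) ≈ # m * # n
  #-* m n = trans (reflexive (cong ⟨_⟩ (ℤₚ.pos-* m n))) (⟨⟩-* (+ m) (+ n))

  #-cong : ∀ {m n} → m ≡ n → # m ≈ # n
  #-cong ≡.refl = refl

  difference-ℕ : ∀ {f g : ℕ → ℕ} → f 1 ≡ g 0 ℕ.+ 3 ℕ.* f 0 →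
    (∀ j → f (suc (suc j)) ℕ.+ f j ≡ g (suc j) ℕ.+ 2 ℕ.* f (suc j)) →
    SecondDifference (λ j → # f j) (λ j → # g j)
  difference-ℕ {f} {g} boundary interior = record
    { boundary = trans (#-cong boundary) (trans (#-+ (g 0) _) (+-congˡ (#-* 3 (f 0))))
    ; interior = λ j → begin
        # f (suc (suc j))
          ≈⟨ solve 2 (λ a b → a := a :+ b :- b) refl _ (# f j) ⟩
        # f (suc (suc j)) + # f j - # f j
          ≈⟨ +-congʳ (trans (sym (#-+ (f (suc (suc j))) (f j))) (trans (#-cong (interior j))
               (trans (#-+ (g (suc j)) _) (+-congˡ (#-* 2 (f (suc j))))))) ⟩
        # g (suc j) + # 2 * # f (suc j) - # f j ∎
    }

  s₀-difference : SecondDifference (λ j → # s₀ j) (λ _ → # 0)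
  s₀-difference = difference-ℕ {s₀} {λ _ → 0} ≡.refl interior
    where
    interior : ∀ j → suc (2 ℕ.* suc (suc j)) ℕ.+ suc (2 ℕ.* j) ≡ 0 ℕ.+ 2 ℕ.* suc (2 ℕ.* suc j)
    interior = solve-∀

  s₁-difference : SecondDifference (λ j → # s₁ j) (λ j → # s₀ j)
  s₁-difference = difference-ℕ {s₁} {s₀} ≡.refl λ j → interior (s₁ j) j
    where
    interior : ∀ s j → s ℕ.+ suc j ℕ.* suc j ℕ.+ suc (suc j) ℕ.* suc (suc j) ℕ.+ s ≡
               suc (2 ℕ.* suc j) ℕ.+ 2 ℕ.* (s ℕ.+ suc j ℕ.* suc j)
    interior = solve-∀

  s₂-difference : SecondDifference (λ j → # s₂ j) (λ j → # s₁ j)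
  s₂-difference = difference-ℕ {s₂} {s₁} ≡.refl λ j → interior (s₂ j) (s₂′ j) (s₁ (suc j))
    where
    interior : ∀ s r t → s ℕ.+ r ℕ.+ (r ℕ.+ t) ℕ.+ s ≡ t ℕ.+ 2 ℕ.* (s ℕ.+ r)
    interior = solve-∀

  -- (1 - z q^n)(1 - q^n / z) = (1 - q^n)² (1 - w `x n`) for w = z + 1/z - 2. The coefficients of
  -- w⁰, w¹, w² in the finite product are thus P², -P² e₁ and P² e₂, with e₁ and e₂ elementary
  -- symmetric in the `x n`.
  x : ℕ → Series
  x n = X ^ n * (geom n * geom n)

  factor²-x : ∀ n → (# 1 - X ^ suc n) ^ 2 * x (suc n) ≈ X ^ suc n
  factor²-x n = trans
    (solve 3 (λ f q g → f :^ 2 :* (q :* (g :* g)) := q :* (f :* g) :* (f :* g)) refl (factor (suc n)) (X ^ suc n) (geom (suc n)))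
    (trans (*-cong (*-congˡ (geom-inverse (suc n))) (geom-inverse (suc n)))
      (solve 1 (λ q → q :* κ 1 :* κ 1 := q) refl (X ^ suc n)))

  x-sum x²-sum : ℕ → Series
  x-sum  N = ∑ N (λ i → x (suc i))
  x²-sum N = ∑ N (λ i → x (suc i) * x (suc i))

  x-sum-stable : ∀ n → x-sum (suc n) ≈[ n ] x-sum n
  x-sum-stable n = stable-by (geom (suc n) * geom (suc n)) refl

  x²-sum-stable : ∀ n → x²-sum (suc n) ≈[ n ] x²-sum n
  x²-sum-stable n = stable-by (geom (suc n) * geom (suc n) * x (suc n)) (+-congˡ (*-assoc _ _ _))

  -- The second difference of `s₀` is zero, so each step only multiplies by (1 - q^{N+1})²; after
  -- multiplication by E this is Jacobi's identity in the limit.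
  Φ-s₀ : ∀ N → Φ N (λ j → # s₀ j) ≈ P N * P N
  Φ-s₀ zero    = solve 0 (κ 0 :+ κ 1 :* κ 1 :* κ 1 := κ 1 :* κ 1) refl
  Φ-s₀ (suc N) = trans (Φ-suc N s₀-difference) (trans
    (+-cong (*-congˡ (Φ-s₀ N)) (-‿cong (*-congˡ (pairing-zero (suc N)))))
    (solve 2 (λ n p → (κ 1 :- n) :^ 2 :* (p :* p) :- n :* κ 0 := p :* (κ 1 :- n) :* (p :* (κ 1 :- n))) refl (X ^ suc N) (P N)))
    where
    pairing-zero : ∀ k → pairing N (λ _ → # 0) k ≈ # 0
    pairing-zero zero    = refl
    pairing-zero (suc k) = trans (+-congʳ (pairing-zero k))
      (solve 2 (λ σ c → κ 0 :+ σ :* κ 0 :* c := κ 0) refl (sgn k) (coefficient N k))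

  Φ-s₁ : ∀ N → Φ N (λ j → # s₁ j) ≈ - (P N * P N * x-sum N)
  Φ-s₁ zero    = solve 0 (κ 0 :+ κ 1 :* κ 0 :* κ 1 := :- (κ 1 :* κ 1 :* κ 0)) refl
  Φ-s₁ (suc N) = begin
    Φ (suc N) (λ j → # s₁ j)
      ≈⟨ trans (Φ-suc N s₁-difference) (+-cong (*-congˡ (Φ-s₁ N)) (-‿cong (*-cong (sym (factor²-x N)) (Φ-s₀ N)))) ⟩
    f ^ 2 * (- (p * p * S)) - f ^ 2 * u * (p * p)
      ≈⟨ solve 4 (λ f p S u → f :^ 2 :* (:- (p :* p :* S)) :- f :^ 2 :* u :* (p :* p) :=
           :- (p :* f :* (p :* f) :* (S :+ u))) refl f p S u ⟩
    - (p * f * (p * f) * (S + u)) ∎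
    where
    f = factor (suc N)
    p = P N
    S = x-sum N
    u = x (suc N)

  -- Newton's identity 2 e₂ = p₁² - p₂ for the `x n`; the factor 2 keeps everything integral.
  Φ-s₂ : ∀ N → # 2 * Φ N (λ j → # s₂ j) ≈ P N * P N * (x-sum N * x-sum N - x²-sum N)
  Φ-s₂ zero    = solve 0 (κ 2 :* (κ 0 :+ κ 1 :* κ 0 :* κ 1) := κ 1 :* κ 1 :* (κ 0 :* κ 0 :- κ 0)) refl
  Φ-s₂ (suc N) = begin
    # 2 * Φ (suc N) (λ j → # s₂ j)
      ≈⟨ *-congˡ (Φ-suc N s₂-difference) ⟩
    # 2 * (f ^ 2 * Φ N (λ j → # s₂ j) - X ^ suc N * Φ N (λ j → # s₁ j))
      ≈⟨ solve 4 (λ f a n b → κ 2 :* (f :^ 2 :* a :- n :* b) := f :^ 2 :* (κ 2 :* a) :- κ 2 :* n :* b) refl f _ _ _ ⟩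
    f ^ 2 * (# 2 * Φ N (λ j → # s₂ j)) - # 2 * X ^ suc N * Φ N (λ j → # s₁ j)
      ≈⟨ +-cong (*-congˡ (Φ-s₂ N)) (-‿cong (*-cong (*-congˡ (sym (factor²-x N))) (Φ-s₁ N))) ⟩
    f ^ 2 * (p * p * (S * S - T)) - # 2 * (f ^ 2 * u) * (- (p * p * S))
      ≈⟨ solve 5 (λ f p S T u → f :^ 2 :* (p :* p :* (S :* S :- T)) :- κ 2 :* (f :^ 2 :* u) :* (:- (p :* p :* S)) :=
           p :* f :* (p :* f) :* ((S :+ u) :* (S :+ u) :- (T :+ u :* u))) refl f p S T u ⟩
    p * f * (p * f) * ((S + u) * (S + u) - (T + u * u)) ∎
    where
    f = factor (suc N)
    p = P N
    S = x-sum N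
    T = x²-sum N
    u = x (suc N)

  -- `X₁` sums q^n / (1 - q^n)² and so generates σ(n); `X₂` sums q^{2n} / (1 - q^n)⁴.
  X₁ X₂ : Series
  X₁ = limit x-sum
  X₂ = limit x²-sum

  E³ : Series
  E³ = E * (E * E)

  E³≈thetaSum : ∀ N → E³ ≈[ N ] thetaSum (λ j → # s₀ j) N
  E³≈thetaSum N = ≈[]-trans (⊗-cong[] (≈[]-refl {E}) (≈[]-trans (⊗-cong[] (E≈P N) (E≈P N)) (≈⇒≈[] N (sym (Φ-s₀ N)))))
    (E-Φ _ N)

  E³X₁≈thetaSum : ∀ N → - (E³ * X₁) ≈[ N ] thetaSum (λ j → # s₁ j) N
  E³X₁≈thetaSum N = ≈[]-trans (≈⇒≈[] N (solve 2 (λ e a → :- (e :* (e :* e) :* a) := e :* (:- (e :* e :* a))) refl E X₁))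
    (≈[]-trans (⊗-cong[] (≈[]-refl {E}) (≈[]-trans
      (-‿cong[] (⊗-cong[] (⊗-cong[] (E≈P N) (E≈P N)) (limit≈ x-sum-stable N))) (≈⇒≈[] N (sym (Φ-s₁ N)))))
    (E-Φ _ N))

  E³X₂≈thetaSum : ∀ N → E³ * (X₁ * X₁ - X₂) ≈[ N ] # 2 * thetaSum (λ j → # s₂ j) N
  E³X₂≈thetaSum N = ≈[]-trans (≈⇒≈[] N (*-assoc E (E * E) _))
    (≈[]-trans (⊗-cong[] (≈[]-refl {E}) (≈[]-trans
      (⊗-cong[] (⊗-cong[] (E≈P N) (E≈P N)) (⊕-cong[] (⊗-cong[] X₁≈ X₁≈) (-‿cong[] (limit≈ x²-sum-stable N))))
      (≈⇒≈[] N (sym (Φ-s₂ N)))))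
    (≈[]-trans (≈⇒≈[] N (solve 2 (λ e a → e :* (κ 2 :* a) := κ 2 :* (e :* a)) refl E (Φ N (λ j → # s₂ j))))
      (⊗-cong[] (≈[]-refl {# 2}) (E-Φ _ N))))
    where X₁≈ = limit≈ x-sum-stable N

  θ-X^ : ∀ e → θ (X ^ e) ≈ # e * X ^ e
  θ-X^ zero    = trans (θ-⟨⟩ (+ 1)) (solve 0 (κ 0 := κ 0 :* κ 1) refl)
  θ-X^ (suc e) = begin
    θ (X * X ^ e)                     ≈⟨ θ-⊗ X (X ^ e) ⟩
    θ X * X ^ e + X * θ (X ^ e)       ≈⟨ +-cong (*-congʳ θ-X) (*-congˡ (θ-X^ e)) ⟩
    X * X ^ e + X * (# e * X ^ e)     ≈⟨ solve 3 (λ x y e → x :* y :+ x :* (e :* y) := (κ 1 :+ e) :* (x :* y)) refl X (X ^ e) (# e) ⟩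
    (# 1 + # e) * X ^ suc e           ≈⟨ *-congʳ (#-+ 1 e) ⟨
    # suc e * X ^ suc e               ∎

  θ-scalar : ∀ {c} f → θ c ≈ # 0 → θ (c * f) ≈ c * θ f
  θ-scalar {c} f θc≈0 = trans (θ-⊗ c f) (trans (+-congʳ (*-congʳ θc≈0))
    (solve 2 (λ f r → κ 0 :* f :+ r := r) refl f (c * θ f)))

  θ-sgn : ∀ n → θ (sgn n) ≈ # 0
  θ-sgn zero    = θ-⟨⟩ (+ 1)
  θ-sgn (suc n) = trans (θ-scalar (sgn n) (trans (θ-⊝ (# 1)) (trans (-‿cong (θ-⟨⟩ (+ 1))) (solve 0 (:- κ 0 := κ 0) refl))))
    (trans (*-congˡ (θ-sgn n)) (solve 0 (:- κ 1 :* κ 0 := κ 0) refl))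

  θ-∑ : ∀ (F : ℕ → Series) n → θ (∑ n F) ≈ ∑ n (λ i → θ (F i))
  θ-∑ F zero    = θ-⟨⟩ (+ 0)
  θ-∑ F (suc n) = trans (θ-⊕ (∑ n F) (F n)) (+-congʳ (θ-∑ F n))

  θ-thetaSum : ∀ (f : ℕ → ℕ) N → θ (thetaSum (λ j → # f j) N) ≈ thetaSum (λ j → # (triangle j ℕ.* f j)) N
  θ-thetaSum f N = trans (θ-∑ _ (suc N)) (∑-cong (suc N) λ j → begin
    θ (sgn j * # f j * X ^ triangle j)
      ≈⟨ θ-scalar (X ^ triangle j) (trans (θ-scalar (# f j) (θ-sgn j)) (trans (*-congˡ (θ-⟨⟩ (+ f j))) (solve 1 (λ σ → σ :* κ 0 := κ 0) refl (sgn j)))) ⟩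
    sgn j * # f j * θ (X ^ triangle j)
      ≈⟨ *-congˡ (θ-X^ (triangle j)) ⟩
    sgn j * # f j * (# triangle j * X ^ triangle j)
      ≈⟨ solve 4 (λ σ f t x → σ :* f :* (t :* x) := σ :* (t :* f) :* x) refl _ _ _ _ ⟩
    sgn j * (# triangle j * # f j) * X ^ triangle j
      ≈⟨ *-congʳ (*-congˡ (#-* (triangle j) (f j))) ⟨
    sgn j * # (triangle j ℕ.* f j) * X ^ triangle j ∎)

  thetaSum-scale : ∀ c (f : ℕ → ℕ) N → # c * thetaSum (λ j → # f j) N ≈ thetaSum (λ j → # (c ℕ.* f j)) N
  thetaSum-scale c f N = trans (sym (∑-*ˡ (# c) _ (suc N))) (∑-cong (suc N) λ j → trans
    (solve 4 (λ c σ f x → c :* (σ :* f :* x) := σ :* (c :* f) :* x) refl (# c) (sgn j) (# f j) (X ^ triangle j))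
    (*-congʳ (*-congˡ (sym (#-* c (f j))))))

  thetaSum-+ : ∀ (f g : ℕ → ℕ) N → thetaSum (λ j → # f j) N + thetaSum (λ j → # g j) N ≈ thetaSum (λ j → # (f j ℕ.+ g j)) N
  thetaSum-+ f g N = sum (suc N)
    where
    sum : ∀ n → ∑ n (λ j → sgn j * # f j * X ^ triangle j) + ∑ n (λ j → sgn j * # g j * X ^ triangle j) ≈
          ∑ n (λ j → sgn j * # (f j ℕ.+ g j) * X ^ triangle j)
    sum zero    = +-identityʳ (# 0)
    sum (suc n) = trans
      (solve 6 (λ S T σ f g x → S :+ σ :* f :* x :+ (T :+ σ :* g :* x) := S :+ T :+ σ :* (f :+ g) :* x) refl _ _ (sgn n) (# f n) (# g n) (X ^ triangle n))
      (+-cong (sum n) (*-congʳ (*-congˡ (sym (#-+ (f n) (g n))))))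

  thetaSum-cong : ∀ {f g : ℕ → ℕ} N → (∀ j → f j ≡ g j) → thetaSum (λ j → # f j) N ≈ thetaSum (λ j → # g j) N
  thetaSum-cong N eq = ∑-cong (suc N) λ j → *-congʳ (*-congˡ (#-cong (eq j)))

  -- The w-coefficient of the triple product is -E³ X₁, and `s₁-closed` reads three times its theta
  -- series as θ E³.
  θE³ : # 3 * - (E³ * X₁) ≈ θ E³
  θE³ = ≈[]⇒≈ λ N → ≈[]-trans (⊗-cong[] (≈[]-refl {# 3}) (E³X₁≈thetaSum N)) (≈[]-trans
    (≈⇒≈[] N (trans (thetaSum-scale 3 s₁ N) (trans (thetaSum-cong N s₁-closed) (sym (θ-thetaSum s₀ N)))))
    (θ-cong[] (≈[]-sym (E³≈thetaSum N))))

  θ²E³ : # 15 * (E³ * (X₁ * X₁ - X₂)) + θ E³ ≈ θ (θ E³)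
  θ²E³ = ≈[]⇒≈ λ N → ≈[]-trans (⊕-cong[] (⊗-cong[] (≈[]-refl {# 15}) (E³X₂≈thetaSum N)) (θ-cong[] (E³≈thetaSum N)))
    (≈[]-trans (≈⇒≈[] N (begin
      # 15 * (# 2 * thetaSum (λ j → # s₂ j) N) + θ (thetaSum (λ j → # s₀ j) N)
        -- The factors 15 and 2 combine to the 30 of `s₂-closed`.
        ≈⟨ +-cong (trans (solve 1 (λ s → κ 15 :* (κ 2 :* s) := κ 30 :* s) refl _) (thetaSum-scale 30 s₂ N)) (θ-thetaSum s₀ N) ⟩
      thetaSum (λ j → # (30 ℕ.* s₂ j)) N + thetaSum (λ j → # (triangle j ℕ.* s₀ j)) N
        ≈⟨ trans (thetaSum-+ _ _ N) (thetaSum-cong N s₂-closed) ⟩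
      thetaSum (λ j → # (triangle j ℕ.* (triangle j ℕ.* s₀ j))) N
        ≈⟨ trans (θ-cong (θ-thetaSum s₀ N)) (θ-thetaSum _ N) ⟨
      θ (θ (thetaSum (λ j → # s₀ j) N)) ∎))
    (θ-cong[] (θ-cong[] (≈[]-sym (E³≈thetaSum N)))))

  -- Triangular numbers are 0, 1 or 3 modulo 5.
  part-2-E³ : part 2 E³ ≈ # 0
  part-2-E³ = ≈[]⇒≈ λ N → ≈[]-trans (part-cong[] 2 (E³≈thetaSum N)) (≈⇒≈[] N (sum (suc N)))
    where
    2∤ : ∀ i m → triangle i % 5 ≢ 2 → part 2 (sgn (i ℕ.+ m ℕ.* 5) * # s₀ (i ℕ.+ m ℕ.* 5) * X ^ triangle (i ℕ.+ m ℕ.* 5)) ≈ # 0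
    2∤ i m t≢2 = part-other 2 t≢2 (supported-* (supported-* (supported-sgn (i ℕ.+ m ℕ.* 5)) (supported-⟨⟩ (+ s₀ (i ℕ.+ m ℕ.* 5))))
      (supported-X^ (triangle i) (i ℕ.* m ℕ.+ fifthTriangle m) (triangle-shift i m)))
    sum : ∀ n → part 2 (∑ n (λ j → sgn j * # s₀ j * X ^ triangle j)) ≈ # 0
    sum zero    = part-other 2 (λ ()) (supported-⟨⟩ (+ 0))
    sum (suc n) = trans (part-+ 2 _ _) (trans (+-cong (sum n) (mod5-cases
      (λ j → part 2 (sgn j * # s₀ j * X ^ triangle j) ≈ # 0)
      (λ m → 2∤ 0 m (λ ())) (λ m → 2∤ 1 m (λ ())) (λ m → 2∤ 2 m (λ ())) (λ m → 2∤ 3 m (λ ())) (λ m → 2∤ 4 m (λ ())) n))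
      (+-identityʳ (# 0)))

-- The relation A B = -y², Lambert series and Ramanujan's formula for E₄.

module DivisorSums where
  open PowerSeries
  open SeriesAlgebra
  open Operators
  open EulerProduct
  open ResidueClasses
  open CubeOfE
  open import Data.Bool using (true; false; if_then_else_)
  open import Data.Empty using (⊥-elim)
  open import Data.Integer as ℤ using (ℤ; +_)
  import Data.Integer.Properties as ℤₚ
  open import Data.Nat as ℕ using (ℕ; zero; suc; z≤n; s≤s)
  open import Data.Nat.Divisibility using (_∣_; _∣?_; divides; n∣m*n; >⇒∤; ∣m+n∣m⇒∣n)
  open import Data.Nat.Primality using (prime?; euclidsLemma)
  import Data.Nat.Properties as ℕₚ
  open import Data.Nat.Tactic.RingSolver using (solve-∀)
  open import Data.Sum using (inj₁; inj₂)
  open import Relation.Binary.PropositionalEquality as ≡ using (_≡_; _≢_; cong; cong₂)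
  open import Relation.Binary.Reasoning.Setoid setoid
  open import Relation.Nullary using (¬_; yes; no)
  open import Relation.Nullary.Decidable using (does; toWitness)

  nonzero : ∀ {a n} → a ≡ + suc n → a ≢ + 0
  nonzero ≡.refl ()

  -- Expanding the cube of A + B - y, the exponents congruent to 2 modulo 5 form 3 A (A B + y²).
  -- This part is zero, and 3 A has constant term 3.
  AB≈-y² : A * B ≈ - (y * y)
  AB≈-y² = begin
    A * B                    ≈⟨ solve 2 (λ a y → a := a :+ y :- y) refl (A * B) (y * y) ⟩
    A * B + y * y - y * y    ≈⟨ +-congʳ (≈0-cancel 3A≢0 (trans (sym part-2) part-2-E³)) ⟩
    # 0 - y * y              ≈⟨ +-identityˡ _ ⟩
    - (y * y)                ∎
    where
    3A≢0 : (# 3 * A) 0 ≢ + 0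
    3A≢0 = nonzero (≡.trans (⟨⟩⊗-at (+ 3) A 0) (cong (+ 3 ℤ.*_) (≡.trans (part-zero E) E-zero)))
    cube : E³ ≈ # 3 * A * (A * B + y * y) + (A * A * A + - (# 3 * (B * B * y)))
      + (B * B * B + - (# 3 * (A * A * y))) + (- (y * y * y) + - (# 6 * (A * B * y))) + (# 3 * (A * B * B) + # 3 * (B * y * y))
    cube = trans (*-cong E-dissection (*-cong E-dissection E-dissection))
      (solve 3 (λ A B y → (A :+ B :- y) :* ((A :+ B :- y) :* (A :+ B :- y)) :=
        κ 3 :* A :* (A :* B :+ y :* y) :+ (A :* A :* A :+ :- (κ 3 :* (B :* B :* y)))
        :+ (B :* B :* B :+ :- (κ 3 :* (A :* A :* y))) :+ (:- (y :* y :* y) :+ :- (κ 6 :* (A :* B :* y)))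
        :+ (κ 3 :* (A :* B :* B) :+ κ 3 :* (B :* y :* y))) refl A B y)
    a = A-supported
    b = B-supported
    c = y-supported
    part-2 : part 2 E³ ≈ # 3 * A * (A * B + y * y)
    part-2 = trans (part-cong 2 cube) (trans (part-+ 2 _ _) (trans (+-cong (trans (part-+ 2 _ _) (+-cong (trans (part-+ 2 _ _)
      (+-cong (trans (part-+ 2 _ _) (+-cong
        (part-same 2 ≡.refl (supported-* (supported-#* 3 a) (supported-+ {2} (a · b) (c · c))))
        (part-other 2 (λ ()) (supported-+ {0} (a · a · a) (supported-% ≡.refl (supported-neg (supported-#* 3 (b · b · c))))))))
        (part-other 2 (λ ()) (supported-+ {1} (supported-% ≡.refl (b · b · b)) (supported-neg (supported-#* 3 (a · a · c)))))))
        (part-other 2 (λ ()) (supported-+ {3} (supported-neg (c · c · c)) (supported-neg (supported-#* 6 (a · b · c)))))))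
        (part-other 2 (λ ()) (supported-+ {4} (supported-#* 3 (a · b · b)) (supported-#* 3 (b · c · c)))))
      (solve 1 (λ s → s :+ κ 0 :+ κ 0 :+ κ 0 :+ κ 0 := s) refl _)))

  E²-zero : (E * E) 0 ≡ + 1
  E²-zero = ≡.trans (⊗-zero-at E E) (cong₂ ℤ._*_ E-zero E-zero)

  θE : θ E ≈ - X₁ * E
  θE = cancel (θ E) (- X₁ * E) 3E²≢0 (begin
    # 3 * (E * E) * θ E
      ≈⟨ solve 2 (λ e t → κ 3 :* (e :* e) :* t := t :* (e :* e) :+ e :* (t :* e :+ e :* t)) refl E (θ E) ⟩
    θ E * (E * E) + E * (θ E * E + E * θ E)
      ≈⟨ trans (θ-⊗ E (E * E)) (+-congˡ (*-congˡ (θ-⊗ E E))) ⟨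
    θ E³
      ≈⟨ θE³ ⟨
    # 3 * - (E³ * X₁)
      ≈⟨ solve 2 (λ e x → κ 3 :* (:- (e :* (e :* e) :* x)) := κ 3 :* (e :* e) :* (:- x :* e)) refl E X₁ ⟩
    # 3 * (E * E) * (- X₁ * E) ∎)
    where
    3E²≢0 : (# 3 * (E * E)) 0 ≢ + 0
    3E²≢0 = nonzero (≡.trans (⟨⟩⊗-at (+ 3) (E * E) 0) (cong (+ 3 ℤ.*_) E²-zero))

  E³-zero : E³ 0 ≢ + 0
  E³-zero = nonzero (≡.trans (⊗-zero-at E (E * E)) (cong₂ ℤ._*_ E-zero E²-zero))

  -- θ² E³ is known twice, from the w²-coefficient of the triple product and by differentiating -3
  -- E³ X₁; E³ and a factor 3 then cancel. This is 12 θ E₂ = E₂² - E₄ before `X₂` is recognised.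
  lambert-relation : # 5 * X₂ ≈ # 2 * (X₁ * X₁) - X₁ + θ X₁
  lambert-relation = cancel (# 5 * X₂) _ 3≢0 (cancel _ _ E³-zero (begin
    E³ * (# 3 * (# 5 * X₂))
      ≈⟨ solve 4 (λ e u v t → e :* (κ 3 :* (κ 5 :* v)) := κ 15 :* (e :* (u :* u)) :+ t :- (κ 15 :* (e :* (u :* u :- v)) :+ t)) refl E³ X₁ X₂ (θ E³) ⟩
    # 15 * (E³ * (X₁ * X₁)) + θ E³ - (# 15 * (E³ * (X₁ * X₁ - X₂)) + θ E³)
      ≈⟨ +-congˡ (-‿cong (trans θ²E³ (trans (θ-cong (sym θE³)) θ²))) ⟩
    # 15 * (E³ * (X₁ * X₁)) + θ E³ - # 3 * - (θ E³ * X₁ + E³ * θ X₁)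
      ≈⟨ +-cong (+-congˡ (sym θE³)) (-‿cong (*-congˡ (-‿cong (+-congʳ (*-congʳ (sym θE³)))))) ⟩
    # 15 * (E³ * (X₁ * X₁)) + # 3 * - (E³ * X₁) - # 3 * - (# 3 * - (E³ * X₁) * X₁ + E³ * θ X₁)
      ≈⟨ solve 3 (λ e u t → κ 15 :* (e :* (u :* u)) :+ κ 3 :* (:- (e :* u)) :- κ 3 :* (:- (κ 3 :* (:- (e :* u)) :* u :+ e :* t)) :=
           e :* (κ 3 :* (κ 2 :* (u :* u) :- u :+ t))) refl E³ X₁ (θ X₁) ⟩
    E³ * (# 3 * (# 2 * (X₁ * X₁) - X₁ + θ X₁)) ∎))
    where
    3≢0 : (# 3) 0 ≢ + 0
    3≢0 = nonzero (⟨⟩-zero-at (+ 3))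
    θ² : θ (# 3 * - (E³ * X₁)) ≈ # 3 * - (θ E³ * X₁ + E³ * θ X₁)
    θ² = trans (θ-scalar _ (θ-⟨⟩ (+ 3))) (*-congˡ (trans (θ-⊝ _) (-‿cong (θ-⊗ E³ X₁))))

  θones : θ ones ≈ X * (ones * ones)
  θones = begin
    θ ones
      ≈⟨ solve 3 (λ o t x → t := (κ 1 :+ x :* o) :* t :- x :* o :* t) refl ones (θ ones) X ⟩
    (# 1 + X * ones) * θ ones - X * ones * θ ones
      ≈⟨ +-congʳ (*-congʳ (sym ones-expand)) ⟩
    ones * θ ones - X * ones * θ ones
      ≈⟨ +-congʳ (*-congˡ (trans (θ-cong ones-expand) (trans (θ-⊕ (# 1) (X * ones)) (+-cong (θ-⟨⟩ (+ 1)) (trans (θ-⊗ X ones) (+-congʳ (*-congʳ θ-X))))))) ⟩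
    ones * (# 0 + (X * ones + X * θ ones)) - X * ones * θ ones
      ≈⟨ solve 3 (λ o t x → o :* (κ 0 :+ (x :* o :+ x :* t)) :- x :* o :* t := x :* (o :* o)) refl ones (θ ones) X ⟩
    X * (ones * ones) ∎

  -- With p = q / (1 - q)² the series of n³ q^n is p + 6 p², which is why X₁ + 6 X₂ generates σ₃.
  θ³ones : θ (θ (θ ones)) ≈ X * (ones * ones) + # 6 * (X * (ones * ones) * (X * (ones * ones)))
  θ³ones = begin
    θ (θ (θ ones))
      ≈⟨ θ-cong (trans (θ-cong θones) step₁) ⟩
    θ (X * o² + # 2 * (X * (ones * (X * o²))))
      ≈⟨ trans (θ-⊕ _ _) (+-cong step₁ (trans (θ-scalar _ (θ-⟨⟩ (+ 2))) (*-congˡ (trans (θ-⊗ _ _) (+-cong (*-congʳ θ-X)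
           (*-congˡ (trans (θ-⊗ _ _) (+-cong (*-congʳ θones) (*-congˡ step₁))))))))) ⟩
    X * o² + # 2 * (X * (ones * (X * o²))) + # 2 * (X * (ones * (X * o²)) + X * (X * o² * (X * o²) + ones * (X * o² + # 2 * (X * (ones * (X * o²))))))
      ≈⟨ solve 2 (λ x o → let p = x :* (o :* o) in
           p :+ κ 2 :* (x :* (o :* p)) :+ κ 2 :* (x :* (o :* p) :+ x :* (p :* p :+ o :* (p :+ κ 2 :* (x :* (o :* p))))) :=
           p :+ κ 6 :* (p :* (x :* (o :* (κ 1 :+ x :* o))))) refl X ones ⟩
    X * o² + # 6 * (X * o² * (X * (ones * (# 1 + X * ones))))
      ≈⟨ +-congˡ (*-congˡ (*-congˡ (*-congˡ (*-congˡ (sym ones-expand))))) ⟩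
    X * o² + # 6 * (X * o² * (X * o²)) ∎
    where
    o² = ones * ones
    step₁ : θ (X * o²) ≈ X * o² + # 2 * (X * (ones * (X * o²)))
    step₁ = trans (θ-⊗ X o²) (trans (+-cong (*-congʳ θ-X) (*-congˡ (trans (θ-⊗ ones ones) (+-cong (*-congʳ θones) (*-congˡ θones)))))
      (solve 3 (λ x o p → x :* (o :* o) :+ x :* (p :* o :+ o :* p) := x :* (o :* o) :+ κ 2 :* (x :* (o :* p))) refl X ones (X * o²)))

  x-dilate : ∀ i → x (suc i) ≈ dilate (suc i) (X * (ones * ones))
  x-dilate i = sym (trans (dilate-⊗ (suc i) X _) (*-cong (dilate-X (suc i))
    (trans (dilate-⊗ (suc i) ones ones) (*-cong (geom≈dilate (suc i)) (geom≈dilate (suc i))))))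

  lambertSum : Series → ℕ → Series
  lambertSum f N = ∑ N (λ i → dilate (suc i) f)

  x-sum≈lambertSum : ∀ N → x-sum N ≈ lambertSum (θ ones) N
  x-sum≈lambertSum N = ∑-cong N λ i → trans (x-dilate i) (dilate-cong (suc i) (sym θones))

  X₁+6X₂≈lambertSum : ∀ N → X₁ + # 6 * X₂ ≈[ N ] lambertSum (θ (θ (θ ones))) N
  X₁+6X₂≈lambertSum N = ≈[]-trans
    (⊕-cong[] (limit≈ x-sum-stable N) (⊗-cong[] (≈[]-refl {# 6}) (limit≈ x²-sum-stable N)))
    (≈⇒≈[] N (sum N))
    where
    term : ∀ i → x (suc i) + # 6 * (x (suc i) * x (suc i)) ≈ dilate (suc i) (θ (θ (θ ones)))
    term i = trans (+-cong (x-dilate i) (*-cong (sym (dilate-⟨⟩ (suc i) (+ 6))) (*-cong (x-dilate i) (x-dilate i)))) (sym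
      (trans (dilate-cong (suc i) θ³ones) (trans (dilate-⊕ (suc i) _ _) (+-congˡ (trans (dilate-⊗ (suc i) _ _) (*-congˡ (dilate-⊗ (suc i) _ _)))))))
    sum : ∀ N → x-sum N + # 6 * x²-sum N ≈ lambertSum (θ (θ (θ ones))) N
    sum zero    = solve 0 (κ 0 :+ κ 6 :* κ 0 := κ 0) refl
    sum (suc N) = trans (solve 4 (λ s t u v → s :+ u :+ κ 6 :* (t :+ v) := s :+ κ 6 :* t :+ (u :+ κ 6 :* v)) refl _ _ _ _)
      (+-cong (sum N) (term N))

  dilate-dilate : ∀ n .{{_ : ℕ.NonZero n}} f → V (dilate n f) ≈ dilate (n ℕ.* 5) f
  dilate-dilate n f = sym (dilate-unique (n ℕ.* 5) {{ℕₚ.m*n≢0 n 5}} f _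
    (λ k → ≡.trans (cong (V (dilate n f)) (≡.sym (ℕₚ.*-assoc k n 5))) (≡.trans (dilate-on 5 (dilate n f) (k ℕ.* n)) (dilate-on n f k)))
    off)
    where
    off : ∀ k → ¬ n ℕ.* 5 ∣ k → V (dilate n f) k ≡ + 0
    off k n5∤k with 5 ∣? k
    ... | no  5∤k = dilate-off 5 (dilate n f) k 5∤k
    ... | yes (divides j ≡.refl) = ≡.trans (dilate-on 5 (dilate n f) j) (dilate-off n f j λ where
            (divides i ≡.refl) → n5∤k (divides i (ℕₚ.*-assoc i n 5)))

  U-dilate : ∀ n .{{_ : ℕ.NonZero n}} f → ¬ 5 ∣ n → U (dilate n f) ≈ dilate n (U f)
  U-dilate n f 5∤n = sym (dilate-unique n (U f) _
    (λ k → ≡.trans (U-at (dilate n f) (k ℕ.* n)) (≡.trans (cong (dilate n f) (swap k n))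
      (≡.trans (dilate-on n f (k ℕ.* 5)) (≡.sym (U-at f k)))))
    (λ k n∤k → ≡.trans (U-at (dilate n f) k) (dilate-off n f (k ℕ.* 5) (λ n∣5k → n∤k (coprime n∣5k)))))
    where
    swap : ∀ k n → k ℕ.* n ℕ.* 5 ≡ k ℕ.* 5 ℕ.* n
    swap = solve-∀
    coprime : ∀ {k} → n ∣ k ℕ.* 5 → n ∣ k
    coprime {k} (divides j k5≡jn) with euclidsLemma j n (toWitness {a? = prime? 5} _) (divides k (≡.sym k5≡jn))
    ... | inj₂ 5∣n = ⊥-elim (5∤n 5∣n)
    ... | inj₁ (divides i ≡.refl) = divides i (ℕₚ.*-cancelʳ-≡ k (i ℕ.* n) 5 (≡.trans k5≡jn (swap′ i n)))
      where
      swap′ : ∀ i n → i ℕ.* 5 ℕ.* n ≡ i ℕ.* n ℕ.* 5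
      swap′ = solve-∀

  Uθones : U (θ ones) ≈ # 5 * θ ones
  Uθones = pointwise λ n → ≡.trans (U-at (θ ones) n) (≡.trans (θ-at ones (n ℕ.* 5))
    (≡.trans (ℤₚ.*-identityʳ _) (≡.trans (cong +_ (ℕₚ.*-comm n 5)) (≡.trans (ℤₚ.pos-* 5 n)
      (≡.sym (≡.trans (⟨⟩⊗-at (+ 5) (θ ones) n) (cong (+ 5 ℤ.*_) (≡.trans (θ-at ones n) (ℤₚ.*-identityʳ (+ n))))))))))

  -- The Hecke relation σ(5 n) + 5 σ(n / 5) = 6 σ(n) in truncated form. U scales the dilation by i
  -- by 5 if 5 does not divide i, and sends the dilation by 5 i to the one by i. Cutting the sums at
  -- 5 K and K makes the blocks match exactly.
  U-lambertSum : ∀ K → U (lambertSum (θ ones) (K ℕ.* 5)) + # 5 * V (lambertSum (θ ones) K) ≈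
    # 5 * lambertSum (θ ones) (K ℕ.* 5) + lambertSum (θ ones) K
  U-lambertSum zero = trans (+-cong U0 (*-congˡ (dilate-⟨⟩ 5 (+ 0)))) (solve 0 (κ 0 :+ κ 5 :* κ 0 := κ 5 :* κ 0 :+ κ 0) refl)
    where
    U0 : U (# 0) ≈ # 0
    U0 = trans (U-cong (sym (dilate-⟨⟩ 5 (+ 0)))) (U-V (# 0))
  U-lambertSum (suc K) = begin
    U (L + d 1 + d 2 + d 3 + d 4 + dilate (suc K ℕ.* 5) f) + # 5 * V (M + m)
      ≈⟨ +-cong (trans (U-⊕ _ _) (+-cong (trans (U-⊕ _ _) (+-cong (trans (U-⊕ _ _) (+-cong (trans (U-⊕ _ _) (+-cong
           (trans (U-⊕ _ _) (+-congˡ (Ud 0 (s≤s z≤n)))) (Ud 1 (s≤s (s≤s z≤n))))) (Ud 2 (s≤s (s≤s (s≤s z≤n)))))) (Ud 3 (ℕₚ.≤-refl))))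
           (trans (U-cong (sym (dilate-dilate (suc K) f))) (U-V m))))
           (*-congˡ (trans (dilate-⊕ 5 M m) (+-congˡ (dilate-dilate (suc K) f)))) ⟩
    U L + # 5 * d 1 + # 5 * d 2 + # 5 * d 3 + # 5 * d 4 + m + # 5 * (V M + d 5)
      ≈⟨ solve 8 (λ l p q r s t m v → l :+ κ 5 :* p :+ κ 5 :* q :+ κ 5 :* r :+ κ 5 :* s :+ m :+ κ 5 :* (v :+ t) :=
           (l :+ κ 5 :* v) :+ κ 5 :* (p :+ q :+ r :+ s :+ t) :+ m) refl (U L) (d 1) (d 2) (d 3) (d 4) (d 5) m (V M) ⟩
    U L + # 5 * V M + # 5 * (d 1 + d 2 + d 3 + d 4 + d 5) + m
      ≈⟨ +-congʳ (+-congʳ (U-lambertSum K)) ⟩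
    # 5 * L + M + # 5 * (d 1 + d 2 + d 3 + d 4 + d 5) + m
      ≈⟨ solve 8 (λ l p q r s t m v → κ 5 :* l :+ v :+ κ 5 :* (p :+ q :+ r :+ s :+ t) :+ m :=
           κ 5 :* (l :+ p :+ q :+ r :+ s :+ t) :+ (v :+ m)) refl L (d 1) (d 2) (d 3) (d 4) (d 5) m M ⟩
    # 5 * (L + d 1 + d 2 + d 3 + d 4 + d 5) + (M + m) ∎
    where
    f = θ ones
    L = lambertSum f (K ℕ.* 5)
    M = lambertSum f K
    m = dilate (suc K) f
    d : ℕ → Series
    d i = dilate (i ℕ.+ K ℕ.* 5) f
    Ud : ∀ i → i ℕ.< 4 → U (d (suc i)) ≈ # 5 * d (suc i)
    Ud i i<4 = trans
      (U-dilate (suc i ℕ.+ K ℕ.* 5) f λ 5∣ → >⇒∤ (s≤s i<4)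
        (∣m+n∣m⇒∣n (≡.subst (5 ∣_) (ℕₚ.+-comm (suc i) (K ℕ.* 5)) 5∣) (n∣m*n K)))
      (trans (dilate-cong (suc i ℕ.+ K ℕ.* 5) Uθones) (trans (dilate-⊗ (suc i ℕ.+ K ℕ.* 5) _ _)
        (*-congʳ (dilate-⟨⟩ (suc i ℕ.+ K ℕ.* 5) (+ 5)))))

  X₁≈lambertSum : ∀ N → X₁ ≈[ N ] lambertSum (θ ones) N
  X₁≈lambertSum N = ≈[]-trans (limit≈ x-sum-stable N) (≈⇒≈[] N (x-sum≈lambertSum N))

  U-X₁ : U X₁ + # 5 * V X₁ ≈ # 5 * X₁ + X₁
  U-X₁ = ≈[]⇒≈ λ N → ≈[]-trans
    (⊕-cong[] (U-cong[] (X₁≈lambertSum (N ℕ.* 5))) (⊗-cong[] (≈[]-refl {# 5}) (dilate-cong[] 5 (X₁≈lambertSum N))))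
    (≈[]-trans (≈⇒≈[] N (U-lambertSum N))
      (≈[]-sym (⊕-cong[] (⊗-cong[] (≈[]-refl {# 5}) (≈[]-weaken (ℕₚ.m≤m*n N 5) (X₁≈lambertSum (N ℕ.* 5)))) (X₁≈lambertSum N))))

  -- The recursive helper inside σ₃ has no name; checking σ₃-suc lets unification recover it.
  mutual
    σ₃-upTo : ℕ → ℕ → ℕ
    σ₃-upTo = _

    σ₃-suc : ∀ m → σ₃ (suc m) ≡ σ₃-upTo (suc m) m ℕ.+ (if does (suc m ∣? suc m) then suc m ℕ.^ 3 else 0)
    σ₃-suc m with suc m ℕ.^ 3 | suc m ∣? suc m | suc m
    ... | _ | _ | _ = ≡.refl

  cubes : Series
  cubes = θ (θ (θ ones))

  cubes-at : ∀ n → cubes n ≡ + (n ℕ.^ 3)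
  cubes-at n = ≡.trans (θ-at _ n) (≡.trans (cong (+ n ℤ.*_) (≡.trans (θ-at _ n) (cong (+ n ℤ.*_) (θ-at ones n)))) (go n))
    where
    go : ∀ n → + n ℤ.* (+ n ℤ.* (+ n ℤ.* + 1)) ≡ + (n ℕ.^ 3)
    go n = ≡.sym (≡.trans (ℤₚ.pos-* n _) (cong (+ n ℤ.*_) (≡.trans (ℤₚ.pos-* n _) (cong (+ n ℤ.*_) (ℤₚ.pos-* n 1)))))

  σ₃-term : ∀ n d → + (if does (suc d ∣? n) then suc d ℕ.^ 3 else 0) ≡ cubes (suc d) ℤ.* geom (suc d) n
  σ₃-term n d with does (suc d ∣? n)
  ... | true  = ≡.sym (≡.trans (ℤₚ.*-identityʳ _) (cubes-at (suc d)))
  ... | false = ≡.sym (ℤₚ.*-zeroʳ (cubes (suc d)))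

  σ₃-upTo-sum : ∀ n d → + σ₃-upTo n (suc d) ≡ sumTo d (λ j → cubes (suc j) ℤ.* geom (suc j) n)
  σ₃-upTo-sum n zero    = σ₃-term n 0
  σ₃-upTo-sum n (suc d) = ≡.trans (ℤₚ.pos-+ (σ₃-upTo n (suc d)) _) (cong₂ ℤ._+_ (σ₃-upTo-sum n d) (σ₃-term n (suc d)))

  sumTo-single : ∀ n k (h : Series) → k ℕ.≤ n → (∀ i → i ≢ k → h i ≡ + 0) → sumTo n h ≡ h k
  sumTo-single zero    zero    h _   _   = ≡.refl
  sumTo-single (suc n) k       h k≤n off with k ℕₚ.≟ suc n
  ... | yes ≡.refl = ≡.trans (cong (ℤ._+ h (suc n)) (≡.trans (sumTo-cong n λ i i≤n → off i (ℕₚ.<⇒≢ (s≤s i≤n))) (sumTo-zero n)))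
                       (ℤₚ.+-identityˡ (h (suc n)))
  ... | no  k≢sn   = ≡.trans (cong₂ ℤ._+_ (sumTo-single n k h (ℕₚ.≤-pred (ℕₚ.≤∧≢⇒< k≤n k≢sn)) off) (off (suc n) λ eq → k≢sn (≡.sym eq)))
                       (ℤₚ.+-identityʳ (h k))

  indicator : ℕ → ℕ → ℤ
  indicator a b = select (a ℕₚ.≟ b) (+ 1)

  indicator-≡ : ∀ {a b} → a ≡ b → indicator a b ≡ + 1
  indicator-≡ {a} {b} a≡b with a ℕₚ.≟ b
  ... | yes _   = ≡.refl
  ... | no  a≢b = ⊥-elim (a≢b a≡b)

  indicator-≢ : ∀ {a b} → a ≢ b → indicator a b ≡ + 0
  indicator-≢ {a} {b} a≢b with a ℕₚ.≟ b
  ... | yes a≡b = ⊥-elim (a≢b a≡b)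
  ... | no  _   = ≡.refl

  -- An indicator in place of the divisibility test treats divisor and cofactor alike, as the
  -- exchange of sums in `lambertSum-cubes` requires.
  dilate-sum : ∀ i f n → dilate (suc i) f (suc n) ≡ sumTo n (λ j → f (suc j) ℤ.* indicator (suc j ℕ.* suc i) (suc n))
  dilate-sum i f n with suc i ∣? suc n
  ... | no ∤ = ≡.trans (dilate-off (suc i) f (suc n) ∤) (≡.sym (≡.trans
          (sumTo-cong n λ j _ → ≡.trans (cong (f (suc j) ℤ.*_) (indicator-≢ λ eq → ∤ (divides (suc j) (≡.sym eq)))) (ℤₚ.*-zeroʳ (f (suc j))))
          (sumTo-zero n)))
  ... | yes (divides (suc k) eq) = ≡.trans (cong (dilate (suc i) f) eq) (≡.trans (dilate-on (suc i) f (suc k)) (≡.sym (≡.trans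
          (sumTo-single n k _ k≤n λ j j≢k → ≡.trans (cong (f (suc j) ℤ.*_) (indicator-≢ λ eq′ →
            j≢k (ℕₚ.suc-injective (ℕₚ.*-cancelʳ-≡ (suc j) (suc k) (suc i) (≡.trans eq′ eq))))) (ℤₚ.*-zeroʳ (f (suc j))))
          (≡.trans (cong (f (suc k) ℤ.*_) (indicator-≡ (≡.sym eq))) (ℤₚ.*-identityʳ (f (suc k)))))))
    where
    k≤n : k ℕ.≤ n
    k≤n = ℕₚ.≤-pred (ℕₚ.≤-trans (ℕₚ.m≤m*n (suc k) (suc i)) (ℕₚ.≤-reflexive (≡.sym eq)))

  sumTo-swap : ∀ m n (h : ℕ → ℕ → ℤ) → sumTo m (λ i → sumTo n (h i)) ≡ sumTo n (λ j → sumTo m (λ i → h i j))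
  sumTo-swap zero    n h = ≡.refl
  sumTo-swap (suc m) n h = ≡.trans (cong (ℤ._+ sumTo n (h (suc m))) (sumTo-swap m n h))
    (≡.sym (sumTo-+ n (λ j → sumTo m (λ i → h i j)) (h (suc m))))

  lambertSum-at : ∀ f N n → lambertSum f (suc N) n ≡ sumTo N (λ i → dilate (suc i) f n)
  lambertSum-at f zero    n = at (+-identityˡ (dilate 1 f)) n
  lambertSum-at f (suc N) n = ≡.trans (⊕-at _ _ n) (cong (ℤ._+ dilate (suc (suc N)) f n) (lambertSum-at f N n))

  -- The sum runs over pairs with product n + 1 and cubes one member; dilations are indexed by the
  -- other member, so the order of summation is exchanged before comparing with σ₃.
  lambertSum-cubes : ∀ n → lambertSum cubes (suc n) (suc n) ≡ + σ₃ (suc n)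
  lambertSum-cubes n = P.begin
    lambertSum cubes (suc n) (suc n)
      P.≡⟨ lambertSum-at cubes n (suc n) ⟩
    sumTo n (λ i → dilate (suc i) cubes (suc n))
      P.≡⟨ sumTo-cong n (λ i _ → dilate-sum i cubes n) ⟩
    sumTo n (λ i → sumTo n (λ j → cubes (suc j) ℤ.* indicator (suc j ℕ.* suc i) (suc n)))
      P.≡⟨ sumTo-swap n n _ ⟩
    sumTo n (λ j → sumTo n (λ i → cubes (suc j) ℤ.* indicator (suc j ℕ.* suc i) (suc n)))
      P.≡⟨ sumTo-cong n (λ j _ → ≡.trans (sumTo-*ˡ n (cubes (suc j)) _) (cong (cubes (suc j) ℤ.*_) (count j))) ⟩
    sumTo n (λ j → cubes (suc j) ℤ.* geom (suc j) (suc n))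
      P.≡⟨ σ₃-upTo-sum (suc n) n ⟨
    + σ₃-upTo (suc n) (suc n)
      P.≡⟨ cong +_ (σ₃-suc n) ⟨
    + σ₃ (suc n) P.∎
    where
    module P = ≡.≡-Reasoning
    count : ∀ j → sumTo n (λ i → indicator (suc j ℕ.* suc i) (suc n)) ≡ geom (suc j) (suc n)
    count j = ≡.trans (sumTo-cong n λ i _ → ≡.trans (cong (λ k → indicator k (suc n)) (ℕₚ.*-comm (suc j) (suc i))) (≡.sym (ℤₚ.*-identityˡ _)))
      (≡.trans (≡.sym (dilate-sum j ones n)) (at (geom≈dilate (suc j)) (suc n)))

  X₁+6X₂-zero : (X₁ + # 6 * X₂) 0 ≡ + 0
  X₁+6X₂-zero = ≡.trans (below (X₁+6X₂≈lambertSum 0) 0 z≤n) (⟨⟩-zero-at (+ 0))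

  E₄-X₁X₂ : E₄ ≈ # 1 + # 240 * (X₁ + # 6 * X₂)
  E₄-X₁X₂ = pointwise λ where
    zero    → ≡.sym (≡.trans (⊕-at _ _ 0) (cong₂ ℤ._+_ (⟨⟩-zero-at (+ 1))
                (≡.trans (⟨⟩⊗-at (+ 240) _ 0) (cong (+ 240 ℤ.*_) X₁+6X₂-zero))))
    (suc n) → ≡.sym (≡.trans (⊕-at _ _ (suc n)) (≡.trans (cong₂ ℤ._+_ (⟨⟩-suc-at (+ 1) n)
                (≡.trans (⟨⟩⊗-at (+ 240) _ (suc n)) (≡.trans (cong (+ 240 ℤ.*_)
                  (≡.trans (below (X₁+6X₂≈lambertSum (suc n)) (suc n) ℕₚ.≤-refl) (lambertSum-cubes n)))
                  (≡.sym (ℤₚ.pos-* 240 (σ₃ (suc n)))))))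
                (ℤₚ.+-identityˡ _)))

  E₂ : Series
  E₂ = # 1 - # 24 * X₁

  E₄-E₂ : E₄ ≈ E₂ * E₂ - # 12 * θ E₂
  E₄-E₂ = begin
    E₄
      ≈⟨ E₄-X₁X₂ ⟩
    # 1 + # 240 * (X₁ + # 6 * X₂)
      -- 240 · 6 = 288 · 5 produces the multiple of `X₂` that `lambert-relation` evaluates.
      ≈⟨ solve 2 (λ u v → κ 1 :+ κ 240 :* (u :+ κ 6 :* v) := κ 1 :+ κ 240 :* u :+ κ 288 :* (κ 5 :* v)) refl X₁ X₂ ⟩
    # 1 + # 240 * X₁ + # 288 * (# 5 * X₂)
      ≈⟨ +-congˡ (*-congˡ lambert-relation) ⟩
    # 1 + # 240 * X₁ + # 288 * (# 2 * (X₁ * X₁) - X₁ + θ X₁)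
      ≈⟨ solve 2 (λ u t → κ 1 :+ κ 240 :* u :+ κ 288 :* (κ 2 :* (u :* u) :- u :+ t) :=
           (κ 1 :- κ 24 :* u) :* (κ 1 :- κ 24 :* u) :- κ 12 :* (κ 0 :- κ 24 :* t)) refl X₁ (θ X₁) ⟩
    E₂ * E₂ - # 12 * (# 0 - # 24 * θ X₁)
      ≈⟨ +-congˡ (-‿cong (*-congˡ θE₂)) ⟨
    E₂ * E₂ - # 12 * θ E₂ ∎
    where
    θE₂ : θ E₂ ≈ # 0 - # 24 * θ X₁
    θE₂ = trans (θ-⊕ _ _) (+-cong (θ-⟨⟩ (+ 1)) (trans (θ-⊝ _) (-‿cong (θ-scalar X₁ (θ-⟨⟩ (+ 24))))))

-- The norm of E and the modular equation.

module ModularEquation where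
  open PowerSeries
  open SeriesAlgebra
  open Operators
  open EulerProduct
  open ResidueClasses
  open CubeOfE
  open DivisorSums
  open import Data.Integer as ℤ using (ℤ; +_)
  import Data.Integer.Properties as ℤₚ
  open import Data.Nat as ℕ using (ℕ; zero; suc; z≤n)
  open import Data.Nat.Divisibility using (m%n≡0⇒n∣m)
  open import Data.Nat.DivMod using (_%_)
  import Data.Nat.Properties as ℕₚ
  open import Relation.Binary.PropositionalEquality as ≡ using (_≡_; _≢_; cong)
  open import Relation.Binary.Reasoning.Setoid setoid

  V-cong : ∀ {f g} → f ≈ g → V f ≈ V g
  V-cong = dilate-cong 5

  V-+ : ∀ f g → V (f + g) ≈ V f + V g
  V-+ = dilate-⊕ 5

  V-* : ∀ f g → V (f * g) ≈ V f * V g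
  V-* = dilate-⊗ 5

  V-neg : ∀ f → V (- f) ≈ - V f
  V-neg = dilate-⊝ 5

  V-# : ∀ n → V (# n) ≈ # n
  V-# n = dilate-⟨⟩ 5 (+ n)

  V-^ : ∀ f k → V (f ^ k) ≈ V f ^ k
  V-^ = dilate-^ 5

  V-#* : ∀ n f → V (# n * f) ≈ # n * V f
  V-#* n f = trans (V-* (# n) f) (*-congʳ (V-# n))

  supported-0 : ∀ {f} → Supported 0 f → f ≈ V (U f)
  supported-0 {f} s = sym (dilate-unique 5 (U f) f (λ k → ≡.sym (U-at f k))
    (λ n 5∤n → outside s n λ n%5≡0 → 5∤n (m%n≡0⇒n∣m n 5 n%5≡0)))

  U-θ : ∀ f → U (θ f) ≈ # 5 * θ (U f)
  U-θ f = pointwise λ n → ≡.trans (U-at (θ f) n) (≡.trans (θ-at f (n ℕ.* 5)) (≡.sym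
    (≡.trans (⟨⟩⊗-at (+ 5) (θ (U f)) n) (≡.trans (cong (+ 5 ℤ.*_) (≡.trans (θ-at (U f) n) (cong (+ n ℤ.*_) (U-at f n))))
      (≡.trans (≡.sym (ℤₚ.*-assoc (+ 5) (+ n) (f (n ℕ.* 5)))) (cong (ℤ._* f (n ℕ.* 5)) (≡.trans (≡.sym (ℤₚ.pos-* 5 n)) (cong +_ (ℕₚ.*-comm 5 n)))))))))

  constant-term : ∀ {f n} → f 0 ≡ + n → f ≈[ 0 ] # n
  constant-term {f} {n} eq = agree λ { zero _ → ≡.trans eq (≡.sym (⟨⟩-zero-at (+ n))) }

  constant-term⁻¹ : ∀ {f n} → f ≈[ 0 ] # n → f 0 ≡ + n
  constant-term⁻¹ {n = n} eq = ≡.trans (below eq 0 z≤n) (⟨⟩-zero-at (+ n))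

  1≢0 : ∀ {f} → f ≈[ 0 ] # 1 → f 0 ≢ + 0
  1≢0 eq = nonzero (constant-term⁻¹ eq)

  -- Stated without division, so that it also covers series such as X that have no inverse.
  record _′_ (f a : Series) : Set where
    constructor logDerivative
    field derivative : θ f ≈ a * f
  open _′_ public

  infix 4 _′_

  ′-* : ∀ {f g a b} → f ′ a → g ′ b → f * g ′ a + b
  ′-* {f} {g} {a} {b} p q = logDerivative (trans (θ-⊗ f g) (trans (+-cong (*-congʳ (derivative p)) (*-congˡ (derivative q)))
    (solve 4 (λ f g a b → a :* f :* g :+ f :* (b :* g) := (a :+ b) :* (f :* g)) refl f g a b)))

  ′-^ : ∀ {f a} → f ′ a → ∀ k → f ^ k ′ # k * a
  ′-^ {f} {a} p zero    = logDerivative (trans (θ-⟨⟩ (+ 1)) (solve 1 (λ a → κ 0 := κ 0 :* a :* κ 1) refl a))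
  ′-^ {f} {a} p (suc k) = logDerivative (trans (derivative (′-* p (′-^ p k))) (*-congʳ (trans
    (solve 2 (λ a k → a :+ k :* a := (κ 1 :+ k) :* a) refl a (# k)) (*-congʳ (sym (#-+ 1 k))))))

  ′-V : ∀ {f a} → f ′ a → V f ′ # 5 * V a
  ′-V {f} {a} p = logDerivative (trans (θ-dilate 5 f) (trans (*-congˡ (trans (V-cong (derivative p)) (V-* a f))) (sym (*-assoc _ _ _))))

  ′-inverse : ∀ {f g a} → f * g ≈ # 1 → f ′ a → g ′ - a
  ′-inverse {f} {g} {a} fg≈1 p = logDerivative (begin
    θ g                               ≈⟨ solve 1 (λ t → t := κ 1 :* t) refl (θ g) ⟩
    # 1 * θ g                         ≈⟨ *-congʳ (sym fg≈1) ⟩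
    f * g * θ g                       ≈⟨ solve 4 (λ f g a t → f :* g :* t := (a :* f :* g :+ f :* t) :* g :- a :* (f :* g) :* g) refl f g a (θ g) ⟩
    (a * f * g + f * θ g) * g - a * (f * g) * g
      ≈⟨ +-cong (*-congʳ (trans (+-congʳ (*-congʳ (sym (derivative p)))) (trans (sym (θ-⊗ f g)) (trans (θ-cong fg≈1) (θ-⟨⟩ (+ 1))))))
           (-‿cong (*-congʳ (*-congˡ fg≈1))) ⟩
    # 0 * g - a * # 1 * g             ≈⟨ solve 2 (λ g a → κ 0 :* g :- a :* κ 1 :* g := :- a :* g) refl g a ⟩
    - a * g                           ∎)

  ′-cong : ∀ {f a b} → a ≈ b → f ′ a → f ′ b
  ′-cong eq p = logDerivative (trans (derivative p) (*-congʳ eq))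

  -- The difference solves the same first-order equation and has constant term 0, so `θ-unique`
  -- applies.
  ′-unique : ∀ {f g a} → a 0 ≡ + 0 → f ≈[ 0 ] g → f ′ a → g ′ a → f ≈ g
  ′-unique {f} {g} {a} a0≡0 f0≡g0 p q = difference (θ-unique a0≡0
    (≡.trans (below (⊕-cong[] f0≡g0 (≈[]-refl { - g })) 0 z≤n) (≡.trans (at (-‿inverseʳ g) 0) (⟨⟩-zero-at (+ 0))))
    (trans (θ-⊕ f (- g)) (trans (+-cong (derivative p) (trans (θ-⊝ g) (-‿cong (derivative q))))
      (solve 3 (λ a f g → a :* f :- a :* g := a :* (f :- g)) refl a f g))))

  X₁-zero : X₁ ≈[ 0 ] # 0
  X₁-zero = constant-term (⟨⟩-zero-at (+ 0))

  E≈[0]1 : E ≈[ 0 ] # 1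
  E≈[0]1 = constant-term E-zero

  V≈[0] : ∀ {f n} → f ≈[ 0 ] # n → V f ≈[ 0 ] # n
  V≈[0] {f} {n} eq = ≈[]-trans (dilate-cong[] 5 eq) (≈⇒≈[] 0 (V-# n))

  E-′ : E ′ - X₁
  E-′ = logDerivative θE

  E₅-′ : E₅ ′ # 5 * V (- X₁)
  E₅-′ = ′-V E-′

  F : Series
  F = invPoch

  F-′ : F ′ - - X₁
  F-′ = ′-inverse E-invPoch E-′

  -- Under q ↦ ζ q with ζ⁵ = 1, E becomes A + ζ² B - ζ y. Reduced by A B = -y², the product of all
  -- five conjugates is `norm₅`, with 11 = 1 + 5 + 5, and the product of the four with ζ ≠ 1 is `w`,
  -- written in E and y.
  norm₅ w : Series
  norm₅ = A ^ 5 + B ^ 5 - # 11 * y ^ 5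
  w = E ^ 4 + # 5 * (E ^ 3 * y) + # 15 * (E ^ 2 * y ^ 2) + # 25 * (E * y ^ 3) + # 25 * y ^ 4

  w₀ w₁ w₂ w₃ w₄ : Series
  w₀ = A ^ 4 + # 3 * (B * y ^ 3)
  w₁ = A ^ 3 * y + # 2 * (B ^ 2 * y ^ 2)
  w₂ = # 2 * (A ^ 2 * y ^ 2) + B ^ 3 * y
  w₃ = B ^ 4 + # 3 * (A * y ^ 3)
  w₄ = # 5 * y ^ 4

  AB+y²≈0 : A * B + y * y ≈ # 0
  AB+y²≈0 = trans (+-congʳ AB≈-y²) (-‿inverseˡ (y * y))

  drop-AB+y² : ∀ f g → f + (A * B + y * y) * g ≈ f
  drop-AB+y² f g = trans (+-congˡ (*-congʳ AB+y²≈0)) (solve 2 (λ f g → f :+ κ 0 :* g := f) refl f g)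

  -- The two sides differ by a multiple of A B + y², which vanishes; the i-th component collects the
  -- exponents congruent to i modulo 5.
  w-dissection : w ≈ w₀ + w₁ + w₂ + w₃ + w₄
  w-dissection = trans
    (+-cong (+-cong (+-cong (+-cong (^-congˡ 4 E-dissection) (*-congˡ (*-congʳ (^-congˡ 3 E-dissection))))
      (*-congˡ (*-congʳ (^-congˡ 2 E-dissection)))) (*-congˡ (*-congʳ E-dissection))) refl)
    (trans (solve 3 (λ A B y → let x = A :+ B :- y in
      x :^ 4 :+ κ 5 :* (x :^ 3 :* y) :+ κ 15 :* (x :^ 2 :* y :^ 2) :+ κ 25 :* (x :* y :^ 3) :+ κ 25 :* y :^ 4 :=
      A :^ 4 :+ κ 3 :* (B :* y :^ 3) :+ (A :^ 3 :* y :+ κ 2 :* (B :^ 2 :* y :^ 2))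
        :+ (κ 2 :* (A :^ 2 :* y :^ 2) :+ B :^ 3 :* y) :+ (B :^ 4 :+ κ 3 :* (A :* y :^ 3)) :+ κ 5 :* y :^ 4
        :+ (A :* B :+ y :* y) :* (κ 4 :* (A :^ 2 :+ B :^ 2) :+ κ 3 :* ((A :+ B) :* y) :+ κ 6 :* (A :* B :+ y :* y))) refl A B y) (drop-AB+y² _ _))

  norm₅≈E*w : norm₅ ≈ E * w
  norm₅≈E*w = trans (sym (drop-AB+y² _ _)) (trans (solve 3 (λ A B y → let u = A :+ B ; x = A :+ B :- y in
      A :^ 5 :+ B :^ 5 :- κ 11 :* y :^ 5 :+ (A :* B :+ y :* y) :* (κ 5 :* u :^ 3 :+ κ 5 :* (u :* (y :* y :- A :* B))) :=
      x :* (x :^ 4 :+ κ 5 :* (x :^ 3 :* y) :+ κ 15 :* (x :^ 2 :* y :^ 2) :+ κ 25 :* (x :* y :^ 3) :+ κ 25 :* y :^ 4)) refl A B y)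
    (sym (*-cong E-dissection (+-cong (+-cong (+-cong (+-cong (^-congˡ 4 E-dissection) (*-congˡ (*-congʳ (^-congˡ 3 E-dissection))))
      (*-congˡ (*-congʳ (^-congˡ 2 E-dissection)))) (*-congˡ (*-congʳ E-dissection))) refl))))

  private
    a = A-supported
    b = B-supported
    c = y-supported

  w₀-supported : Supported 0 w₀
  w₀-supported = supported-+ {0} (a ↑ 4) (supported-% ≡.refl (supported-#* 3 (b · c ↑ 3)))

  w₁-supported : Supported 1 w₁
  w₁-supported = supported-+ {1} (a ↑ 3 · c) (supported-% ≡.refl (supported-#* 2 (b ↑ 2 · c ↑ 2)))

  w₂-supported : Supported 2 w₂
  w₂-supported = supported-+ {2} (supported-#* 2 (a ↑ 2 · c ↑ 2)) (supported-% ≡.refl (b ↑ 3 · c))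

  w₃-supported : Supported 3 w₃
  w₃-supported = supported-+ {3} (supported-% ≡.refl (b ↑ 4)) (supported-#* 3 (a · c ↑ 3))

  w₄-supported : Supported 4 w₄
  w₄-supported = supported-#* 5 (c ↑ 4)

  norm₅-supported : Supported 0 norm₅
  norm₅-supported = supported-+ {0} (supported-+ {0} (a ↑ 5) (supported-% ≡.refl (b ↑ 5)))
    (supported-neg (supported-% ≡.refl (supported-#* 11 (c ↑ 5))))

  U-drop : ∀ {r f} g → r % 5 ≢ 0 → Supported r f → U (g + f) ≈ U g
  U-drop g r≢0 s = trans (U-⊕ g _) (trans (+-congˡ (U-supported r≢0 s)) (+-identityʳ (U g)))

  -- θ preserves residues, so of the fifteen products only these three have exponents divisible by
  -- 5.
  U-wθE : U (w * θ E) ≈ U (w₀ * θ A + w₃ * θ B - w₄ * θ y)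
  U-wθE = begin
    U (w * θ E)
      ≈⟨ U-cong (*-cong w-dissection (trans (θ-cong E-dissection) (trans (θ-⊕ _ _) (+-cong (θ-⊕ A B) (θ-⊝ y))))) ⟩
    U ((w₀ + w₁ + w₂ + w₃ + w₄) * (θ A + θ B - θ y))
      ≈⟨ U-cong (solve 8 (λ p q r s t a b c → (p :+ q :+ r :+ s :+ t) :* (a :+ b :- c) :=
           p :* a :+ s :* b :- t :* c :+ (q :* a :+ t :* b :- p :* c) :+ (r :* a :+ p :* b :- q :* c)
             :+ (s :* a :+ q :* b :- r :* c) :+ (t :* a :+ r :* b :- s :* c)) refl w₀ w₁ w₂ w₃ w₄ (θ A) (θ B) (θ y)) ⟩
    U (w₀ * θ A + w₃ * θ B - w₄ * θ y + (w₁ * θ A + w₄ * θ B - w₀ * θ y) + (w₂ * θ A + w₀ * θ B - w₁ * θ y)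
      + (w₃ * θ A + w₁ * θ B - w₂ * θ y) + (w₄ * θ A + w₂ * θ B - w₃ * θ y))
      ≈⟨ trans (U-drop {4} _ (λ ()) (row {4} (w₄-supported · a′) (w₂-supported · b′) (w₃-supported · c′)))
        (trans (U-drop {3} _ (λ ()) (row {3} (w₃-supported · a′) (w₁-supported · b′) (w₂-supported · c′)))
        (trans (U-drop {2} _ (λ ()) (row {2} (w₂-supported · a′) (w₀-supported · b′) (w₁-supported · c′)))
               (U-drop {1} _ (λ ()) (row {1} (w₁-supported · a′) (supported-% ≡.refl (w₄-supported · b′)) (w₀-supported · c′))))) ⟩
    U (w₀ * θ A + w₃ * θ B - w₄ * θ y) ∎
    where
    a′ = supported-θ a
    b′ = supported-θ b
    c′ = supported-θ c
    row : ∀ {r f g h} → Supported r f → Supported r g → Supported r h → Supported r (f + g - h)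
    row p q s = supported-+ (supported-+ p q) (supported-neg s)

  θ-^ : ∀ f k → θ (f ^ suc k) ≈ # suc k * f ^ k * θ f
  θ-^ f zero    = trans (θ-cong (*-identityʳ f)) (solve 1 (λ t → t := κ 1 :* κ 1 :* t) refl (θ f))
  θ-^ f (suc k) = begin
    θ (f * f ^ suc k)
      ≈⟨ trans (θ-⊗ f (f ^ suc k)) (+-congˡ (*-congˡ (θ-^ f k))) ⟩
    θ f * f ^ suc k + f * (# suc k * f ^ k * θ f)
      ≈⟨ solve 4 (λ f g t k → t :* (f :* g) :+ f :* (k :* g :* t) := (κ 1 :+ k) :* (f :* g) :* t) refl f (f ^ k) (θ f) (# suc k) ⟩
    (# 1 + # suc k) * f ^ suc k * θ f
      ≈⟨ *-congʳ (*-congʳ (sym (#-+ 1 (suc k)))) ⟩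
    # suc (suc k) * f ^ suc k * θ f ∎

  -- The trace of a logarithmic derivative is the logarithmic derivative of the norm.
  trace-norm : # 5 * (w₀ * θ A + w₃ * θ B - w₄ * θ y) ≈ θ norm₅
  trace-norm = begin
    # 5 * (w₀ * θ A + w₃ * θ B - w₄ * θ y)
      ≈⟨ solve 6 (λ A B y a b c →
           κ 5 :* ((A :^ 4 :+ κ 3 :* (B :* y :^ 3)) :* a :+ (B :^ 4 :+ κ 3 :* (A :* y :^ 3)) :* b :- κ 5 :* y :^ 4 :* c) :=
           κ 5 :* A :^ 4 :* a :+ κ 5 :* B :^ 4 :* b :- κ 11 :* (κ 5 :* y :^ 4 :* c)
             :+ κ 15 :* y :^ 3 :* (a :* B :+ A :* b :+ (c :* y :+ y :* c))) refl A B y (θ A) (θ B) (θ y) ⟩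
    # 5 * A ^ 4 * θ A + # 5 * B ^ 4 * θ B - # 11 * (# 5 * y ^ 4 * θ y)
      + # 15 * y ^ 3 * (θ A * B + A * θ B + (θ y * y + y * θ y))
      ≈⟨ +-cong (+-cong (+-cong (sym (θ-^ A 4)) (sym (θ-^ B 4))) (-‿cong (*-congˡ (sym (θ-^ y 4))))) (*-congˡ
           (trans (sym (trans (θ-⊕ (A * B) (y * y)) (+-cong (θ-⊗ A B) (θ-⊗ y y)))) (trans (θ-cong AB+y²≈0) (θ-⟨⟩ (+ 0))))) ⟩
    θ (A ^ 5) + θ (B ^ 5) - # 11 * θ (y ^ 5) + # 15 * y ^ 3 * # 0
      ≈⟨ solve 2 (λ t y → t :+ κ 15 :* y :* κ 0 := t) refl _ (y ^ 3) ⟩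
    θ (A ^ 5) + θ (B ^ 5) - # 11 * θ (y ^ 5)
      ≈⟨ sym (trans (θ-⊕ _ _) (+-cong (θ-⊕ _ _) (trans (θ-⊝ _) (-‿cong (θ-scalar _ (θ-⟨⟩ (+ 11))))))) ⟩
    θ norm₅ ∎

  norm₁ : Series
  norm₁ = U norm₅

  norm₅≈V : norm₅ ≈ V norm₁
  norm₅≈V = supported-0 norm₅-supported

  -- From θ E = -X₁ E follows w θ E = -norm₅ X₁, where norm₅ = V norm₁ leaves U. The 5 of U θ = 5 θ
  -- U cancels that of `trace-norm`.
  norm₁-′ : norm₁ ′ - U X₁
  norm₁-′ = logDerivative (cancel (θ norm₁) _ 5≢0 (begin
    # 5 * θ norm₁
      ≈⟨ U-θ norm₅ ⟨
    U (θ norm₅)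
      ≈⟨ trans (U-cong (sym trace-norm)) (trans (U-⟨⟩⊗ (+ 5) _) (*-congˡ (sym U-wθE))) ⟩
    # 5 * U (w * θ E)
      ≈⟨ *-congˡ (U-cong (trans (*-congˡ θE) (trans (solve 3 (λ w x e → w :* (:- x :* e) := e :* w :* (:- x)) refl w X₁ E)
           (*-congʳ (trans (sym norm₅≈E*w) norm₅≈V))))) ⟩
    # 5 * U (V norm₁ * - X₁)
      ≈⟨ *-congˡ (trans (U-V⊗ norm₁ (- X₁)) (*-congˡ U-neg)) ⟩
    # 5 * (norm₁ * - U X₁)
      ≈⟨ *-congˡ (*-comm _ _) ⟩
    # 5 * (- U X₁ * norm₁) ∎))
    where
    5≢0 : (# 5) 0 ≢ + 0
    5≢0 = nonzero (⟨⟩-zero-at (+ 5))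
    U-neg : U (- X₁) ≈ - U X₁
    U-neg = trans (U-cong (solve 1 (λ x → :- x := con (ℤ.- + 1) :* x) refl X₁)) (trans (U-⟨⟩⊗ (ℤ.- + 1) X₁)
      (solve 1 (λ x → con (ℤ.- + 1) :* x := :- x) refl (U X₁)))

  y≈[0]0 : y ≈[ 0 ] # 0
  y≈[0]0 = constant-term (X⊗-zero E₂₅)

  norm₁≈[0]1 : norm₁ ≈[ 0 ] # 1
  norm₁≈[0]1 = constant-term (≡.trans (U-at norm₅ 0) (constant-term⁻¹ (≈[]-trans
    (⊕-cong[] (⊕-cong[] (^-cong[] 5 A≈1) (^-cong[] 5 B≈0)) (-‿cong[] (⊗-cong[] (≈[]-refl {# 11}) (^-cong[] 5 y≈[0]0))))
    (≈⇒≈[] 0 (solve 0 (κ 1 :^ 5 :+ κ 0 :^ 5 :- κ 11 :* κ 0 :^ 5 := κ 1) refl)))))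
    where
    A≈1 : A ≈[ 0 ] # 1
    A≈1 = constant-term (≡.trans (part-zero E) E-zero)
    B≈0 : B ≈[ 0 ] # 0
    B≈0 = constant-term (outside b 0 (λ ()))

  -- Both sides have constant term 1, and by the Hecke relation `U-X₁` both have logarithmic
  -- derivative -6 X₁.
  norm₁*E₅≈E⁶ : norm₁ * E₅ ≈ E ^ 6
  norm₁*E₅≈E⁶ = ′-unique
    (constant-term⁻¹ (≈[]-trans (-‿cong[] (⊗-cong[] (≈[]-refl {# 6}) X₁-zero)) (≈⇒≈[] 0 (solve 0 (:- (κ 6 :* κ 0) := κ 0) refl))))
    (≈[]-trans (⊗-cong[] norm₁≈[0]1 (V≈[0] E≈[0]1)) (≈[]-trans (≈⇒≈[] 0 (solve 0 (κ 1 :* κ 1 := κ 1 :^ 6) refl))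
      (≈[]-sym (^-cong[] 6 E≈[0]1))))
    (′-cong (begin
      - U X₁ + # 5 * V (- X₁)
        ≈⟨ solve 3 (λ u v w → :- u :+ κ 5 :* w := :- (u :+ κ 5 :* v) :+ κ 5 :* (w :+ v)) refl (U X₁) (V X₁) (V (- X₁)) ⟩
      - (U X₁ + # 5 * V X₁) + # 5 * (V (- X₁) + V X₁)
        ≈⟨ +-cong (-‿cong U-X₁) (*-congˡ (trans (+-congʳ (V-neg X₁)) (-‿inverseˡ _))) ⟩
      - (# 5 * X₁ + X₁) + # 5 * # 0
        ≈⟨ solve 1 (λ x → :- (κ 5 :* x :+ x) :+ κ 5 :* κ 0 := :- (κ 6 :* x)) refl X₁ ⟩
      - (# 6 * X₁) ∎) (′-* norm₁-′ E₅-′))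
    (′-cong (solve 1 (λ x → κ 6 :* (:- x) := :- (κ 6 :* x)) refl X₁) (′-^ E-′ 6))

  E₅⁶ : E₅ ^ 6 ≈ E₂₅ * (E * w)
  E₅⁶ = begin
    E₅ ^ 6             ≈⟨ V-^ E 6 ⟨
    V (E ^ 6)          ≈⟨ V-cong norm₁*E₅≈E⁶ ⟨
    V (norm₁ * E₅)     ≈⟨ V-* norm₁ E₅ ⟩
    V norm₁ * E₂₅      ≈⟨ *-comm _ _ ⟩
    E₂₅ * V norm₁      ≈⟨ *-congˡ (trans (sym norm₅≈V) norm₅≈E*w) ⟩
    E₂₅ * (E * w)      ∎

-- The hauptmodul and the eta quotients for P² and E₄.

module LevelFive where
  open PowerSeries
  open SeriesAlgebra
  open Operators
  open EulerProduct
  open ResidueClasses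
  open CubeOfE
  open DivisorSums
  open ModularEquation
  open import Data.Integer using (+_)
  open import Data.Nat using (ℕ; zero; suc)
  open import Relation.Binary.PropositionalEquality as ≡ using (_≡_)
  open import Relation.Binary.Reasoning.Setoid setoid

  F₅ F₂₅ : Series
  F₅ = V F
  F₂₅ = V F₅

  E₅-F₅ : E₅ * F₅ ≈ # 1
  E₅-F₅ = trans (sym (V-* E F)) (trans (V-cong E-invPoch) (V-# 1))

  E₂₅-F₂₅ : E₂₅ * F₂₅ ≈ # 1
  E₂₅-F₂₅ = trans (sym (V-* E₅ F₅)) (trans (V-cong E₅-F₅) (V-# 1))

  one-^ : ∀ k → # 1 ^ k ≈ # 1
  one-^ zero    = refl
  one-^ (suc k) = trans (*-identityˡ _) (one-^ k)

  unit-^ : ∀ {f g} → f * g ≈ # 1 → ∀ k → (f * g) ^ k ≈ # 1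
  unit-^ fg≈1 k = trans (^-congˡ k fg≈1) (one-^ k)

  -- In terms of η these are η(25τ)/η(τ), (η(5τ)/η(τ))⁶ and the dilate V t written out.
  z t s : Series
  z = y * F
  t = X * (E₅ ^ 6 * F ^ 6)
  s = X ^ 5 * (E₂₅ ^ 6 * F₅ ^ 6)

  V-t : V t ≈ s
  V-t = trans (V-* _ _) (*-cong (dilate-X 5) (trans (V-* _ _) (*-cong (V-^ E₅ 6) (V-^ F 6))))

  φᵖ χᵖ ψᵖ : ∀ {n} → Polynomial n → Polynomial n
  φᵖ z = κ 1 :+ κ 5 :* z :+ κ 15 :* z :^ 2 :+ κ 25 :* z :^ 3 :+ κ 25 :* z :^ 4
  χᵖ z = κ 1 :+ κ 10 :* z :+ κ 45 :* z :^ 2 :+ κ 100 :* z :^ 3 :+ κ 125 :* z :^ 4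
  ψᵖ z = κ 1 :+ κ 4 :* z :+ κ 9 :* z :^ 2 :+ κ 10 :* z :^ 3 :+ κ 5 :* z :^ 4

  -- χ = φ + z φ′ and ψ = φ - z φ′ / 5 arise from the logarithmic derivatives of t = z φ and of V t
  -- = z⁵ / φ, the latter divided by 5.
  φ χ ψ : Series
  φ = # 1 + # 5 * z + # 15 * z ^ 2 + # 25 * z ^ 3 + # 25 * z ^ 4
  χ = # 1 + # 10 * z + # 45 * z ^ 2 + # 100 * z ^ 3 + # 125 * z ^ 4
  ψ = # 1 + # 4 * z + # 9 * z ^ 2 + # 10 * z ^ 3 + # 5 * z ^ 4

  y≈z*E : y ≈ z * E
  y≈z*E = sym (trans (solve 3 (λ y f e → y :* f :* e := y :* (e :* f)) refl y F E) (trans (*-congˡ E-invPoch) (*-identityʳ y)))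

  E₅⁶-φ : E₅ ^ 6 ≈ E₂₅ * (E ^ 5 * φ)
  E₅⁶-φ = trans E₅⁶ (*-congˡ (trans (*-congˡ (+-cong (+-cong (+-cong (+-cong refl (*-congˡ (*-congˡ y≈z*E)))
      (*-congˡ (*-congˡ (^-congˡ 2 y≈z*E)))) (*-congˡ (*-congˡ (^-congˡ 3 y≈z*E)))) (*-congˡ (^-congˡ 4 y≈z*E))))
    (solve 2 (λ e z → e :* (e :^ 4 :+ κ 5 :* (e :^ 3 :* (z :* e)) :+ κ 15 :* (e :^ 2 :* (z :* e) :^ 2)
        :+ κ 25 :* (e :* (z :* e) :^ 3) :+ κ 25 :* (z :* e) :^ 4) := e :^ 5 :* φᵖ z) refl E z)))

  t≈z*φ : t ≈ z * φ
  t≈z*φ = begin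
    X * (E₅ ^ 6 * F ^ 6)
      ≈⟨ *-congˡ (*-congʳ E₅⁶-φ) ⟩
    X * (E₂₅ * (E ^ 5 * φ) * F ^ 6)
      ≈⟨ solve 5 (λ x k e f p → x :* (k :* (e :^ 5 :* p) :* f :^ 6) := x :* k :* f :* p :* (e :* f) :^ 5) refl X E₂₅ E F φ ⟩
    z * φ * (E * F) ^ 5
      ≈⟨ trans (*-congˡ (unit-^ E-invPoch 5)) (*-identityʳ _) ⟩
    z * φ ∎

  s*φ≈z⁵ : s * φ ≈ z ^ 5
  s*φ≈z⁵ = begin
    X ^ 5 * (E₂₅ ^ 6 * F₅ ^ 6) * φ
      ≈⟨ trans (sym (*-identityʳ _)) (*-congˡ (sym (unit-^ E-invPoch 5))) ⟩
    X ^ 5 * (E₂₅ ^ 6 * F₅ ^ 6) * φ * (E * F) ^ 5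
      ≈⟨ solve 6 (λ x k g p e f → x :^ 5 :* (k :^ 6 :* g :^ 6) :* p :* (e :* f) :^ 5 :=
           (x :* k :* f) :^ 5 :* (g :^ 6 :* (k :* (e :^ 5 :* p)))) refl X E₂₅ F₅ φ E F ⟩
    z ^ 5 * (F₅ ^ 6 * (E₂₅ * (E ^ 5 * φ)))
      ≈⟨ *-congˡ (trans (*-congˡ (sym E₅⁶-φ)) (trans (solve 2 (λ f e → f :^ 6 :* e :^ 6 := (e :* f) :^ 6) refl F₅ E₅) (unit-^ E₅-F₅ 6))) ⟩
    z ^ 5 * # 1
      ≈⟨ *-identityʳ _ ⟩
    z ^ 5 ∎

  F≈[0]1 : F ≈[ 0 ] # 1
  F≈[0]1 = ≈[]-trans (≈⇒≈[] 0 (sym (*-identityˡ F))) (≈[]-trans (⊗-cong[] (≈[]-sym E≈[0]1) (≈[]-refl {F})) (≈⇒≈[] 0 E-invPoch))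

  z≈[0]0 : z ≈[ 0 ] # 0
  z≈[0]0 = ≈[]-trans (⊗-cong[] y≈[0]0 (≈[]-refl {F})) (≈⇒≈[] 0 (solve 1 (λ f → κ 0 :* f := κ 0) refl F))

  t≈[0]0 : t ≈[ 0 ] # 0
  t≈[0]0 = constant-term (X⊗-zero _)

  quartic≈[0]1 : ∀ b c d e → # 1 + # b * z + # c * z ^ 2 + # d * z ^ 3 + # e * z ^ 4 ≈[ 0 ] # 1
  quartic≈[0]1 b c d e = ≈[]-trans
    (⊕-cong[] (⊕-cong[] (⊕-cong[] (⊕-cong[] ≈[]-refl (⊗-cong[] (≈[]-refl {# b}) z≈[0]0)) (⊗-cong[] (≈[]-refl {# c}) (^-cong[] 2 z≈[0]0)))
      (⊗-cong[] (≈[]-refl {# d}) (^-cong[] 3 z≈[0]0))) (⊗-cong[] (≈[]-refl {# e}) (^-cong[] 4 z≈[0]0)))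
    (≈⇒≈[] 0 (solve 4 (λ b c d e → κ 1 :+ b :* κ 0 :+ c :* κ 0 :^ 2 :+ d :* κ 0 :^ 3 :+ e :* κ 0 :^ 4 := κ 1) refl (# b) (# c) (# d) (# e)))

  -- A property closed under products, since `cancel` asks for a nonzero constant term while z and s
  -- start with powers of X.
  Cancellable : Series → Set
  Cancellable a = ∀ {f g} → a * f ≈ a * g → f ≈ g

  cancellable-* : ∀ {a b} → Cancellable a → Cancellable b → Cancellable (a * b)
  cancellable-* {a} {b} ca cb eq = cb (ca (trans (sym (*-assoc a b _)) (trans eq (*-assoc a b _))))

  cancellable-^ : ∀ {a} → Cancellable a → ∀ k → Cancellable (a ^ k)
  cancellable-^ ca zero    eq = trans (sym (*-identityˡ _)) (trans eq (*-identityˡ _))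
  cancellable-^ ca (suc k) = cancellable-* ca (cancellable-^ ca k)

  cancellable-1 : ∀ {a} → a ≈[ 0 ] # 1 → Cancellable a
  cancellable-1 eq {f} {g} = cancel f g (1≢0 eq)

  cancellable-X : Cancellable X
  cancellable-X {f} {g} = X-cancel f g

  cancellable-# : ∀ n → Cancellable (# suc n)
  cancellable-# n {f} {g} = cancel f g (nonzero (⟨⟩-zero-at (+ suc n)))

  cancellable-z : Cancellable z
  cancellable-z = cancellable-* (cancellable-* cancellable-X (cancellable-1 (V≈[0] (V≈[0] E≈[0]1)))) (cancellable-1 F≈[0]1)

  cancellable-s : Cancellable s
  cancellable-s = cancellable-* (cancellable-^ cancellable-X 5)
    (cancellable-* (cancellable-^ (cancellable-1 (V≈[0] (V≈[0] E≈[0]1))) 6) (cancellable-^ (cancellable-1 (V≈[0] F≈[0]1)) 6))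

  a b P₅ VP₅ : Series
  a = X₁
  b = V X₁
  P₅ = # 1 + # 6 * a - # 30 * b

  t-′ : t ′ P₅
  t-′ = ′-cong (begin
    # 1 + (# 6 * (# 5 * V (- X₁)) + # 6 * - - X₁)
      ≈⟨ +-congˡ (+-congʳ (*-congˡ (*-congˡ (V-neg X₁)))) ⟩
    # 1 + (# 6 * (# 5 * - V X₁) + # 6 * - - X₁)
      ≈⟨ solve 2 (λ a b → κ 1 :+ (κ 6 :* (κ 5 :* (:- b)) :+ κ 6 :* (:- :- a)) := κ 1 :+ κ 6 :* a :- κ 30 :* b) refl a b ⟩
    P₅ ∎)
    (′-* X-′ (′-* (′-^ E₅-′ 6) (′-^ F-′ 6)))
    where
    X-′ : X ′ # 1
    X-′ = logDerivative (trans θ-X (sym (*-identityˡ X)))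

  VP₅ = V P₅

  s-′ : s ′ # 5 * VP₅
  s-′ = logDerivative (trans (θ-cong (sym V-t)) (trans (derivative (′-V t-′)) (*-congˡ V-t)))

  -- The logarithmic derivative of z, left unsimplified because `P₅*ψ` eliminates it.
  λᶻ : Series
  λᶻ = # 1 + # 5 * V (# 5 * V (- X₁)) + - - X₁

  z-′ : z ′ λᶻ
  z-′ = ′-* (′-* (logDerivative (trans θ-X (sym (*-identityˡ X)))) (′-V E₅-′)) F-′

  θφ : θ φ ≈ λᶻ * (# 5 * z + # 30 * z ^ 2 + # 75 * z ^ 3 + # 100 * z ^ 4)
  θφ = trans (trans (θ-⊕ _ _) (+-cong (trans (θ-⊕ _ _) (+-cong (trans (θ-⊕ _ _) (+-cong (trans (θ-⊕ _ _)
      (+-cong (θ-⟨⟩ (+ 1)) (scaled 5 (derivative z-′)))) (scaled 15 (derivative (′-^ z-′ 2)))))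
      (scaled 25 (derivative (′-^ z-′ 3))))) (scaled 25 (derivative (′-^ z-′ 4)))))
    (solve 2 (λ l z → κ 0 :+ κ 5 :* (l :* z) :+ κ 15 :* (κ 2 :* l :* z :^ 2) :+ κ 25 :* (κ 3 :* l :* z :^ 3) :+ κ 25 :* (κ 4 :* l :* z :^ 4) :=
      l :* (κ 5 :* z :+ κ 30 :* z :^ 2 :+ κ 75 :* z :^ 3 :+ κ 100 :* z :^ 4)) refl λᶻ z)
    where
    scaled : ∀ n {f g} → θ f ≈ g → θ (# n * f) ≈ # n * g
    scaled n eq = trans (θ-scalar _ (θ-⟨⟩ (+ n))) (*-congˡ eq)

  P₅*φ : P₅ * φ ≈ λᶻ * χ
  P₅*φ = cancellable-z (begin
    z * (P₅ * φ)
      ≈⟨ trans (solve 3 (λ z p f → z :* (p :* f) := p :* (z :* f)) refl z P₅ φ) (*-congˡ (sym t≈z*φ)) ⟩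
    P₅ * t
      ≈⟨ trans (sym (derivative t-′)) (trans (θ-cong t≈z*φ) (trans (θ-⊗ z φ) (+-cong (*-congʳ (derivative z-′)) (*-congˡ θφ)))) ⟩
    λᶻ * z * φ + z * (λᶻ * (# 5 * z + # 30 * z ^ 2 + # 75 * z ^ 3 + # 100 * z ^ 4))
      ≈⟨ solve 2 (λ l z → l :* z :* φᵖ z :+ z :* (l :* (κ 5 :* z :+ κ 30 :* z :^ 2 :+ κ 75 :* z :^ 3 :+ κ 100 :* z :^ 4)) :=
           z :* (l :* χᵖ z)) refl λᶻ z ⟩
    z * (λᶻ * χ) ∎)

  VP₅*φ : VP₅ * φ ≈ λᶻ * ψ
  VP₅*φ = cancellable-# 4 (cancellable-s (begin
    s * (# 5 * (VP₅ * φ))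
      ≈⟨ solve 4 (λ s p f r → s :* (κ 5 :* (p :* f)) := (κ 5 :* p :* s :* f :+ s :* r) :- s :* r) refl s VP₅ φ (θ φ) ⟩
    # 5 * VP₅ * s * φ + s * θ φ - s * θ φ
      ≈⟨ +-congʳ (trans (+-congʳ (*-congʳ (sym (derivative s-′)))) (trans (sym (θ-⊗ s φ)) (trans (θ-cong s*φ≈z⁵)
           (trans (derivative (′-^ z-′ 5)) (*-congˡ (sym s*φ≈z⁵)))))) ⟩
    # 5 * λᶻ * (s * φ) - s * θ φ
      ≈⟨ +-congˡ (-‿cong (*-congˡ θφ)) ⟩
    # 5 * λᶻ * (s * φ) - s * (λᶻ * (# 5 * z + # 30 * z ^ 2 + # 75 * z ^ 3 + # 100 * z ^ 4))
      ≈⟨ solve 3 (λ l s z → κ 5 :* l :* (s :* φᵖ z) :- s :* (l :* (κ 5 :* z :+ κ 30 :* z :^ 2 :+ κ 75 :* z :^ 3 :+ κ 100 :* z :^ 4)) :=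
           s :* (κ 5 :* (l :* ψᵖ z))) refl λᶻ s z ⟩
    s * (# 5 * (λᶻ * ψ)) ∎))

  P₅*ψ : P₅ * ψ ≈ VP₅ * χ
  P₅*ψ = cancellable-1 (quartic≈[0]1 5 15 25 25) (begin
    φ * (P₅ * ψ)        ≈⟨ solve 3 (λ f p q → f :* (p :* q) := p :* f :* q) refl φ P₅ ψ ⟩
    P₅ * φ * ψ          ≈⟨ *-congʳ P₅*φ ⟩
    λᶻ * χ * ψ          ≈⟨ solve 3 (λ l c p → l :* c :* p := l :* p :* c) refl λᶻ χ ψ ⟩
    λᶻ * ψ * χ          ≈⟨ *-congʳ VP₅*φ ⟨
    VP₅ * φ * χ         ≈⟨ solve 3 (λ f p c → p :* f :* c := f :* (p :* c)) refl φ VP₅ χ ⟩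
    φ * (VP₅ * χ)       ∎)

  N : Series
  N = E ^ 10 * F₅ ^ 2

  V-N : V N ≈ N * φ ^ 2
  V-N = begin
    V N
      ≈⟨ trans (V-* _ _) (*-cong (V-^ E 10) (V-^ F₅ 2)) ⟩
    E₅ ^ 10 * F₂₅ ^ 2
      ≈⟨ trans (sym (*-identityʳ _)) (*-congˡ (sym (unit-^ E₅-F₅ 2))) ⟩
    E₅ ^ 10 * F₂₅ ^ 2 * (E₅ * F₅) ^ 2
      ≈⟨ solve 3 (λ e k f → e :^ 10 :* k :^ 2 :* (e :* f) :^ 2 := (e :^ 6) :^ 2 :* (k :^ 2 :* f :^ 2)) refl E₅ F₂₅ F₅ ⟩
    (E₅ ^ 6) ^ 2 * (F₂₅ ^ 2 * F₅ ^ 2)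
      ≈⟨ *-congʳ (^-congˡ 2 E₅⁶-φ) ⟩
    (E₂₅ * (E ^ 5 * φ)) ^ 2 * (F₂₅ ^ 2 * F₅ ^ 2)
      ≈⟨ solve 5 (λ k e p l f → (k :* (e :^ 5 :* p)) :^ 2 :* (l :^ 2 :* f :^ 2) := (e :^ 10 :* f :^ 2 :* p :^ 2) :* (k :* l) :^ 2) refl E₂₅ E φ F₂₅ F₅ ⟩
    N * φ ^ 2 * (E₂₅ * F₂₅) ^ 2
      ≈⟨ trans (*-congˡ (unit-^ E₂₅-F₂₅ 2)) (*-identityʳ _) ⟩
    N * φ ^ 2 ∎

  quadratic : ℕ → ℕ → Series → Series
  quadratic b c u = # 1 + # b * u + # c * u ^ 2

  quadratic-cong : ∀ b c {u v} → u ≈ v → quadratic b c u ≈ quadratic b c v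
  quadratic-cong b c eq = +-cong (+-congˡ (*-congˡ eq)) (*-congˡ (^-congˡ 2 eq))

  V-N-quadratic : ∀ b c → V (N * quadratic b c t) ≈ N * (φ ^ 2 + # b * (z ^ 5 * φ) + # c * (z ^ 5) ^ 2)
  V-N-quadratic b c = begin
    V (N * quadratic b c t)
      ≈⟨ trans (V-* _ _) (*-cong V-N (trans (V-+ _ _) (+-cong (trans (V-+ _ _) (+-cong (V-# 1) (trans (V-#* b t) (*-congˡ V-t))))
           (trans (V-#* c _) (*-congˡ (trans (V-^ t 2) (^-congˡ 2 V-t))))))) ⟩
    N * φ ^ 2 * quadratic b c s
      ≈⟨ solve 5 (λ n f s b c → n :* f :^ 2 :* (κ 1 :+ b :* s :+ c :* s :^ 2) :=
           n :* (f :^ 2 :+ b :* (s :* f :* f) :+ c :* (s :* f) :^ 2)) refl N φ s (# b) (# c) ⟩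
    N * (φ ^ 2 + # b * (s * φ * φ) + # c * (s * φ) ^ 2)
      ≈⟨ *-congˡ (+-cong (+-congˡ (*-congˡ (*-congʳ s*φ≈z⁵))) (*-congˡ (^-congˡ 2 s*φ≈z⁵))) ⟩
    N * (φ ^ 2 + # b * (z ^ 5 * φ) + # c * (z ^ 5) ^ 2) ∎

  M : Series
  M = N * quadratic 22 125 t

  ρᵖ : ∀ {n} → Polynomial n → Polynomial n
  ρᵖ z = κ 1 :+ κ 2 :* z :+ κ 5 :* z :^ 2

  -- Under t = z φ the quadratic 1 + 22 t + 125 t² factors as ρ χ², and its dilate, cleared of φ, as
  -- ρ ψ² with the same ρ = 1 + 2 z + 5 z². Thus M satisfies the dilation equation that `P₅*ψ` gives
  -- for P₅².
  M*ψ² : M * ψ ^ 2 ≈ V M * χ ^ 2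
  M*ψ² = begin
    N * quadratic 22 125 t * ψ ^ 2
      ≈⟨ *-congʳ (*-congˡ (quadratic-cong 22 125 t≈z*φ)) ⟩
    N * quadratic 22 125 (z * φ) * ψ ^ 2
      ≈⟨ *-congʳ (*-congˡ (solve 1 (λ z → κ 1 :+ κ 22 :* (z :* φᵖ z) :+ κ 125 :* (z :* φᵖ z) :^ 2 := ρᵖ z :* χᵖ z :^ 2) refl z)) ⟩
    N * (k * χ ^ 2) * ψ ^ 2
      ≈⟨ solve 4 (λ n k c p → n :* (k :* c :^ 2) :* p :^ 2 := n :* (k :* p :^ 2) :* c :^ 2) refl N k χ ψ ⟩
    N * (k * ψ ^ 2) * χ ^ 2
      ≈⟨ *-congʳ (*-congˡ (solve 1 (λ z → ρᵖ z :* ψᵖ z :^ 2 := φᵖ z :^ 2 :+ κ 22 :* (z :^ 5 :* φᵖ z) :+ κ 125 :* (z :^ 5) :^ 2) refl z)) ⟩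
    N * (φ ^ 2 + # 22 * (z ^ 5 * φ) + # 125 * (z ^ 5) ^ 2) * χ ^ 2
      ≈⟨ *-congʳ (V-N-quadratic 22 125) ⟨
    V M * χ ^ 2 ∎
    where k = # 1 + # 2 * z + # 5 * z ^ 2

  N≈[0]1 : N ≈[ 0 ] # 1
  N≈[0]1 = ≈[]-trans (⊗-cong[] (^-cong[] 10 E≈[0]1) (^-cong[] 2 (V≈[0] F≈[0]1))) (≈⇒≈[] 0 (solve 0 (κ 1 :^ 10 :* κ 1 :^ 2 := κ 1) refl))

  N-quadratic≈[0]1 : ∀ b c → N * quadratic b c t ≈[ 0 ] # 1
  N-quadratic≈[0]1 b c = ≈[]-trans (⊗-cong[] N≈[0]1 (⊕-cong[] (⊕-cong[] (≈[]-refl {# 1}) (⊗-cong[] (≈[]-refl {# b}) t≈[0]0))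
    (⊗-cong[] (≈[]-refl {# c}) (^-cong[] 2 t≈[0]0))))
    (≈⇒≈[] 0 (solve 2 (λ b c → κ 1 :* (κ 1 :+ b :* κ 0 :+ c :* κ 0 :^ 2) := κ 1) refl (# b) (# c)))

  P₅≈[0]1 : P₅ ≈[ 0 ] # 1
  P₅≈[0]1 = ≈[]-trans (⊕-cong[] (⊕-cong[] (≈[]-refl {# 1}) (⊗-cong[] (≈[]-refl {# 6}) X₁-zero))
    (-‿cong[] (⊗-cong[] (≈[]-refl {# 30}) (V≈[0] X₁-zero))))
    (≈⇒≈[] 0 (solve 0 (κ 1 :+ κ 6 :* κ 0 :- κ 30 :* κ 0 := κ 1) refl))

  difference-zero : ∀ {f g} → f ≈[ 0 ] # 1 → g ≈[ 0 ] # 1 → (f - g) 0 ≡ + 0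
  difference-zero f≈1 g≈1 = constant-term⁻¹ (≈[]-trans (⊕-cong[] f≈1 (-‿cong[] g≈1)) (≈⇒≈[] 0 (solve 0 (κ 1 :- κ 1 := κ 0) refl)))

  P₅² : P₅ ^ 2 ≈ M
  P₅² = difference (dilation-unique {ψ ^ 2} {χ ^ 2}
    (constant-term⁻¹ (≈[]-trans (^-cong[] 2 (quartic≈[0]1 4 9 10 5)) (≈⇒≈[] 0 (one-^ 2))))
    (difference-zero (≈[]-trans (^-cong[] 2 P₅≈[0]1) (≈⇒≈[] 0 (one-^ 2))) (N-quadratic≈[0]1 22 125))
    (begin
      ψ ^ 2 * (P₅ ^ 2 - M)
        ≈⟨ solve 3 (λ q p m → q :^ 2 :* (p :^ 2 :- m) := (p :* q) :^ 2 :- m :* q :^ 2) refl ψ P₅ M ⟩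
      (P₅ * ψ) ^ 2 - M * ψ ^ 2
        ≈⟨ +-cong (^-congˡ 2 P₅*ψ) (-‿cong M*ψ²) ⟩
      (VP₅ * χ) ^ 2 - V M * χ ^ 2
        ≈⟨ solve 3 (λ c p m → (p :* c) :^ 2 :- m :* c :^ 2 := c :^ 2 :* (p :^ 2 :- m)) refl χ VP₅ (V M) ⟩
      χ ^ 2 * (VP₅ ^ 2 - V M)
        ≈⟨ *-congˡ (trans (V-+ _ _) (+-cong (V-^ P₅ 2) (V-neg M))) ⟨
      χ ^ 2 * V (P₅ ^ 2 - M) ∎))

  N-′ : N ′ # 10 * b - # 10 * a
  N-′ = ′-cong (begin
    # 10 * - X₁ + # 2 * (# 5 * V (- - X₁))
      ≈⟨ +-congˡ (*-congˡ (*-congˡ (V-cong (solve 1 (λ x → :- :- x := x) refl X₁)))) ⟩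
    # 10 * - X₁ + # 2 * (# 5 * V X₁)
      ≈⟨ solve 2 (λ a b → κ 10 :* (:- a) :+ κ 2 :* (κ 5 :* b) := κ 10 :* b :- κ 10 :* a) refl a b ⟩
    # 10 * b - # 10 * a ∎)
    (′-* (′-^ E-′ 10) (′-^ (′-V F-′) 2))

  -- Differentiating P₅² = M gives P₅ times this equation: M and P₅² share the factor from N, and θ
  -- t = P₅ t supplies the other P₅.
  θP₅ : # 2 * θ P₅ ≈ (# 10 * b - # 10 * a) * P₅ + N * (# 22 * t + # 250 * t ^ 2)
  θP₅ = cancellable-1 P₅≈[0]1 (begin
    P₅ * (# 2 * θ P₅)
      ≈⟨ solve 2 (λ p q → p :* (κ 2 :* q) := κ 2 :* (p :* κ 1) :* q) refl P₅ (θ P₅) ⟩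
    # 2 * P₅ ^ 1 * θ P₅
      ≈⟨ trans (sym (θ-^ P₅ 1)) (trans (θ-cong P₅²) (trans (θ-⊗ N _) (+-cong (*-congʳ (derivative N-′)) (*-congˡ θquadratic)))) ⟩
    ν * N * quadratic 22 125 t + N * (P₅ * (# 22 * t + # 250 * t ^ 2))
      ≈⟨ +-congʳ (trans (*-assoc ν N _) (*-congˡ (sym P₅²))) ⟩
    ν * P₅ ^ 2 + N * (P₅ * (# 22 * t + # 250 * t ^ 2))
      ≈⟨ solve 4 (λ v p n r → v :* p :^ 2 :+ n :* (p :* r) := p :* (v :* p :+ n :* r)) refl ν P₅ N _ ⟩
    P₅ * (ν * P₅ + N * (# 22 * t + # 250 * t ^ 2)) ∎)
    where
    ν = # 10 * b - # 10 * a
    θquadratic : θ (quadratic 22 125 t) ≈ P₅ * (# 22 * t + # 250 * t ^ 2)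
    θquadratic = trans (trans (θ-⊕ _ _) (+-cong (trans (θ-⊕ _ _) (+-cong (θ-⟨⟩ (+ 1)) (trans (θ-scalar _ (θ-⟨⟩ (+ 22))) (*-congˡ (derivative t-′)))))
      (trans (θ-scalar _ (θ-⟨⟩ (+ 125))) (*-congˡ (derivative (′-^ t-′ 2))))))
      (solve 2 (λ p t → κ 0 :+ κ 22 :* (p :* t) :+ κ 125 :* (κ 2 :* p :* t :^ 2) := p :* (κ 22 :* t :+ κ 250 :* t :^ 2)) refl P₅ t)

  C : Series
  C = N * quadratic 250 3125 t

  -- Cleared of φ, the dilated quadratic φ² + 250 z⁵ φ + 3125 z¹⁰ is again a polynomial in z φ = t,
  -- so no z survives.
  V-C : V C ≈ N * quadratic 10 5 t
  V-C = trans (V-N-quadratic 250 3125) (*-congˡ (trans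
    (solve 1 (λ z → φᵖ z :^ 2 :+ κ 250 :* (z :^ 5 :* φᵖ z) :+ κ 3125 :* (z :^ 5) :^ 2 :=
      κ 1 :+ κ 10 :* (z :* φᵖ z) :+ κ 5 :* (z :* φᵖ z) :^ 2) refl z)
    (sym (quadratic-cong 10 5 t≈z*φ))))

  E₄-a : E₄ ≈ (# 1 - # 24 * a) ^ 2 + # 288 * θ a
  E₄-a = trans E₄-E₂ (trans (+-congˡ (-‿cong (*-congˡ (trans (θ-⊕ _ _) (+-cong (θ-⟨⟩ (+ 1)) (trans (θ-⊝ _) (-‿cong (θ-scalar a (θ-⟨⟩ (+ 24))))))))))
    (solve 2 (λ a t → (κ 1 :- κ 24 :* a) :* (κ 1 :- κ 24 :* a) :- κ 12 :* (κ 0 :- κ 24 :* t) := (κ 1 :- κ 24 :* a) :^ 2 :+ κ 288 :* t) refl a (θ a)))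

  V-E₄ : # 25 * V E₄ ≈ # 25 * (# 1 - # 24 * b) ^ 2 + # 1440 * θ b
  V-E₄ = begin
    # 25 * V E₄
      ≈⟨ *-congˡ (trans (V-cong E₄-a) (trans (V-+ _ _) (+-cong (trans (V-^ _ 2) (^-congˡ 2 (trans (V-+ _ _)
           (+-cong (V-# 1) (trans (V-neg _) (-‿cong (V-#* 24 a))))))) (V-#* 288 (θ a))))) ⟩
    # 25 * ((# 1 - # 24 * b) ^ 2 + # 288 * V (θ a))
      ≈⟨ solve 2 (λ b t → κ 25 :* ((κ 1 :- κ 24 :* b) :^ 2 :+ κ 288 :* t) := κ 25 :* (κ 1 :- κ 24 :* b) :^ 2 :+ κ 1440 :* (κ 5 :* t)) refl b (V (θ a)) ⟩
    # 25 * (# 1 - # 24 * b) ^ 2 + # 1440 * (# 5 * V (θ a))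
      ≈⟨ +-congˡ (*-congˡ (sym (θ-dilate 5 a))) ⟩
    # 25 * (# 1 - # 24 * b) ^ 2 + # 1440 * θ b ∎

  -- The weight 25 makes θ a and θ b occur only through θ P₅; the remaining quadratic terms in a and
  -- b then combine to 24 P₅².
  E₄-difference : # 25 * V E₄ - E₄ ≈ # 25 * V C - C
  E₄-difference = begin
    # 25 * V E₄ - E₄
      ≈⟨ +-cong V-E₄ (-‿cong E₄-a) ⟩
    # 25 * (# 1 - # 24 * b) ^ 2 + # 1440 * θ b - ((# 1 - # 24 * a) ^ 2 + # 288 * θ a)
      ≈⟨ solve 4 (λ a b u v → κ 25 :* (κ 1 :- κ 24 :* b) :^ 2 :+ κ 1440 :* v :- ((κ 1 :- κ 24 :* a) :^ 2 :+ κ 288 :* u) :=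
           κ 25 :* (κ 1 :- κ 24 :* b) :^ 2 :- (κ 1 :- κ 24 :* a) :^ 2 :- κ 24 :* (κ 2 :* (κ 0 :+ κ 6 :* u :- κ 30 :* v))) refl a b (θ a) (θ b) ⟩
    # 25 * (# 1 - # 24 * b) ^ 2 - (# 1 - # 24 * a) ^ 2 - # 24 * (# 2 * (# 0 + # 6 * θ a - # 30 * θ b))
      ≈⟨ +-congˡ (-‿cong (*-congˡ (trans (*-congˡ (sym θP)) θP₅))) ⟩
    # 25 * (# 1 - # 24 * b) ^ 2 - (# 1 - # 24 * a) ^ 2 - # 24 * ((# 10 * b - # 10 * a) * P₅ + N * (# 22 * t + # 250 * t ^ 2))
      ≈⟨ solve 4 (λ a b n t → let p = κ 1 :+ κ 6 :* a :- κ 30 :* b in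
           κ 25 :* (κ 1 :- κ 24 :* b) :^ 2 :- (κ 1 :- κ 24 :* a) :^ 2 :- κ 24 :* ((κ 10 :* b :- κ 10 :* a) :* p :+ n :* (κ 22 :* t :+ κ 250 :* t :^ 2)) :=
           κ 24 :* (p :^ 2 :- n :* (κ 22 :* t :+ κ 250 :* t :^ 2))) refl a b N t ⟩
    # 24 * (P₅ ^ 2 - N * (# 22 * t + # 250 * t ^ 2))
      ≈⟨ *-congˡ (+-congʳ P₅²) ⟩
    # 24 * (M - N * (# 22 * t + # 250 * t ^ 2))
      ≈⟨ solve 2 (λ n t → κ 24 :* (n :* (κ 1 :+ κ 22 :* t :+ κ 125 :* t :^ 2) :- n :* (κ 22 :* t :+ κ 250 :* t :^ 2)) :=
           κ 25 :* (n :* (κ 1 :+ κ 10 :* t :+ κ 5 :* t :^ 2)) :- n :* (κ 1 :+ κ 250 :* t :+ κ 3125 :* t :^ 2)) refl N t ⟩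
    # 25 * (N * quadratic 10 5 t) - C
      ≈⟨ +-congʳ (*-congˡ (sym V-C)) ⟩
    # 25 * V C - C ∎
    where
    θP : θ P₅ ≈ # 0 + # 6 * θ a - # 30 * θ b
    θP = trans (θ-⊕ _ _) (+-cong (trans (θ-⊕ _ _) (+-cong (θ-⟨⟩ (+ 1)) (θ-scalar a (θ-⟨⟩ (+ 6)))))
      (trans (θ-⊝ _) (-‿cong (θ-scalar b (θ-⟨⟩ (+ 30))))))

  -- `E₄-difference` makes E₄ - C equal to 25 times its own dilate, and its constant term is 0.
  E₄-eta : E₄ ≈ C
  E₄-eta = difference (dilation-unique {# 1} {# 25} (⟨⟩-zero-at (+ 1))
    (difference-zero (constant-term ≡.refl) (N-quadratic≈[0]1 250 3125))
    (begin
      # 1 * (E₄ - C)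
        ≈⟨ solve 4 (λ e c v w → κ 1 :* (e :- c) := κ 25 :* v :- c :- (κ 25 :* v :- e)) refl E₄ C (V E₄) (V C) ⟩
      # 25 * V E₄ - C - (# 25 * V E₄ - E₄)
        ≈⟨ +-congˡ (-‿cong E₄-difference) ⟩
      # 25 * V E₄ - C - (# 25 * V C - C)
        ≈⟨ solve 3 (λ v c w → κ 25 :* v :- c :- (κ 25 :* w :- c) := κ 25 :* (v :- w)) refl (V E₄) C (V C) ⟩
      # 25 * (V E₄ - V C)
        ≈⟨ *-congˡ (trans (V-+ _ _) (+-congˡ (V-neg C))) ⟨
      # 25 * V (E₄ - C) ∎))

-- The action of U on multiples of ℤ[Θ] and the factor 5 gained at each step.

module Iteration where
  open PowerSeries
  open SeriesAlgebra
  open Operators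
  open EulerProduct
  open ResidueClasses
  open CubeOfE
  open DivisorSums
  open ModularEquation
  open LevelFive
  open import Data.Integer as ℤ using (ℤ; +_)
  open import Data.Nat as ℕ using (ℕ; zero; suc)
  import Data.Nat.Properties as ℕₚ
  import Relation.Binary.PropositionalEquality as ≡
  open import Relation.Binary.Reasoning.Setoid setoid

  k : Series
  k = X * E₅ ^ 4

  V-k : V k ≈ X * y ^ 4
  V-k = trans (V-* _ _) (trans (*-cong (dilate-X 5) (V-^ E₅ 4)) (solve 2 (λ x e → x :^ 5 :* e :^ 4 := x :* (x :* e) :^ 4) refl X E₂₅))

  X-supported : Supported 1 X
  X-supported = supported-≈ (*-identityʳ X) (supported-X^ 1 0 ≡.refl)

  private
    a′ = A-supported
    b′ = B-supported
    c′ = y-supported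
    x′ = X-supported

  U-residue-0 : ∀ {f f₀ f₁ f₂ f₃ f₄} → f ≈ V f₀ + f₁ + f₂ + f₃ + f₄ →
    Supported 1 f₁ → Supported 2 f₂ → Supported 3 f₃ → Supported 4 f₄ → U f ≈ f₀
  U-residue-0 {f₀ = f₀} eq s₁ s₂ s₃ s₄ = trans (U-cong eq) (trans (U-drop {4} _ (λ ()) s₄) (trans (U-drop {3} _ (λ ()) s₃)
    (trans (U-drop {2} _ (λ ()) s₂) (trans (U-drop {1} _ (λ ()) s₁) (U-V f₀)))))

  V-scaled-k : ∀ c → V (⟨ c ⟩ * k) ≈ ⟨ c ⟩ * (X * y ^ 4)
  V-scaled-k c = trans (V-* _ _) (*-cong (dilate-⟨⟩ 5 c) V-k)

  U-Xy⁴ : U (X * y ^ 4) ≈ k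
  U-Xy⁴ = trans (U-cong (sym V-k)) (U-V k)

  U-XEy³ : U (X * (E * y ^ 3)) ≈ ⟨ ℤ.- + 1 ⟩ * k
  U-XEy³ = U-residue-0 {f₂ = # 0} {f₃ = # 0} (begin
    X * (E * y ^ 3)
      ≈⟨ *-congˡ (*-congʳ E-dissection) ⟩
    X * ((A + B - y) * y ^ 3)
      ≈⟨ solve 4 (λ x A B y → x :* ((A :+ B :- y) :* y :^ 3) :=
           con (ℤ.- + 1) :* (x :* y :^ 4) :+ x :* (B :* y :^ 3) :+ κ 0 :+ κ 0 :+ x :* (A :* y :^ 3)) refl X A B y ⟩
    ⟨ ℤ.- + 1 ⟩ * (X * y ^ 4) + X * (B * y ^ 3) + # 0 + # 0 + X * (A * y ^ 3)
      ≈⟨ +-congʳ (+-congʳ (+-congʳ (+-congʳ (V-scaled-k _)))) ⟨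
    V (⟨ ℤ.- + 1 ⟩ * k) + X * (B * y ^ 3) + # 0 + # 0 + X * (A * y ^ 3) ∎)
    (supported-% ≡.refl (x′ · (b′ · c′ ↑ 3))) (supported (λ n _ → ⟨0⟩-at n)) (supported (λ n _ → ⟨0⟩-at n)) (x′ · (a′ · c′ ↑ 3))

  -- After E = A + B - y and A B = -y², the exponents divisible by 5 form a multiple of X y⁴ =
  -- `V k`. The next two values follow the same pattern.
  U-XE²y² : U (X * (E ^ 2 * y ^ 2)) ≈ ⟨ ℤ.- + 1 ⟩ * k
  U-XE²y² = U-residue-0 (begin
    X * (E ^ 2 * y ^ 2)
      ≈⟨ *-congˡ (*-congʳ (^-congˡ 2 E-dissection)) ⟩
    X * ((A + B - y) ^ 2 * y ^ 2)
      ≈⟨ trans (solve 4 (λ x A B y → x :* ((A :+ B :- y) :^ 2 :* y :^ 2) :=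
           con (ℤ.- + 1) :* (x :* y :^ 4) :+ x :* (:- (κ 2 :* (B :* y)) :* y :^ 2) :+ x :* (B :^ 2 :* y :^ 2)
             :+ x :* (A :^ 2 :* y :^ 2) :+ x :* (:- (κ 2 :* (A :* y)) :* y :^ 2)
             :+ (A :* B :+ y :* y) :* (κ 2 :* x :* y :^ 2)) refl X A B y) (drop-AB+y² _ _) ⟩
    ⟨ ℤ.- + 1 ⟩ * (X * y ^ 4) + X * (- (# 2 * (B * y)) * y ^ 2) + X * (B ^ 2 * y ^ 2)
      + X * (A ^ 2 * y ^ 2) + X * (- (# 2 * (A * y)) * y ^ 2)
      ≈⟨ +-congʳ (+-congʳ (+-congʳ (+-congʳ (V-scaled-k _)))) ⟨
    V (⟨ ℤ.- + 1 ⟩ * k) + X * (- (# 2 * (B * y)) * y ^ 2) + X * (B ^ 2 * y ^ 2)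
      + X * (A ^ 2 * y ^ 2) + X * (- (# 2 * (A * y)) * y ^ 2) ∎)
    (supported-% ≡.refl (x′ · (supported-neg (supported-#* 2 (b′ · c′)) · c′ ↑ 2))) (supported-% ≡.refl (x′ · (b′ ↑ 2 · c′ ↑ 2)))
    (x′ · (a′ ↑ 2 · c′ ↑ 2)) (x′ · (supported-neg (supported-#* 2 (a′ · c′)) · c′ ↑ 2))

  U-XE³y : U (X * (E ^ 3 * y)) ≈ # 5 * k
  U-XE³y = U-residue-0 {f₁ = # 0} {f₄ = # 0} (begin
    X * (E ^ 3 * y)
      ≈⟨ *-congˡ (*-congʳ (^-congˡ 3 E-dissection)) ⟩
    X * ((A + B - y) ^ 3 * y)
      ≈⟨ trans (solve 4 (λ x A B y → x :* ((A :+ B :- y) :^ 3 :* y) :=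
           κ 5 :* (x :* y :^ 4) :+ κ 0 :+ x :* ((A :^ 3 :- κ 3 :* (B :^ 2 :* y)) :* y)
             :+ x :* ((B :^ 3 :- κ 3 :* (A :^ 2 :* y)) :* y) :+ κ 0
             :+ (A :* B :+ y :* y) :* ((κ 3 :* (A :+ B) :- κ 6 :* y) :* (x :* y))) refl X A B y) (drop-AB+y² _ _) ⟩
    # 5 * (X * y ^ 4) + # 0 + X * ((A ^ 3 - # 3 * (B ^ 2 * y)) * y) + X * ((B ^ 3 - # 3 * (A ^ 2 * y)) * y) + # 0
      ≈⟨ +-congʳ (+-congʳ (+-congʳ (+-congʳ (V-scaled-k _)))) ⟨
    V (# 5 * k) + # 0 + X * ((A ^ 3 - # 3 * (B ^ 2 * y)) * y) + X * ((B ^ 3 - # 3 * (A ^ 2 * y)) * y) + # 0 ∎)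
    (supported (λ n _ → ⟨0⟩-at n))
    (x′ · (supported-+ {0} (a′ ↑ 3) (supported-% ≡.refl (supported-neg (supported-#* 3 (b′ ↑ 2 · c′)))) · c′))
    (x′ · (supported-+ {1} (supported-% ≡.refl (b′ ↑ 3)) (supported-neg (supported-#* 3 (a′ ↑ 2 · c′))) · c′))
    (supported (λ n _ → ⟨0⟩-at n))

  U-XE⁴ : U (X * E ^ 4) ≈ ⟨ ℤ.- + 5 ⟩ * k
  U-XE⁴ = U-residue-0 (begin
    X * E ^ 4
      ≈⟨ *-congˡ (^-congˡ 4 E-dissection) ⟩
    X * (A + B - y) ^ 4
      ≈⟨ trans (solve 4 (λ x A B y → let T = A :^ 2 :- κ 2 :* (A :* y) :- y :^ 2 :- κ 2 :* (B :* y) :+ B :^ 2 ; δ = A :* B :+ y :* y in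
           x :* (A :+ B :- y) :^ 4 :=
           con (ℤ.- + 5) :* (x :* y :^ 4) :+ x :* (A :^ 4 :+ κ 8 :* (B :* y :^ 3)) :+ x :* (κ 2 :* (B :^ 2 :* y :^ 2) :- κ 4 :* (A :^ 3 :* y))
             :+ x :* (κ 2 :* (A :^ 2 :* y :^ 2) :- κ 4 :* (B :^ 3 :* y)) :+ x :* (κ 8 :* (A :* y :^ 3) :+ B :^ 4)
             :+ δ :* (x :* (κ 4 :* T :+ κ 4 :* δ :+ κ 2 :* (A :* B :+ κ 3 :* y :^ 2) :- κ 4 :* (y :* (A :+ B))))) refl X A B y) (drop-AB+y² _ _) ⟩
    ⟨ ℤ.- + 5 ⟩ * (X * y ^ 4) + X * (A ^ 4 + # 8 * (B * y ^ 3)) + X * (# 2 * (B ^ 2 * y ^ 2) - # 4 * (A ^ 3 * y))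
      + X * (# 2 * (A ^ 2 * y ^ 2) - # 4 * (B ^ 3 * y)) + X * (# 8 * (A * y ^ 3) + B ^ 4)
      ≈⟨ +-congʳ (+-congʳ (+-congʳ (+-congʳ (V-scaled-k _)))) ⟨
    V (⟨ ℤ.- + 5 ⟩ * k) + X * (A ^ 4 + # 8 * (B * y ^ 3)) + X * (# 2 * (B ^ 2 * y ^ 2) - # 4 * (A ^ 3 * y))
      + X * (# 2 * (A ^ 2 * y ^ 2) - # 4 * (B ^ 3 * y)) + X * (# 8 * (A * y ^ 3) + B ^ 4) ∎)
    (x′ · supported-+ {0} (a′ ↑ 4) (supported-% ≡.refl (supported-#* 8 (b′ · c′ ↑ 3))))
    (x′ · supported-+ {1} (supported-% ≡.refl (supported-#* 2 (b′ ↑ 2 · c′ ↑ 2))) (supported-neg (supported-#* 4 (a′ ↑ 3 · c′))))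
    (x′ · supported-+ {2} (supported-#* 2 (a′ ↑ 2 · c′ ↑ 2)) (supported-% ≡.refl (supported-neg (supported-#* 4 (b′ ↑ 3 · c′)))))
    (x′ · supported-+ {3} (supported-#* 8 (a′ · c′ ↑ 3)) (supported-% ≡.refl (b′ ↑ 4)))

  -- Of the five components of w only the last, 5 y⁴, meets X in exponents divisible by 5.
  U-Xw : U (X * w) ≈ # 5 * k
  U-Xw = U-residue-0 (begin
    X * w
      ≈⟨ *-congˡ w-dissection ⟩
    X * (w₀ + w₁ + w₂ + w₃ + w₄)
      ≈⟨ solve 6 (λ x p q r s y → x :* (p :+ q :+ r :+ s :+ κ 5 :* y) := κ 5 :* (x :* y) :+ x :* p :+ x :* q :+ x :* r :+ x :* s) refl X w₀ w₁ w₂ w₃ (y ^ 4) ⟩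
    # 5 * (X * y ^ 4) + X * w₀ + X * w₁ + X * w₂ + X * w₃
      ≈⟨ +-congʳ (+-congʳ (+-congʳ (+-congʳ (V-scaled-k _)))) ⟨
    V (# 5 * k) + X * w₀ + X * w₁ + X * w₂ + X * w₃ ∎)
    (x′ · w₀-supported) (x′ · w₁-supported) (x′ · w₂-supported) (x′ · w₃-supported)

  -- Multiplying by V(E⁶) = E₅⁶ trades the 1/E in z for w by the modular equation: E₅⁶ z = V(E₅²) X
  -- w, whose U is known.
  U-z : U z ≈ # 5 * t
  U-z = cancellable-^ (cancellable-1 E≈[0]1) 6 (begin
    E ^ 6 * U z
      ≈⟨ trans (sym (U-V⊗ (E ^ 6) z)) (U-cong (*-congʳ (trans (V-^ E 6) E₅⁶))) ⟩
    U (E₂₅ * (E * w) * z)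
      ≈⟨ U-cong (trans (solve 5 (λ k e w x f → k :* (e :* w) :* (x :* k :* f) := k :^ 2 :* (x :* w) :* (e :* f)) refl E₂₅ E w X F)
           (trans (*-congˡ E-invPoch) (trans (*-identityʳ _) (*-congʳ (sym (V-^ E₅ 2)))))) ⟩
    U (V (E₅ ^ 2) * (X * w))
      ≈⟨ trans (U-V⊗ _ _) (*-congˡ U-Xw) ⟩
    E₅ ^ 2 * (# 5 * k)
      ≈⟨ trans (sym (*-identityʳ _)) (*-congˡ (sym (unit-^ E-invPoch 6))) ⟩
    E₅ ^ 2 * (# 5 * k) * (E * F) ^ 6
      ≈⟨ solve 4 (λ d x e f → d :^ 2 :* (κ 5 :* (x :* d :^ 4)) :* (e :* f) :^ 6 := e :^ 6 :* (κ 5 :* (x :* (d :^ 6 :* f :^ 6)))) refl E₅ X E F ⟩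
    E ^ 6 * (# 5 * t) ∎)

  -- Scaled so that Θ is a monic integral polynomial in Z, and so that Z^m carries the 5^m used in
  -- the base values.
  Θ Z : Series
  Θ = # 125 * t
  Z = # 5 * z

  infixl 4 _⊞_
  infixr 5 _⊠_
  infixr 6 Θ*_

  -- p lies in ℤ[Θ].
  data Polynomialᶿ : Series → Set where
    𝟏  : Polynomialᶿ (# 1)
    _⊞_  : ∀ {p q} → Polynomialᶿ p → Polynomialᶿ q → Polynomialᶿ (p + q)
    _⊠_  : ∀ c {p} → Polynomialᶿ p → Polynomialᶿ (⟨ c ⟩ * p)
    Θ*_  : ∀ {p} → Polynomialᶿ p → Polynomialᶿ (Θ * p)

  -- Membership in 5 h ℤ[Θ], with the quotient kept so that the next step can act on it.
  record Divisible (h f : Series) : Set where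
    constructor divisible
    field
      {quotient} : Series
      polynomial : Polynomialᶿ quotient
      equation   : f ≈ # 5 * (h * quotient)
  open Divisible

  divisible-≈ : ∀ {h f g} → f ≈ g → Divisible h f → Divisible h g
  divisible-≈ eq (divisible p e) = divisible p (trans (sym eq) e)

  divisible-+ : ∀ {h f g} → Divisible h f → Divisible h g → Divisible h (f + g)
  divisible-+ {h} (divisible {p} P e) (divisible {q} Q e′) = divisible (P ⊞ Q) (trans (+-cong e e′)
    (solve 3 (λ h p q → κ 5 :* (h :* p) :+ κ 5 :* (h :* q) := κ 5 :* (h :* (p :+ q))) refl h p q))

  divisible-* : ∀ c {h f} → Divisible h f → Divisible h (⟨ c ⟩ * f)
  divisible-* c {h} (divisible {p} P e) = divisible (c ⊠ P) (trans (*-congˡ e)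
    (solve 3 (λ c h p → c :* (κ 5 :* (h :* p)) := κ 5 :* (h :* (c :* p))) refl ⟨ c ⟩ h p))

  divisible-Θ : ∀ {h f} → Divisible h f → Divisible h (Θ * f)
  divisible-Θ {h} (divisible {p} P e) = divisible (Θ* P) (trans (*-congˡ e)
    (solve 3 (λ c h p → c :* (κ 5 :* (h :* p)) := κ 5 :* (h :* (c :* p))) refl Θ h p))

  Θ-in-Z : Θ ≈ # 25 * Z + # 25 * Z ^ 2 + # 15 * Z ^ 3 + # 5 * Z ^ 4 + Z ^ 5
  Θ-in-Z = trans (*-congˡ t≈z*φ) (solve 1 (λ z → κ 125 :* (z :* φᵖ z) :=
    κ 25 :* (κ 5 :* z) :+ κ 25 :* (κ 5 :* z) :^ 2 :+ κ 15 :* (κ 5 :* z) :^ 3 :+ κ 5 :* (κ 5 :* z) :^ 4 :+ (κ 5 :* z) :^ 5) refl z)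

  Z⁵ : Z ^ 5 ≈ V Θ * (# 25 + # 25 * Z + # 15 * Z ^ 2 + # 5 * Z ^ 3 + Z ^ 4)
  Z⁵ = begin
    Z ^ 5
      ≈⟨ solve 1 (λ z → (κ 5 :* z) :^ 5 := κ 3125 :* z :^ 5) refl z ⟩
    # 3125 * z ^ 5
      ≈⟨ *-congˡ s*φ≈z⁵ ⟨
    # 3125 * (s * φ)
      ≈⟨ solve 2 (λ s z → κ 3125 :* (s :* φᵖ z) :=
           κ 125 :* s :* (κ 25 :+ κ 25 :* (κ 5 :* z) :+ κ 15 :* (κ 5 :* z) :^ 2 :+ κ 5 :* (κ 5 :* z) :^ 3 :+ (κ 5 :* z) :^ 4)) refl s z ⟩
    # 125 * s * (# 25 + # 25 * Z + # 15 * Z ^ 2 + # 5 * Z ^ 3 + Z ^ 4)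
      ≈⟨ *-congʳ (trans (V-#* 125 t) (*-congˡ V-t)) ⟨
    V Θ * (# 25 + # 25 * Z + # 15 * Z ^ 2 + # 5 * Z ^ 3 + Z ^ 4) ∎

  module _ {g h : Series}
    (base₀ : Divisible h (U g)) (base₁ : Divisible h (U (g * Z))) (base₂ : Divisible h (U (g * Z ^ 2)))
    (base₃ : Divisible h (U (g * Z ^ 3))) (base₄ : Divisible h (U (g * Z ^ 4))) where

    U-combination : ∀ {f₀ f₁ f₂ f₃ f₄} → Divisible h (U f₀) → Divisible h (U f₁) → Divisible h (U f₂) → Divisible h (U f₃) →
      Divisible h (U f₄) → Divisible h (U (# 25 * f₀ + # 25 * f₁ + # 15 * f₂ + # 5 * f₃ + f₄))
    U-combination {f₀} {f₁} {f₂} {f₃} {f₄} d₀ d₁ d₂ d₃ d₄ = divisible-≈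
      (sym (trans (U-⊕ _ _) (+-congʳ (trans (U-⊕ _ _) (+-cong (trans (U-⊕ _ _) (+-cong (trans (U-⊕ _ _)
        (+-cong (U-⟨⟩⊗ (+ 25) f₀) (U-⟨⟩⊗ (+ 25) f₁))) (U-⟨⟩⊗ (+ 15) f₂))) (U-⟨⟩⊗ (+ 5) f₃))))))
      (divisible-+ (divisible-+ (divisible-+ (divisible-+ (divisible-* (+ 25) d₀) (divisible-* (+ 25) d₁)) (divisible-* (+ 15) d₂))
        (divisible-* (+ 5) d₃)) d₄)

    -- `Z⁵` replaces Z^{5+m} by lower powers times V Θ, and V Θ leaves U as Θ. Five initial values
    -- therefore suffice.
    U-Z^ : ∀ m → Divisible h (U (g * Z ^ m))
    U-Z^ 0 = divisible-≈ (U-cong (sym (*-identityʳ g))) base₀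
    U-Z^ 1 = divisible-≈ (U-cong (*-congˡ (sym (*-identityʳ Z)))) base₁
    U-Z^ 2 = base₂
    U-Z^ 3 = base₃
    U-Z^ 4 = base₄
    U-Z^ (suc (suc (suc (suc (suc m))))) = divisible-≈ (sym (begin
      U (g * Z ^ (5 ℕ.+ m))
        ≈⟨ U-cong (*-congˡ (^-homo-* Z 5 m)) ⟩
      U (g * (Z ^ 5 * Z ^ m))
        ≈⟨ U-cong (*-congˡ (*-congʳ Z⁵)) ⟩
      U (g * (V Θ * (# 25 + # 25 * Z + # 15 * Z ^ 2 + # 5 * Z ^ 3 + Z ^ 4) * Z ^ m))
        ≈⟨ U-cong (solve 4 (λ g v z r →
             g :* (v :* (κ 25 :+ κ 25 :* z :+ κ 15 :* z :^ 2 :+ κ 5 :* z :^ 3 :+ z :^ 4) :* r) :=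
             v :* (κ 25 :* (g :* r) :+ κ 25 :* (g :* (z :* r)) :+ κ 15 :* (g :* (z :* (z :* r)))
               :+ κ 5 :* (g :* (z :* (z :* (z :* r)))) :+ g :* (z :* (z :* (z :* (z :* r)))))) refl g (V Θ) Z (Z ^ m)) ⟩
      U (V Θ * (# 25 * (g * Z ^ m) + # 25 * (g * Z ^ (1 ℕ.+ m)) + # 15 * (g * Z ^ (2 ℕ.+ m)) + # 5 * (g * Z ^ (3 ℕ.+ m)) + g * Z ^ (4 ℕ.+ m)))
        ≈⟨ U-V⊗ Θ _ ⟩
      Θ * U (# 25 * (g * Z ^ m) + # 25 * (g * Z ^ (1 ℕ.+ m)) + # 15 * (g * Z ^ (2 ℕ.+ m)) + # 5 * (g * Z ^ (3 ℕ.+ m)) + g * Z ^ (4 ℕ.+ m)) ∎))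
      (divisible-Θ (U-combination (U-Z^ m) (U-Z^ (suc m)) (U-Z^ (suc (suc m))) (U-Z^ (suc (suc (suc m)))) (U-Z^ (suc (suc (suc (suc m)))))))

    -- Θ itself does not pass through U, so each Θ is rewritten by powers of Z; this raises m, hence
    -- the generality in m.
    U-Z^-polynomial : ∀ {p} → Polynomialᶿ p → ∀ m → Divisible h (U (g * Z ^ m * p))
    U-Z^-polynomial 𝟏 m = divisible-≈ (U-cong (sym (*-identityʳ _))) (U-Z^ m)
    U-Z^-polynomial (P ⊞ Q) m = divisible-≈ (trans (sym (U-⊕ _ _)) (U-cong (sym (distribˡ _ _ _))))
      (divisible-+ (U-Z^-polynomial P m) (U-Z^-polynomial Q m))
    U-Z^-polynomial (_⊠_ c {p} P) m = divisible-≈ (trans (sym (U-⟨⟩⊗ c _)) (U-cong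
      (solve 3 (λ c r p → c :* (r :* p) := r :* (c :* p)) refl ⟨ c ⟩ (g * Z ^ m) p)))
      (divisible-* c (U-Z^-polynomial P m))
    U-Z^-polynomial (Θ*_ {p} P) m = divisible-≈ (U-cong (begin
      # 25 * (g * Z ^ (1 ℕ.+ m) * p) + # 25 * (g * Z ^ (2 ℕ.+ m) * p) + # 15 * (g * Z ^ (3 ℕ.+ m) * p) + # 5 * (g * Z ^ (4 ℕ.+ m) * p) + g * Z ^ (5 ℕ.+ m) * p
        ≈⟨ solve 4 (λ g z r p → κ 25 :* (g :* (z :* r) :* p) :+ κ 25 :* (g :* (z :* (z :* r)) :* p) :+ κ 15 :* (g :* (z :* (z :* (z :* r))) :* p)
               :+ κ 5 :* (g :* (z :* (z :* (z :* (z :* r)))) :* p) :+ g :* (z :* (z :* (z :* (z :* (z :* r))))) :* p :=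
             g :* r :* ((κ 25 :* z :+ κ 25 :* z :^ 2 :+ κ 15 :* z :^ 3 :+ κ 5 :* z :^ 4 :+ z :^ 5) :* p)) refl g Z (Z ^ m) p ⟩
      g * Z ^ m * ((# 25 * Z + # 25 * Z ^ 2 + # 15 * Z ^ 3 + # 5 * Z ^ 4 + Z ^ 5) * p)
        ≈⟨ *-congˡ (*-congʳ Θ-in-Z) ⟨
      g * Z ^ m * (Θ * p) ∎))
      (U-combination (U-Z^-polynomial P (1 ℕ.+ m)) (U-Z^-polynomial P (2 ℕ.+ m)) (U-Z^-polynomial P (3 ℕ.+ m))
        (U-Z^-polynomial P (4 ℕ.+ m)) (U-Z^-polynomial P (5 ℕ.+ m)))

    U-polynomial : ∀ {p} → Polynomialᶿ p → Divisible h (U (g * p))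
    U-polynomial P = divisible-≈ (U-cong (*-congʳ (*-identityʳ g))) (U-Z^-polynomial P 0)

  divisible-k : ∀ c {f} → f ≈ ⟨ c ⟩ * k → Divisible k (# 5 * f)
  divisible-k c eq = divisible (c ⊠ 𝟏) (trans (*-congˡ eq)
    (solve 2 (λ c k → κ 5 :* (c :* k) := κ 5 :* (k :* (c :* κ 1))) refl ⟨ c ⟩ k))

  U-# : ∀ n f → U (# n * f) ≈ # n * U f
  U-# n = U-⟨⟩⊗ (+ n)

  divisible-power : ∀ m c {f g} → g ≈ # (5 ℕ.* m) * f → U f ≈ ⟨ c ⟩ * k → Divisible k (U g)
  divisible-power m c {f} {g} eq Uf = divisible-≈
    (sym (trans (U-cong eq) (trans (U-# (5 ℕ.* m) f) (trans (*-congʳ (#-* 5 m)) (*-assoc _ _ _)))))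
    (divisible-k (+ m ℤ.* c) (trans (*-congˡ Uf) (trans (sym (*-assoc _ _ _)) (*-congʳ (sym (⟨⟩-* (+ m) c))))))

  -- At Z⁰ the factor 5 comes from `U-XE⁴`; at higher powers it comes from the scaling of Z, once z
  -- E is read as y.
  U-odd : ∀ {p} → Polynomialᶿ p → Divisible k (U (X * E ^ 4 * p))
  U-odd = U-polynomial
    (divisible (ℤ.- + 1 ⊠ 𝟏) (trans U-XE⁴ (solve 1 (λ k → con (ℤ.- + 5) :* k := κ 5 :* (k :* (con (ℤ.- + 1) :* κ 1))) refl k)))
    (divisible-power 1 (+ 5) (trans (solve 3 (λ x e z → x :* e :^ 4 :* (κ 5 :* z) := κ 5 :* (x :* (e :^ 3 :* (z :* e)))) refl X E z)
      (*-congˡ (*-congˡ (*-congˡ (sym y≈z*E))))) U-XE³y)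
    (divisible-power 5 (ℤ.- + 1) (trans (solve 3 (λ x e z → x :* e :^ 4 :* (κ 5 :* z) :^ 2 := κ 25 :* (x :* (e :^ 2 :* (z :* e) :^ 2))) refl X E z)
      (*-congˡ (*-congˡ (*-congˡ (^-congˡ 2 (sym y≈z*E)))))) U-XE²y²)
    (divisible-power 25 (ℤ.- + 1) (trans (solve 3 (λ x e z → x :* e :^ 4 :* (κ 5 :* z) :^ 3 := κ 125 :* (x :* (e :* (z :* e) :^ 3))) refl X E z)
      (*-congˡ (*-congˡ (*-congˡ (^-congˡ 3 (sym y≈z*E)))))) U-XEy³)
    (divisible-power 125 (+ 1) (trans (solve 3 (λ x e z → x :* e :^ 4 :* (κ 5 :* z) :^ 4 := κ 625 :* (x :* (z :* e) :^ 4)) refl X E z)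
      (*-congˡ (*-congˡ (^-congˡ 4 (sym y≈z*E))))) (trans U-Xy⁴ (sym (*-identityˡ k))))

  U-even : ∀ {p} → Polynomialᶿ p → Divisible k (U (X * (E ^ 3 * y) * p))
  U-even = U-polynomial
    (divisible 𝟏 (trans U-XE³y (*-congˡ (sym (*-identityʳ k)))))
    (divisible-power 1 (ℤ.- + 1) (trans (solve 4 (λ x e y z → x :* (e :^ 3 :* y) :* (κ 5 :* z) := κ 5 :* (x :* (e :^ 2 :* (y :* (z :* e))))) refl X E y z)
      (*-congˡ (*-congˡ (*-congˡ (trans (*-congˡ (sym y≈z*E)) (*-congˡ (sym (*-identityʳ y)))))))) U-XE²y²)
    (divisible-power 5 (ℤ.- + 1) (trans (solve 4 (λ x e y z → x :* (e :^ 3 :* y) :* (κ 5 :* z) :^ 2 := κ 25 :* (x :* (e :* (y :* (z :* e) :^ 2)))) refl X E y z)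
      (*-congˡ (*-congˡ (*-congˡ (*-congˡ (^-congˡ 2 (sym y≈z*E))))))) U-XEy³)
    (divisible-power 25 (+ 1) (trans (solve 4 (λ x e y z → x :* (e :^ 3 :* y) :* (κ 5 :* z) :^ 3 := κ 125 :* (x :* (y :* (z :* e) :^ 3))) refl X E y z)
      (*-congˡ (*-congˡ (*-congˡ (^-congˡ 3 (sym y≈z*E)))))) (trans U-Xy⁴ (sym (*-identityˡ k))))
    -- Here y z³ E³ = y⁴ leaves one z over, so `U-z` enters; 625 · 5 t = 25 Θ.
    (divisible (+ 5 ⊠ (Θ* 𝟏)) (begin
      U (X * (E ^ 3 * y) * Z ^ 4)
        ≈⟨ U-cong (trans (solve 4 (λ x e y z → x :* (e :^ 3 :* y) :* (κ 5 :* z) :^ 4 := κ 625 :* (x :* (y :* (z :* e) :^ 3) :* z)) refl X E y z)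
             (*-congˡ (*-congʳ (trans (*-congˡ (*-congˡ (^-congˡ 3 (sym y≈z*E)))) (sym V-k))))) ⟩
      U (# 625 * (V k * z))
        ≈⟨ trans (U-# 625 _) (*-congˡ (trans (U-V⊗ k z) (*-congˡ U-z))) ⟩
      # 625 * (k * (# 5 * t))
        ≈⟨ solve 2 (λ k t → κ 625 :* (k :* (κ 5 :* t)) := κ 5 :* (k :* (κ 5 :* (κ 125 :* t :* κ 1)))) refl k t ⟩
      # 5 * (k * (# 5 * (Θ * # 1))) ∎))

  -- Up to a power of q these are η(τ)⁴ η(5τ)³ and η(τ)³ η(5τ)⁴, the generators for odd and even
  -- numbers of extractions.
  o e : Series
  o = X * (E ^ 4 * E₅ ^ 3)
  e = X * (E ^ 3 * E₅ ^ 4)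

  U-o : ∀ {p} → Polynomialᶿ p → Divisible e (U (o * p))
  U-o {p} P = divisible (polynomial (U-odd P)) (begin
    U (X * (E ^ 4 * E₅ ^ 3) * p)
      ≈⟨ U-cong (trans (solve 4 (λ x a b p → x :* (a :* b) :* p := b :* (x :* a :* p)) refl X (E ^ 4) (E₅ ^ 3) p) (*-congʳ (sym (V-^ E 3)))) ⟩
    U (V (E ^ 3) * (X * E ^ 4 * p))
      ≈⟨ trans (U-V⊗ _ _) (*-congˡ (equation (U-odd P))) ⟩
    E ^ 3 * (# 5 * (k * q))
      ≈⟨ solve 4 (λ a x b q → a :* (κ 5 :* (x :* b :* q)) := κ 5 :* (x :* (a :* b) :* q)) refl (E ^ 3) X (E₅ ^ 4) q ⟩
    # 5 * (e * q) ∎)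
    where q = quotient (U-odd P)

  U-Xe : ∀ {p} → Polynomialᶿ p → Divisible o (U (X * (e * p)))
  U-Xe {p} P = divisible (polynomial (U-even P)) (begin
    U (X * (X * (E ^ 3 * E₅ ^ 4) * p))
      -- Inserting E₂₅ F₂₅ = 1 turns the second X into the y of `U-even`; the remaining F₂₅ joins
      -- E₅⁴ in V(E⁴ F₅).
      ≈⟨ U-cong (trans (sym (*-identityʳ _)) (*-congˡ (sym E₂₅-F₂₅))) ⟩
    U (X * (X * (E ^ 3 * E₅ ^ 4) * p) * (E₂₅ * F₂₅))
      ≈⟨ U-cong (trans (solve 6 (λ x a b p k f → x :* (x :* (a :* b) :* p) :* (k :* f) := b :* f :* (x :* (a :* (x :* k)) :* p)) refl X (E ^ 3) (E₅ ^ 4) p E₂₅ F₂₅) (*-congʳ (trans (*-congʳ (sym (V-^ E 4))) (sym (V-* _ _))))) ⟩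
    U (V (E ^ 4 * F₅) * (X * (E ^ 3 * y) * p))
      ≈⟨ trans (U-V⊗ _ _) (*-congˡ (equation (U-even P))) ⟩
    E ^ 4 * F₅ * (# 5 * (k * q))
      ≈⟨ solve 5 (λ a f x d q → a :* f :* (κ 5 :* (x :* d :^ 4 :* q)) := κ 5 :* (x :* (a :* d :^ 3) :* q) :* (d :* f)) refl (E ^ 4) F₅ X E₅ q ⟩
    # 5 * (o * q) * (E₅ * F₅)
      ≈⟨ trans (*-congˡ E₅-F₅) (*-identityʳ _) ⟩
    # 5 * (o * q) ∎)
    where q = quotient (U-even P)

  -- By `norm₁*E₅≈E⁶` this is `norm₁`, so V τ = E w.
  τ : Series
  τ = E ^ 6 * F₅

  -- Division of x e⁹ by the polynomial e w - t of degree five in e.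
  ninth-power : ∀ x e y t →
    e * (e ^ 4 + # 5 * (e ^ 3 * y) + # 15 * (e ^ 2 * y ^ 2) + # 25 * (e * y ^ 3) + # 25 * y ^ 4) - t ≈ # 0 →
    x * e ^ 9 ≈ t * (x * e ^ 4 + ⟨ ℤ.- + 5 ⟩ * (x * (e ^ 3 * y)) + # 10 * (x * (e ^ 2 * y ^ 2)) + ⟨ ℤ.- + 50 ⟩ * (x * y ^ 4))
      + y ^ 5 * (# 125 * (x * e ^ 4) + # 500 * (x * (e ^ 3 * y)) + # 1250 * (x * (e ^ 2 * y ^ 2)) + # 1250 * (x * (e * y ^ 3)))
  ninth-power x e y t relation = trans (*-congˡ (solve 3 (λ e y t → e :^ 9 :=
      t :* (e :^ 4 :+ con (ℤ.- + 5) :* (e :^ 3 :* y) :+ κ 10 :* (e :^ 2 :* y :^ 2) :+ con (ℤ.- + 50) :* y :^ 4)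
      :+ y :^ 5 :* (κ 125 :* e :^ 4 :+ κ 500 :* (e :^ 3 :* y) :+ κ 1250 :* (e :^ 2 :* y :^ 2) :+ κ 1250 :* (e :* y :^ 3))
      :+ (e :* (e :^ 4 :+ κ 5 :* (e :^ 3 :* y) :+ κ 15 :* (e :^ 2 :* y :^ 2) :+ κ 25 :* (e :* y :^ 3) :+ κ 25 :* y :^ 4) :- t)
        :* (e :^ 4 :- κ 5 :* (e :^ 3 :* y) :+ κ 10 :* (e :^ 2 :* y :^ 2) :- κ 50 :* y :^ 4)) refl e y t))
    (trans (*-congˡ (+-congˡ (*-congʳ relation))) (solve 9 (λ x t p q r s y v c →
      x :* (t :* (p :+ con (ℤ.- + 5) :* q :+ κ 10 :* r :+ con (ℤ.- + 50) :* s)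
        :+ y :* (κ 125 :* p :+ κ 500 :* q :+ κ 1250 :* r :+ κ 1250 :* v) :+ κ 0 :* c) :=
      t :* (x :* p :+ con (ℤ.- + 5) :* (x :* q) :+ κ 10 :* (x :* r) :+ con (ℤ.- + 50) :* (x :* s))
        :+ y :* (κ 125 :* (x :* p) :+ κ 500 :* (x :* q) :+ κ 1250 :* (x :* r) :+ κ 1250 :* (x :* v))) refl
      x t (e ^ 4) (e ^ 3 * y) (e ^ 2 * y ^ 2) (y ^ 4) (y ^ 5) (e * y ^ 3)
      (e ^ 4 - # 5 * (e ^ 3 * y) + # 10 * (e ^ 2 * y ^ 2) - # 50 * y ^ 4)))

  -- With V τ = E w and y⁵ = V(X E₅⁵), both coefficients in `ninth-power` leave U, and only values
  -- of degree four in E and y remain; -90 and -625 are their weighted sums.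
  U-XE⁹ : U (X * E ^ 9) ≈ k * (⟨ ℤ.- + 90 ⟩ * τ + ⟨ ℤ.- + 625 ⟩ * (X * E₅ ^ 5))
  U-XE⁹ = begin
    U (X * E ^ 9)
      ≈⟨ U-cong (ninth-power X E y (V τ) Ew-Vτ) ⟩
    U (V τ * f + y ^ 5 * g)
      ≈⟨ trans (U-⊕ _ _) (+-cong (U-V⊗ τ f) (trans (U-cong (*-congʳ (sym V-Xe⁵))) (U-V⊗ _ g))) ⟩
    τ * U f + X * E₅ ^ 5 * U g
      ≈⟨ +-cong (*-congˡ (trans (U-⊕ _ _) (+-cong (trans (U-⊕ _ _) (+-cong (trans (U-⊕ _ _)
             (+-cong U-XE⁴ (scaled (ℤ.- + 5) U-XE³y))) (scaled (+ 10) U-XE²y²))) (scaled (ℤ.- + 50) U-Xy⁴))))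
           (*-congˡ (trans (U-⊕ _ _) (+-cong (trans (U-⊕ _ _) (+-cong (trans (U-⊕ _ _)
             (+-cong (scaled (+ 125) U-XE⁴) (scaled (+ 500) U-XE³y))) (scaled (+ 1250) U-XE²y²))) (scaled (+ 1250) U-XEy³)))) ⟩
    τ * (⟨ ℤ.- + 5 ⟩ * k + ⟨ ℤ.- + 5 ⟩ * (# 5 * k) + # 10 * (⟨ ℤ.- + 1 ⟩ * k) + ⟨ ℤ.- + 50 ⟩ * k)
      + X * E₅ ^ 5 * (# 125 * (⟨ ℤ.- + 5 ⟩ * k) + # 500 * (# 5 * k) + # 1250 * (⟨ ℤ.- + 1 ⟩ * k) + # 1250 * (⟨ ℤ.- + 1 ⟩ * k))
      ≈⟨ solve 3 (λ t v k →
           t :* (con (ℤ.- + 5) :* k :+ con (ℤ.- + 5) :* (κ 5 :* k) :+ κ 10 :* (con (ℤ.- + 1) :* k) :+ con (ℤ.- + 50) :* k)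
           :+ v :* (κ 125 :* (con (ℤ.- + 5) :* k) :+ κ 500 :* (κ 5 :* k) :+ κ 1250 :* (con (ℤ.- + 1) :* k) :+ κ 1250 :* (con (ℤ.- + 1) :* k)) :=
           k :* (con (ℤ.- + 90) :* t :+ con (ℤ.- + 625) :* v)) refl τ (X * E₅ ^ 5) k ⟩
    k * (⟨ ℤ.- + 90 ⟩ * τ + ⟨ ℤ.- + 625 ⟩ * (X * E₅ ^ 5)) ∎
    where
    f = X * E ^ 4 + ⟨ ℤ.- + 5 ⟩ * (X * (E ^ 3 * y)) + # 10 * (X * (E ^ 2 * y ^ 2)) + ⟨ ℤ.- + 50 ⟩ * (X * y ^ 4)
    g = # 125 * (X * E ^ 4) + # 500 * (X * (E ^ 3 * y)) + # 1250 * (X * (E ^ 2 * y ^ 2)) + # 1250 * (X * (E * y ^ 3))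
    scaled : ∀ c {f g} → U f ≈ g → U (⟨ c ⟩ * f) ≈ ⟨ c ⟩ * g
    scaled c eq = trans (U-⟨⟩⊗ c _) (*-congˡ eq)
    V-Xe⁵ : V (X * E₅ ^ 5) ≈ y ^ 5
    V-Xe⁵ = trans (V-* _ _) (trans (*-cong (dilate-X 5) (V-^ E₅ 5)) (solve 2 (λ x e → x :^ 5 :* e :^ 5 := (x :* e) :^ 5) refl X E₂₅))
    Ew-Vτ : E * w - V τ ≈ # 0
    Ew-Vτ = trans (+-congˡ (-‿cong (begin
      V τ                    ≈⟨ trans (V-* _ _) (*-congʳ (trans (V-^ E 6) E₅⁶)) ⟩
      E₂₅ * (E * w) * F₂₅    ≈⟨ solve 3 (λ k w f → k :* w :* f := w :* (k :* f)) refl E₂₅ (E * w) F₂₅ ⟩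
      E * w * (E₂₅ * F₂₅)    ≈⟨ trans (*-congˡ E₂₅-F₂₅) (*-identityʳ _) ⟩
      E * w                  ∎))) (-‿inverseʳ (E * w))

  mutual
    -- U (X f) reads f at 5 n - 1 for n ≥ 1. Alternating it with plain U runs through the solutions
    -- of 24 N ≡ 1 modulo successive powers of 5.
    L-even L-odd : ℕ → Series
    L-even zero    = E₄ * F
    L-even (suc j) = U (L-odd j)
    L-odd j = U (X * L-even j)

  -- Since E⁹ F₅² t = `e`, the t and t² terms of E₄/E lie in e ℤ[Θ] and fall under `U-Xe`; the
  -- leading term E⁹ F₅² does not, and is evaluated by `U-XE⁹`.
  L-odd-0 : Divisible o (L-odd 0)
  L-odd-0 = divisible-≈ (sym split) (divisible-+
    (divisible ((ℤ.- + 18 ⊠ 𝟏) ⊞ (ℤ.- + 1 ⊠ (Θ* 𝟏))) leading)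
    (U-Xe ((+ 250 ⊠ 𝟏) ⊞ (+ 25 ⊠ (Θ* 𝟏)))))
    where
    q = # 250 * # 1 + # 25 * (Θ * # 1)
    split : L-odd 0 ≈ F ^ 2 * U (X * E ^ 9) + U (X * (e * q))
    split = begin
      U (X * (E₄ * F))
        ≈⟨ U-cong (*-congˡ (*-congʳ E₄-eta)) ⟩
      U (X * (E ^ 10 * F₅ ^ 2 * quadratic 250 3125 t * F))
        ≈⟨ U-cong (solve 5 (λ x e g t f → x :* (e :^ 10 :* g :^ 2 :* (κ 1 :+ κ 250 :* t :+ κ 3125 :* t :^ 2) :* f) :=
             g :^ 2 :* (x :* e :^ 9) :* (e :* f) :+ x :* (e :^ 9 :* g :^ 2 :* t :* (κ 250 :* κ 1 :+ κ 25 :* (κ 125 :* t :* κ 1))) :* (e :* f)) refl X E F₅ t F) ⟩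
      U (F₅ ^ 2 * (X * E ^ 9) * (E * F) + X * (E ^ 9 * F₅ ^ 2 * t * q) * (E * F))
        ≈⟨ U-cong (+-cong (trans (*-congˡ E-invPoch) (trans (*-identityʳ _) (*-congʳ (sym (V-^ F 2)))))
             (trans (*-congˡ E-invPoch) (trans (*-identityʳ _) (*-congˡ (*-congʳ E⁹F₅²t))))) ⟩
      U (V (F ^ 2) * (X * E ^ 9) + X * (e * q))
        ≈⟨ trans (U-⊕ _ _) (+-congʳ (U-V⊗ _ _)) ⟩
      F ^ 2 * U (X * E ^ 9) + U (X * (e * q)) ∎
      where
      E⁹F₅²t : E ^ 9 * F₅ ^ 2 * t ≈ e
      E⁹F₅²t = trans (solve 5 (λ e g x d f → e :^ 9 :* g :^ 2 :* (x :* (d :^ 6 :* f :^ 6)) := x :* (e :^ 3 :* d :^ 4) :* ((d :* g) :^ 2 :* (e :* f) :^ 6)) refl E F₅ X E₅ F) (trans (*-congˡ (trans (*-cong (unit-^ E₅-F₅ 2) (unit-^ E-invPoch 6)) (*-identityʳ _))) (*-identityʳ _))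
    leading : F ^ 2 * U (X * E ^ 9) ≈ # 5 * (o * (⟨ ℤ.- + 18 ⟩ * # 1 + ⟨ ℤ.- + 1 ⟩ * (Θ * # 1)))
    leading = begin
      F ^ 2 * U (X * E ^ 9)
        ≈⟨ *-congˡ U-XE⁹ ⟩
      F ^ 2 * (k * (⟨ ℤ.- + 90 ⟩ * τ + ⟨ ℤ.- + 625 ⟩ * (X * E₅ ^ 5)))
        ≈⟨ solve 5 (λ f x d e g → f :^ 2 :* (x :* d :^ 4 :* (con (ℤ.- + 90) :* (e :^ 6 :* g) :+ con (ℤ.- + 625) :* (x :* d :^ 5))) :=
             con (ℤ.- + 90) :* (x :* (e :^ 4 :* d :^ 3)) :* ((e :* f) :^ 2 :* (d :* g)) :+ con (ℤ.- + 625) :* (f :^ 2 :* x :^ 2 :* d :^ 9)) refl F X E₅ E F₅ ⟩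
      ⟨ ℤ.- + 90 ⟩ * o * ((E * F) ^ 2 * (E₅ * F₅)) + ⟨ ℤ.- + 625 ⟩ * (F ^ 2 * X ^ 2 * E₅ ^ 9)
        ≈⟨ +-cong (*-congˡ (*-cong (unit-^ E-invPoch 2) E₅-F₅)) (*-congˡ (trans (sym (*-identityʳ _)) (*-congˡ (sym (unit-^ E-invPoch 4))))) ⟩
      ⟨ ℤ.- + 90 ⟩ * o * (# 1 * # 1) + ⟨ ℤ.- + 625 ⟩ * (F ^ 2 * X ^ 2 * E₅ ^ 9 * (E * F) ^ 4)
        ≈⟨ solve 4 (λ x e d f → con (ℤ.- + 90) :* (x :* (e :^ 4 :* d :^ 3)) :* (κ 1 :* κ 1) :+ con (ℤ.- + 625) :* (f :^ 2 :* x :^ 2 :* d :^ 9 :* (e :* f) :^ 4) :=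
             κ 5 :* (x :* (e :^ 4 :* d :^ 3) :* (con (ℤ.- + 18) :* κ 1 :+ con (ℤ.- + 1) :* (κ 125 :* (x :* (d :^ 6 :* f :^ 6)) :* κ 1)))) refl X E E₅ F ⟩
      # 5 * (o * (⟨ ℤ.- + 18 ⟩ * # 1 + ⟨ ℤ.- + 1 ⟩ * (Θ * # 1))) ∎

  -- Membership in N h ℤ[Θ], the invariant of the iteration with N a power of 5.
  record Multiple (N : ℕ) (h f : Series) : Set where
    constructor multiple
    field
      {quotient} : Series
      polynomial : Polynomialᶿ quotient
      equation   : f ≈ # N * (h * quotient)

  U-multiple : ∀ N {h h′ f} g → (∀ {p} → Polynomialᶿ p → Divisible h′ (U (g * (h * p)))) →
               Multiple N h f → Multiple (5 ℕ.* N) h′ (U (g * f))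
  U-multiple N {h} {h′} {f} g step (multiple {p} P eq) = multiple (polynomial (step P)) (begin
    U (g * f)                    ≈⟨ U-cong (trans (*-congˡ eq) (solve 4 (λ g n h p → g :* (n :* (h :* p)) := n :* (g :* (h :* p))) refl g (# N) h p)) ⟩
    U (# N * (g * (h * p)))      ≈⟨ U-# N _ ⟩
    # N * U (g * (h * p))        ≈⟨ *-congˡ (equation (step P)) ⟩
    # N * (# 5 * (h′ * q))       ≈⟨ solve 3 (λ n h q → n :* (κ 5 :* (h :* q)) := κ 5 :* n :* (h :* q)) refl (# N) h′ q ⟩
    # 5 * # N * (h′ * q)         ≈⟨ *-congʳ (#-* 5 N) ⟨
    # (5 ℕ.* N) * (h′ * q)       ∎)
    where q = quotient (step P)

  multiple-≈ : ∀ {N h f g} → f ≈ g → Multiple N h f → Multiple N h g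
  multiple-≈ eq (multiple P e) = multiple P (trans (sym eq) e)

  L-odd-multiple  : ∀ j → Multiple (5 ℕ.^ suc (j ℕ.+ j)) o (L-odd j)
  L-even-multiple : ∀ j → Multiple (5 ℕ.^ (suc j ℕ.+ suc j)) e (L-even (suc j))

  L-odd-multiple zero    = multiple (polynomial L-odd-0) (equation L-odd-0)
  L-odd-multiple (suc j) = U-multiple (5 ℕ.^ (suc j ℕ.+ suc j)) X U-Xe (L-even-multiple j)

  L-even-multiple j = ≡.subst (λ n → Multiple (5 ℕ.^ suc n) e (L-even (suc j))) (≡.sym (ℕₚ.+-suc j j))
    (multiple-≈ (U-cong (*-identityˡ (L-odd j))) (U-multiple (5 ℕ.^ suc (j ℕ.+ j)) (# 1)
      (λ P → step P) (L-odd-multiple j)))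
    where
    step : ∀ {p} → Polynomialᶿ p → Divisible e (U (# 1 * (o * p)))
    step P = divisible-≈ (U-cong (sym (*-identityˡ _))) (U-o P)

-- From the iterated series to coefficients in the progression.

module Congruence where
  open PowerSeries
  open Operators
  open EulerProduct
  open Iteration
  open import Data.Empty using (⊥-elim)
  open import Data.Integer as ℤ using (+_)
  import Data.Integer.Properties as ℤₚ
  open import Data.Integer.Divisibility using () renaming (_∣_ to _∣ℤ_)
  open import Data.Nat
  open import Data.Nat.Divisibility
  open import Data.Nat.Properties
  open import Data.Nat.Tactic.RingSolver using (solve-∀)
  open import Data.Product using (∃-syntax; _,_)
  open import Data.Sum using (_⊎_; inj₁; inj₂)
  open import Relation.Binary.PropositionalEquality hiding ([_])

  multiple-∣ : ∀ {N h f} → Multiple N h f → ∀ n → + N ∣ℤ f n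
  multiple-∣ {N} {h} {f} (multiple {q} _ eq) n = divides ℤ.∣ (h ⊗ q) n ∣ (begin
    ℤ.∣ f n ∣                     ≡⟨ cong ℤ.∣_∣ (trans (at eq n) (⟨⟩⊗-at (+ N) (h ⊗ q) n)) ⟩
    ℤ.∣ + N ℤ.* (h ⊗ q) n ∣       ≡⟨ ℤₚ.abs-* (+ N) ((h ⊗ q) n) ⟩
    N * ℤ.∣ (h ⊗ q) n ∣           ≡⟨ *-comm N _ ⟩
    ℤ.∣ (h ⊗ q) n ∣ * N           ∎)
    where open ≡-Reasoning

  -- With index 24 m - 1 at even steps and 24 m - 5 at odd steps, L extracts the coefficients of e₄ at N = (5^k · index + 1) / 24.
  L-even-at : ∀ j m N → 24 * N + 5 ^ (j + j) ≡ 5 ^ (j + j) * (24 * m) + 1 → L-even j m ≡ e₄ N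
  L-odd-at  : ∀ j m N → 24 * N + 5 * 5 ^ suc (j + j) ≡ 5 ^ suc (j + j) * (24 * m) + 1 → L-odd j m ≡ e₄ N

  L-even-at zero m N eq = trans (⊗-at E₄ invPoch m)
    (cong e₄ (sym (*-cancelˡ-≡ N m 24 (trans (+-cancelʳ-≡ 1 (24 * N) _ eq) (+-identityʳ (24 * m))))))
  L-even-at (suc j) m N eq = trans (U-at (L-odd j) m) (L-odd-at j (m * 5) N (trans
    (cong (λ i → 24 * N + 5 ^ i) (sym (cong suc (+-suc j j))))
    (trans eq (trans (cong (λ i → 5 ^ suc i * (24 * m) + 1) (+-suc j j)) (regroup (5 ^ suc (j + j)) m)))))
    where
    regroup : ∀ q m → 5 * q * (24 * m) + 1 ≡ q * (24 * (m * 5)) + 1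
    regroup = solve-∀

  -- Index 0 is impossible: the left side of the equation is at least 25 and the right side is 1.
  L-odd-at j zero N eq = ⊥-elim (<-irrefl refl (≤-trans (s≤s (s≤s z≤n))
    (≤-trans (*-monoʳ-≤ 5 (*-monoʳ-≤ 5 (>-nonZero⁻¹ (5 ^ (j + j)) {{m^n≢0 5 (j + j)}})))
      (≤-trans (m≤n+m _ (24 * N)) (≤-reflexive (trans eq (cong (_+ 1) (*-zeroʳ (5 ^ suc (j + j))))))))))
  L-odd-at j (suc m) N eq = trans (U-at (X ⊗ L-even j) (suc m)) (trans (X⊗-suc (L-even j) (4 + m * 5))
    (L-even-at j (4 + m * 5) N (+-cancelʳ-≡ (24 * 5 ^ (j + j)) _ _
      (trans (left N (5 ^ (j + j))) (trans eq (right (5 ^ (j + j)) m))))))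
    where
    left : ∀ N q → 24 * N + q + 24 * q ≡ 24 * N + 5 * (5 * q)
    left = solve-∀
    right : ∀ q m → 5 * q * (24 * suc m) + 1 ≡ q * (24 * (4 + m * 5)) + 1 + 24 * q
    right = solve-∀

  -- 25 is 1 modulo 24; the odd powers of 5 are accordingly 5 modulo 24.
  5^2j : ∀ j → ∃[ u ] 5 ^ (j + j) ≡ 24 * u + 1
  5^2j zero = 0 , refl
  5^2j (suc j) with 5^2j j
  ... | u , eq = 25 * u + 1 , trans (cong (5 ^_) (cong suc (+-suc j j))) (trans (cong (λ q → 5 * (5 * q)) eq) (regroup u))
    where
    regroup : ∀ u → 5 * (5 * (24 * u + 1)) ≡ 24 * (25 * u + 1) + 1
    regroup = solve-∀

  halve : ∀ k → ∃[ j ] (k ≡ j + j ⊎ k ≡ suc (j + j))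
  halve zero = 0 , inj₁ refl
  halve (suc k) with halve k
  ... | j , inj₁ refl = j , inj₂ refl
  ... | j , inj₂ refl = suc j , inj₁ (cong suc (sym (+-suc j j)))

  24*δ : ∀ {c q δ} → 0 < δ → 24 * δ ∸ 1 ≡ c * q → 24 * δ ≡ c * q + 1
  24*δ {δ = suc δ} _ eq = trans (sym (m∸n+n≡m {24 * suc δ} {1} (s≤s z≤n))) (cong (_+ 1) eq)

  -- Modulo 24, q = 1 turns c q + 1 = 0 into c = -1; the witness is m = n + (c + 1) / 24.
  even-index : ∀ u n δ c {q} → q ≡ 24 * u + 1 → 24 * δ ≡ c * q + 1 →
    ∃[ m ] 24 * (q * n + δ) + q ≡ q * (24 * m) + 1
  even-index u n δ c {q} q≡24u+1 24δ≡cq+1 = solution (∣m+n∣m⇒∣n {24} {24 * (c * u)} 24∣ (m∣m*n (c * u)))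
    where
    open ≡-Reasoning
    split : ∀ c u → 24 * (c * u) + (c + 1) ≡ c * (24 * u + 1) + 1
    split = solve-∀
    24∣ : 24 ∣ 24 * (c * u) + (c + 1)
    24∣ = divides δ (begin
      24 * (c * u) + (c + 1)    ≡⟨ split c u ⟩
      c * (24 * u + 1) + 1      ≡⟨ cong (λ x → c * x + 1) q≡24u+1 ⟨
      c * q + 1                 ≡⟨ 24δ≡cq+1 ⟨
      24 * δ                    ≡⟨ *-comm 24 δ ⟩
      δ * 24                    ∎)
    expand : ∀ q n δ → 24 * (q * n + δ) + q ≡ 24 * (q * n) + 24 * δ + q
    expand = solve-∀
    collect : ∀ q n c → 24 * (q * n) + (c * q + 1) + q ≡ 24 * (q * n) + (c + 1) * q + 1
    collect = solve-∀
    refactor : ∀ q n d → 24 * (q * n) + d * 24 * q + 1 ≡ q * (24 * (n + d)) + 1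
    refactor = solve-∀
    solution : 24 ∣ c + 1 → ∃[ m ] 24 * (q * n + δ) + q ≡ q * (24 * m) + 1
    solution (divides d c+1≡d*24) = n + d , (begin
      24 * (q * n + δ) + q            ≡⟨ expand q n δ ⟩
      24 * (q * n) + 24 * δ + q       ≡⟨ cong (λ x → 24 * (q * n) + x + q) 24δ≡cq+1 ⟩
      24 * (q * n) + (c * q + 1) + q  ≡⟨ collect q n c ⟩
      24 * (q * n) + (c + 1) * q + 1  ≡⟨ cong (λ x → 24 * (q * n) + x * q + 1) c+1≡d*24 ⟩
      24 * (q * n) + d * 24 * q + 1   ≡⟨ refactor q n d ⟩
      q * (24 * (n + d)) + 1          ∎)

  -- Modulo 24, q = 5 and 25 = 1, so multiplying c q + 1 = 0 by 5 gives c = -5; the witness is m = n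
  -- + (c + 5) / 24.
  odd-index : ∀ u n δ c {q} → q ≡ 5 * (24 * u + 1) → 24 * δ ≡ c * q + 1 →
    ∃[ m ] 24 * (q * n + δ) + 5 * q ≡ q * (24 * m) + 1
  odd-index u n δ c {q} q≡ 24δ≡cq+1 =
    solution (∣m+n∣m⇒∣n {24} {24 * (c * (25 * u + 1))} 24∣ (m∣m*n (c * (25 * u + 1))))
    where
    open ≡-Reasoning
    split : ∀ c u → 24 * (c * (25 * u + 1)) + (c + 5) ≡ 5 * (c * (5 * (24 * u + 1)) + 1)
    split = solve-∀
    swap : ∀ δ → 5 * (24 * δ) ≡ 5 * δ * 24
    swap = solve-∀
    24∣ : 24 ∣ 24 * (c * (25 * u + 1)) + (c + 5)
    24∣ = divides (5 * δ) (begin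
      24 * (c * (25 * u + 1)) + (c + 5)   ≡⟨ split c u ⟩
      5 * (c * (5 * (24 * u + 1)) + 1)    ≡⟨ cong (λ x → 5 * (c * x + 1)) q≡ ⟨
      5 * (c * q + 1)                     ≡⟨ cong (5 *_) 24δ≡cq+1 ⟨
      5 * (24 * δ)                        ≡⟨ swap δ ⟩
      5 * δ * 24                          ∎)
    expand : ∀ q n δ → 24 * (q * n + δ) + 5 * q ≡ 24 * (q * n) + 24 * δ + 5 * q
    expand = solve-∀
    collect : ∀ q n c → 24 * (q * n) + (c * q + 1) + 5 * q ≡ 24 * (q * n) + (c + 5) * q + 1
    collect = solve-∀
    refactor : ∀ q n d → 24 * (q * n) + d * 24 * q + 1 ≡ q * (24 * (n + d)) + 1
    refactor = solve-∀
    solution : 24 ∣ c + 5 → ∃[ m ] 24 * (q * n + δ) + 5 * q ≡ q * (24 * m) + 1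
    solution (divides d c+5≡d*24) = n + d , (begin
      24 * (q * n + δ) + 5 * q            ≡⟨ expand q n δ ⟩
      24 * (q * n) + 24 * δ + 5 * q       ≡⟨ cong (λ x → 24 * (q * n) + x + 5 * q) 24δ≡cq+1 ⟩
      24 * (q * n) + (c * q + 1) + 5 * q  ≡⟨ collect q n c ⟩
      24 * (q * n) + (c + 5) * q + 1      ≡⟨ cong (λ x → 24 * (q * n) + x * q + 1) c+5≡d*24 ⟩
      24 * (q * n) + d * 24 * q + 1       ≡⟨ refactor q n d ⟩
      q * (24 * (n + d)) + 1              ∎)

  even-step : ∀ j n δ c → 24 * δ ≡ c * 5 ^ (suc j + suc j) + 1 →
              + (5 ^ (suc j + suc j)) ∣ℤ e₄ (5 ^ (suc j + suc j) * n + δ)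
  even-step j n δ c 24δ =
    let u , 5^≡24u+1 = 5^2j (suc j)
        m , index    = even-index u n δ c 5^≡24u+1 24δ
    in  subst (+ (5 ^ (suc j + suc j)) ∣ℤ_) (L-even-at (suc j) m (5 ^ (suc j + suc j) * n + δ) index) (multiple-∣ (L-even-multiple j) m)

  odd-step : ∀ j n δ c → 24 * δ ≡ c * 5 ^ suc (j + j) + 1 → + (5 ^ suc (j + j)) ∣ℤ e₄ (5 ^ suc (j + j) * n + δ)
  odd-step j n δ c 24δ =
    let u , 5^≡24u+1 = 5^2j j
        m , index    = odd-index u n δ c (cong (5 *_) 5^≡24u+1) 24δ
    in  subst (+ (5 ^ suc (j + j)) ∣ℤ_) (L-odd-at j m (5 ^ suc (j + j) * n + δ) index) (multiple-∣ (L-odd-multiple j) m)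

  5^k∣e₄ : ∀ k n δ → k ≥ 1 → 0 < δ → 5 ^ k ∣ (24 * δ ∸ 1) → + (5 ^ k) ∣ℤ e₄ (5 ^ k * n + δ)
  5^k∣e₄ k n δ k≥1 0<δ (divides c 24δ∸1≡c*5^k) = step {k} (halve k) k≥1 (24*δ {c} 0<δ 24δ∸1≡c*5^k)
    where
    step : ∀ {k} → ∃[ j ] (k ≡ j + j ⊎ k ≡ suc (j + j)) → k ≥ 1 → 24 * δ ≡ c * 5 ^ k + 1 → + (5 ^ k) ∣ℤ e₄ (5 ^ k * n + δ)
    step (zero  , inj₁ refl) ()
    step (suc j , inj₁ refl) _ = even-step j n δ c
    step (j     , inj₂ refl) _ = odd-step j n δ c

open import Data.Nat using (ℕ; _+_; _*_; _∸_; _^_; _<_; _≥_)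
open import Data.Nat.Divisibility using (_∣_)
open import Data.Integer using (+_)
open import Data.Integer.Divisibility using () renaming (_∣_ to _∣ℤ_)

theorem4p5 : (k n δ : ℕ) → k ≥ 1 → 0 < δ → δ < 5 ^ k → 5 ^ k ∣ (24 * δ ∸ 1) →
    + (5 ^ k) ∣ℤ e₄ (5 ^ k * n + δ)
theorem4p5 k n δ k≥1 0<δ _ = Congruence.5^k∣e₄ k n δ k≥1 0<δ
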